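{- Fix an integer $d \geq 2$. For every integer $n > d+1$, we have $A_d(n)\ge 2$ and $$A_d(n) \leq \begin{cases} n-2, & d = 2,3,\\ 2\left\lceil \frac{n}{2} \right\rceil - 3, & d = 4,5,\\ 2\left\lceil \frac{n}{\lfloor d/2 \rfloor} \right\rceil - 2, & d \geq 6.\end{cases}$$ For every integer $n$ with $3 \leq n \leq d+1$, we have $A_d(n) = 1$.
   Context: $A_d(n)$ is the minimum, over all sets $\mathcal P\subset\mathbb{R}^d$ of $n$ points that are not all collinear, of the number of distinct values in the open interval $(0,\pi)$ of angles $\angle pqr$ with $p,q,r$ distinct points of $\mathcal P$ (angles of $0$ and $\pi$ are not counted). -}

module Defs where

open import Algebra.Bundles using (CommutativeRing)
open import Data.Fin.Base using (Fin)
open import Data.Nat.Base as ℕ using (ℕ; zero; suc)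
import Data.Nat.DivMod as ℕ
open import Data.Product.Base using (∃; _×_)
open import Data.Vec.Functional using (Vector; zipWith)
open import Function.Definitions using (Injective)
open import Level using (0ℓ)
import Relation.Binary.Construct.StrictToNonStrict as StrictToNonStrict
open import Relation.Binary.Core using (Rel)
open import Relation.Binary.PropositionalEquality.Core using (_≡_; _≢_)
open import Relation.Binary.Structures using (IsStrictTotalOrder)
open import Relation.Nullary.Negation.Core using (¬_)
open import Relation.Unary using (Pred)

IsUpperBound : {A : Set} → Rel A 0ℓ → Pred A 0ℓ → A → Set
IsUpperBound _≤_ S b = ∀ x → S x → x ≤ b

IsLeastUpperBound : {A : Set} → Rel A 0ℓ → Pred A 0ℓ → A → Set
IsLeastUpperBound _≤_ S s =
  IsUpperBound _≤_ S s × (∀ b → IsUpperBound _≤_ S b → s ≤ b)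

record OrderedField : Set₁ where
  field
    commutativeRing : CommutativeRing 0ℓ 0ℓ

  open CommutativeRing commutativeRing public

  infix 4 _<_
  field
    0≉1                : ¬ 0# ≈ 1#
    inverse            : ∀ x → ¬ x ≈ 0# → ∃ λ y → x * y ≈ 1#
    _<_                : Rel Carrier 0ℓ
    isStrictTotalOrder : IsStrictTotalOrder _≈_ _<_
    +-monoˡ-<          : ∀ {x y} z → x < y → x + z < y + z
    *-pos              : ∀ {x y} → 0# < x → 0# < y → 0# < x * y

  infix 4 _≤_
  _≤_ : Rel Carrier 0ℓ
  _≤_ = StrictToNonStrict._≤_ _≈_ _<_

-- The ordered field of real numbers, given by its categorical axiomatization
-- (with setoid equality).
record CompleteOrderedField : Set₁ where
  field
    orderedField : OrderedField

  open OrderedField orderedField public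

  field
    complete : (S : Pred Carrier 0ℓ) → ∃ S → ∃ (IsUpperBound _≤_ S) →
               ∃ (IsLeastUpperBound _≤_ S)

module _ (R : CompleteOrderedField) where
  open CompleteOrderedField R
  open import Algebra.Properties.Monoid.Sum +-monoid using (sum)
  open import Data.Vec.Functional.Relation.Binary.Equality.Setoid setoid
    using (_≋_)

  Point : ℕ → Set
  Point d = Vector Carrier d

  vec : ∀ {d} → Point d → Point d → Vector Carrier d
  vec q p = zipWith _-_ p q

  ⟨_,_⟩ : ∀ {d} → Vector Carrier d → Vector Carrier d → Carrier
  ⟨ u , v ⟩ = sum (zipWith _*_ u v)

  IsSqrt : Carrier → Carrier → Set
  IsSqrt x a = 0# ≤ a × a * a ≈ x

  IsNorm : ∀ {d} → Vector Carrier d → Carrier → Set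
  IsNorm u a = IsSqrt ⟨ u , u ⟩ a

  OnUpperUnitSemicircle : Carrier → Carrier → Set
  OnUpperUnitSemicircle x y = x * x + y * y ≈ 1# × 0# ≤ y

  -- Inscribed x y l : some polygonal line of length l from (1 , 0) to (x , y)
  -- has its vertices on the upper unit semicircle, traversed counterclockwise
  -- (that is, with weakly decreasing abscissa).
  data Inscribed : Carrier → Carrier → Carrier → Set where
    start : ∀ {x y l} → x ≈ 1# → y ≈ 0# → l ≈ 0# → Inscribed x y l
    step  : ∀ {x y l x′ y′ l′ δ} →
            Inscribed x y l →
            OnUpperUnitSemicircle x′ y′ →
            x′ ≤ x →
            IsSqrt ((x′ - x) * (x′ - x) + (y′ - y) * (y′ - y)) δ →
            l′ ≈ l + δ →
            Inscribed x′ y′ l′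

  -- Radian measure: for -1 ≤ c ≤ 1, arccos c is the length of the arc of the
  -- unit circle from (1 , 0) to (c , √(1 - c²)), and the length of an arc is
  -- the least upper bound of the lengths of its inscribed polygonal lines.
  IsArccos : Carrier → Carrier → Set
  IsArccos c θ = IsLeastUpperBound _≤_ (λ l → ∃ λ y → Inscribed c y l) θ

  IsPi : Carrier → Set
  IsPi π = IsArccos (- 1#) π

  -- θ is the measure of ∠pqr, i.e. θ = arccos (⟨ p-q , r-q ⟩ / |p-q||r-q|).
  -- Meaningful only for p ≠ q and r ≠ q, as c is not determined otherwise.
  IsAngle : ∀ {d} → (p q r : Point d) → Carrier → Set
  IsAngle p q r θ =
    ∃ λ a → ∃ λ b → ∃ λ c →
      IsNorm (vec q p) a × IsNorm (vec q r) b ×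
      c * (a * b) ≈ ⟨ vec q p , vec q r ⟩ ×
      IsArccos c θ

  -- A set of n points is represented by an injective family Fin n → Point d.
  IsPointSet : ∀ {d n} → (Fin n → Point d) → Set
  IsPointSet P = Injective _≡_ _≋_ P

  Collinear : ∀ {d n} → (Fin n → Point d) → Set
  Collinear {d} P =
    ∃ λ (a : Point d) → ∃ λ (v : Vector Carrier d) →
      ¬ v ≋ (λ _ → 0#) ×
      (∀ i → ∃ λ t → P i ≋ (λ j → a j + t * v j))

  AngleValue : ∀ {d n} → (Fin n → Point d) → Pred Carrier 0ℓ
  AngleValue P θ =
    (∃ λ i → ∃ λ j → ∃ λ k →
      i ≢ j × j ≢ k × i ≢ k × IsAngle (P i) (P j) (P k) θ) ×
    0# < θ × (∃ λ π → IsPi π × θ < π)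

  HasCardinality : Pred Carrier 0ℓ → ℕ → Set
  HasCardinality S m =
    ∃ λ (f : Fin m → Carrier) →
      Injective _≡_ _≈_ f × (∀ i → S (f i)) × (∀ x → S x → ∃ λ i → x ≈ f i)

  AngleCount : ℕ → ℕ → ℕ → Set
  AngleCount d n m =
    ∃ λ (P : Fin n → Point d) →
      IsPointSet P × ¬ Collinear P × HasCardinality (AngleValue P) m

  -- A_d(n) = a
  IsA : ℕ → ℕ → ℕ → Set
  IsA d n a = AngleCount d n a × (∀ m → AngleCount d n m → a ℕ.≤ m)

-- The ceiling of n / m; the value at m = 0 is a junk value.
⌈_÷_⌉ : ℕ → ℕ → ℕ
⌈ n ÷ zero ⌉  = 0
⌈ n ÷ suc m ⌉ = (n ℕ.+ m) ℕ./ suc m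

{-# OPTIONS --safe #-}

-- Prolonging an inscribed polygonal line by a chord shows that arccos is
-- strictly decreasing. Counting angles in (0, π) is therefore counting cosines
-- in (-1, 1), and by the law of cosines these depend only on mutual distances.
--
-- Lower bound. If only one angle occurs, every nondegenerate triangle is
-- equiangular, hence equilateral; then no three points are collinear, all
-- distances are equal, and positive definiteness of the Gram matrix I + J
-- leaves room for at most d + 1 points.
--
-- Upper bounds. A regular simplex has only one angle. For n > d + 1, Lenz'
-- configuration places regular m-gons on unit circles in ⌊d/2⌋ pairwise
-- orthogonal planes. With α = π / m its cosines are cos kα (1 ≤ k ≤ m - 2)
-- inside a circle, cos² kα (k ≤ (m - 1)/2) and (sin kα)/√2 (k ≤ m/2) for two
-- circles, and 1/2 for three circles. The angle α comes from the largest root of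
-- the Chebyshev polynomial of the second kind U_{m-1}.
module Submission where

open import Defs
open import Algebra.Bundles using (CommutativeRing)
open import Axiom.ExcludedMiddle using (ExcludedMiddle)
open import Data.Empty using (⊥; ⊥-elim)
open import Data.Fin.Base using (Fin; zero; suc; toℕ; punchIn; inject≤; remQuot; combine)
open import Data.Fin.Properties
  using (any?; punchInᵢ≢i; inject≤-injective; toℕ<n; toℕ-injective; combine-remQuot)
  renaming (_≟_ to _≟ᶠ_; suc-injective to sucᶠ-injective)
import Data.Integer.Base as ℤ
import Data.Integer.Properties as ℤ
open import Data.List.Base using (List; []; _∷_; _++_; length; map; applyUpTo)
open import Data.List.Properties using (length-map; length-++; length-applyUpTo)
open import Data.List.Relation.Unary.Any as Any using (Any; here; there)
import Data.List.Relation.Unary.Any.Properties as Any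
open import Data.Maybe.Base using (Maybe; just; nothing)
open import Data.Nat.Base as ℕ using (ℕ; zero; suc; ⌊_/2⌋; ⌈_/2⌉)
import Data.Nat.DivMod as ℕ
import Data.Nat.Properties as ℕ
open import Algebra.Properties.CommutativeSemigroup ℕ.+-commutativeSemigroup using (interchange)
open import Data.Product.Base using (∃; _×_; _,_; proj₁; proj₂; uncurry)
open import Data.Sum.Base using (_⊎_; inj₁; inj₂)
open import Data.Vec.Functional as Vector using (Vector; insertAt)
open import Data.Vec.Functional.Properties using (insertAt-lookup; insertAt-punchIn)
open import Function.Base using (_∘_)
open import Function.Definitions using (Injective)
open import Level using (0ℓ)
open import Relation.Binary.Definitions using (tri<; tri≈; tri>)
open import Relation.Binary.PropositionalEquality.Core as ≡ using (_≡_; _≢_)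
open import Relation.Binary.Structures using (IsStrictTotalOrder)
open import Relation.Nullary.Decidable.Core using (yes; no; Dec; ¬?)
open import Relation.Nullary.Negation.Core using (¬_)
open import Relation.Unary using (Pred)

-- The scalars are only a complete ordered field and an angle is only a supremum of lengths, so no
-- trigonometric function is at hand. Angles enter through the existence and strict monotonicity of
-- arccos; everything else is algebra in squared distances, with Heron's expression deciding whether
-- a triple is degenerate. The obstacle in the lower bound is that angles 0 and π are not counted: a
-- single counted angle says nothing directly about collinear triples, and these have to be refuted
-- by a separate argument before all distances can be compared. For the upper bounds the lists of
-- cosines have m - 2, ⌊(m - 1)/2⌋ and ⌊m/2⌋ entries, in all 2m - 3, and a third circle adds one
-- more. The list of cos² kα stops short of k = m/2 because that right angle already occurs inside a
-- circle; this saves one value for even m. With m = n for one circle, ⌈n/2⌉ for two and ⌈n/⌊d/2⌋⌉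
-- in general, these are the stated bounds. The largest root is the one taken because all Chebyshev
-- polynomials of smaller degree are positive there, which makes sin kα positive for 0 < k < m and
-- hence the m vertices distinct.

-- Ring identities with integer coefficients

module IntegerRingSolver (A : CommutativeRing 0ℓ 0ℓ) where
  open CommutativeRing A
  open import Algebra.Properties.Ring ring
    using (-‿distribˡ-*; -‿distribʳ-*)
  open import Algebra.Properties.AbelianGroup +-abelianGroup
    using (⁻¹-involutive; ε⁻¹≈ε; ⁻¹-∙-comm)
  open import Algebra.Properties.Semiring.Mult.TCOptimised semiring
    using (×1-homo-*; ×-homo-+; 1+×) renaming (_×_ to _⋆_)
  open import Algebra.Solver.Ring.AlmostCommutativeRing
    using (fromCommutativeRing; _-Raw-AlmostCommutative⟶_)
  open import Relation.Binary.Reasoning.Setoid setoid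

  -- The optimised multiples reduce 0, 1 and 2 to `0#`, `1#` and `1# + 1#` themselves. Hence `:2`
  -- denotes `2#` definitionally, and solved identities match goals written with these constants.
  ⟦_⟧ℤ : ℤ.ℤ → Carrier
  ⟦ ℤ.+ n ⟧ℤ      = n ⋆ 1#
  ⟦ ℤ.-[1+ n ] ⟧ℤ = - (suc n ⋆ 1#)

  neg-homo : ∀ i → ⟦ ℤ.- i ⟧ℤ ≈ - ⟦ i ⟧ℤ
  neg-homo (ℤ.+ zero)   = sym ε⁻¹≈ε
  neg-homo (ℤ.+ suc n)  = refl
  neg-homo ℤ.-[1+ n ]   = sym (⁻¹-involutive _)

  ⊖-homo : ∀ m n → ⟦ m ℤ.⊖ n ⟧ℤ ≈ m ⋆ 1# + - (n ⋆ 1#)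
  ⊖-homo zero    zero    = trans (sym (+-identityʳ 0#)) (+-congˡ (sym ε⁻¹≈ε))
  ⊖-homo zero    (suc n) = sym (+-identityˡ _)
  ⊖-homo (suc m) zero    = trans (sym (+-identityʳ _)) (+-congˡ (sym ε⁻¹≈ε))
  ⊖-homo (suc m) (suc n) = begin
    ⟦ suc m ℤ.⊖ suc n ⟧ℤ            ≡⟨ ≡.cong ⟦_⟧ℤ (ℤ.[1+m]⊖[1+n]≡m⊖n m n) ⟩
    ⟦ m ℤ.⊖ n ⟧ℤ                    ≈⟨ ⊖-homo m n ⟩
    x + - y                         ≈⟨ +-identityˡ _ ⟨
    0# + (x + - y)                  ≈⟨ +-congʳ (-‿inverseʳ 1#) ⟨
    (1# + - 1#) + (x + - y)         ≈⟨ +-assoc _ _ _ ⟩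
    1# + (- 1# + (x + - y))         ≈⟨ +-congˡ (+-assoc _ _ _) ⟨
    1# + ((- 1# + x) + - y)         ≈⟨ +-congˡ (+-congʳ (+-comm _ _)) ⟩
    1# + ((x + - 1#) + - y)         ≈⟨ +-congˡ (+-assoc _ _ _) ⟩
    1# + (x + (- 1# + - y))         ≈⟨ +-assoc _ _ _ ⟨
    (1# + x) + (- 1# + - y)         ≈⟨ +-cong (sym (1+× m 1#)) (trans (⁻¹-∙-comm 1# y) (-‿cong (sym (1+× n 1#)))) ⟩
    suc m ⋆ 1# + - (suc n ⋆ 1#)     ∎
    where
    x = m ⋆ 1#
    y = n ⋆ 1#

  +-homo : ∀ i j → ⟦ i ℤ.+ j ⟧ℤ ≈ ⟦ i ⟧ℤ + ⟦ j ⟧ℤ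
  +-homo (ℤ.+ m)    (ℤ.+ n)    = ×-homo-+ 1# m n
  +-homo (ℤ.+ m)    ℤ.-[1+ n ] = ⊖-homo m (suc n)
  +-homo ℤ.-[1+ m ] (ℤ.+ n)    = trans (⊖-homo n (suc m)) (+-comm _ _)
  +-homo ℤ.-[1+ m ] ℤ.-[1+ n ] = begin
    - (suc (suc (m ℕ.+ n)) ⋆ 1#)          ≡⟨ ≡.cong (λ k → - (k ⋆ 1#)) (≡.cong suc (≡.sym (ℕ.+-suc m n))) ⟩
    - ((suc m ℕ.+ suc n) ⋆ 1#)            ≈⟨ -‿cong (×-homo-+ 1# (suc m) (suc n)) ⟩
    - (suc m ⋆ 1# + suc n ⋆ 1#)           ≈⟨ ⁻¹-∙-comm _ _ ⟨
    - (suc m ⋆ 1#) + - (suc n ⋆ 1#)       ∎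

  *-homo⁺ : ∀ m n → ⟦ ℤ.+ m ℤ.* ℤ.+ n ⟧ℤ ≈ (m ⋆ 1#) * (n ⋆ 1#)
  *-homo⁺ m n = trans (reflexive (≡.cong ⟦_⟧ℤ (≡.sym (ℤ.pos-* m n)))) (×1-homo-* m n)

  *-homo-+ : ∀ i n → ⟦ i ℤ.* ℤ.+ n ⟧ℤ ≈ ⟦ i ⟧ℤ * (n ⋆ 1#)
  *-homo-+ (ℤ.+ m)    n = *-homo⁺ m n
  *-homo-+ ℤ.-[1+ m ] n = begin
    ⟦ ℤ.- (ℤ.+ suc m) ℤ.* ℤ.+ n ⟧ℤ    ≡⟨ ≡.cong ⟦_⟧ℤ (ℤ.neg-distribˡ-* (ℤ.+ suc m) (ℤ.+ n)) ⟨
    ⟦ ℤ.- (ℤ.+ suc m ℤ.* ℤ.+ n) ⟧ℤ    ≈⟨ neg-homo (ℤ.+ suc m ℤ.* ℤ.+ n) ⟩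
    - ⟦ ℤ.+ suc m ℤ.* ℤ.+ n ⟧ℤ        ≈⟨ -‿cong (*-homo⁺ (suc m) n) ⟩
    - ((suc m ⋆ 1#) * (n ⋆ 1#))       ≈⟨ -‿distribˡ-* _ _ ⟩
    - (suc m ⋆ 1#) * (n ⋆ 1#)         ∎

  *-homo : ∀ i j → ⟦ i ℤ.* j ⟧ℤ ≈ ⟦ i ⟧ℤ * ⟦ j ⟧ℤ
  *-homo i (ℤ.+ n)    = *-homo-+ i n
  *-homo i ℤ.-[1+ n ] = begin
    ⟦ i ℤ.* ℤ.- (ℤ.+ suc n) ⟧ℤ      ≡⟨ ≡.cong ⟦_⟧ℤ (ℤ.neg-distribʳ-* i (ℤ.+ suc n)) ⟨
    ⟦ ℤ.- (i ℤ.* ℤ.+ suc n) ⟧ℤ      ≈⟨ neg-homo (i ℤ.* ℤ.+ suc n) ⟩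
    - ⟦ i ℤ.* ℤ.+ suc n ⟧ℤ          ≈⟨ -‿cong (*-homo-+ i (suc n)) ⟩
    - (⟦ i ⟧ℤ * (suc n ⋆ 1#))       ≈⟨ -‿distribʳ-* _ _ ⟩
    ⟦ i ⟧ℤ * - (suc n ⋆ 1#)         ∎

  homomorphism : ℤ.+-*-rawRing -Raw-AlmostCommutative⟶ fromCommutativeRing A
  homomorphism = record
    { ⟦_⟧    = ⟦_⟧ℤ
    ; +-homo = +-homo
    ; *-homo = *-homo
    ; -‿homo = neg-homo
    ; 0-homo = refl
    ; 1-homo = refl
    }

  weaklyDecidable : ∀ i j → Maybe (⟦ i ⟧ℤ ≈ ⟦ j ⟧ℤ)
  weaklyDecidable i j with i ℤ.≟ j
  ... | yes i≡j = just (reflexive (≡.cong ⟦_⟧ℤ i≡j))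
  ... | no  _   = nothing

  open import Algebra.Solver.Ring ℤ.+-*-rawRing (fromCommutativeRing A)
    homomorphism weaklyDecidable public
    using (solve; _:=_; _:+_; _:*_; _:-_; :-_; con; Polynomial)

  :0 :1 :2 : ∀ {n} → Polynomial n
  :0 = con (ℤ.+ 0)
  :1 = con (ℤ.+ 1)
  :2 = con (ℤ.+ 2)

-- Ordered fields

module OrderedFieldProperties (F : OrderedField) where
  open OrderedField F public hiding (zero)
  open IntegerRingSolver commutativeRing public
  open IsStrictTotalOrder isStrictTotalOrder public
    using (compare; <-resp-≈; <-respʳ-≈; <-respˡ-≈; _≟_)
    renaming (trans to <-trans; irrefl to <-irrefl; asym to <-asym)
  import Relation.Binary.Construct.StrictToNonStrict as SNS
  private module O = SNS _≈_ _<_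

  2# 4# : Carrier
  2# = 1# + 1#
  4# = 2# + 2#

  ≤-refl : ∀ {x} → x ≤ x
  ≤-refl = inj₂ refl

  ≤-trans : ∀ {x y z} → x ≤ y → y ≤ z → x ≤ z
  ≤-trans = O.trans isEquivalence <-resp-≈ <-trans

  <-≤-trans : ∀ {x y z} → x < y → y ≤ z → x < z
  <-≤-trans = O.<-≤-trans <-trans <-respʳ-≈

  ≤-<-trans : ∀ {x y z} → x ≤ y → y < z → x < z
  ≤-<-trans = O.≤-<-trans sym <-trans <-respˡ-≈

  ≤-antisym : ∀ {x y} → x ≤ y → y ≤ x → x ≈ y
  ≤-antisym = O.antisym isEquivalence <-trans <-irrefl

  ≤-respʳ-≈ : ∀ {x y z} → y ≈ z → x ≤ y → x ≤ z
  ≤-respʳ-≈ = O.≤-respʳ-≈ trans <-respʳ-≈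

  ≤-respˡ-≈ : ∀ {x y z} → y ≈ z → y ≤ x → z ≤ x
  ≤-respˡ-≈ = O.≤-respˡ-≈ sym trans <-respˡ-≈

  ≤-total : ∀ x y → x ≤ y ⊎ y ≤ x
  ≤-total = O.total compare

  ≤-<-connex : ∀ x y → x ≤ y ⊎ y < x
  ≤-<-connex x y with compare x y
  ... | tri< x<y _ _ = inj₁ (inj₁ x<y)
  ... | tri≈ _ x≈y _ = inj₁ (inj₂ x≈y)
  ... | tri> _ _ x>y = inj₂ x>y

  <⇒≱ : ∀ {x y} → x < y → ¬ y ≤ x
  <⇒≱ x<y y≤x = <-irrefl refl (<-≤-trans x<y y≤x)

  ≮⇒≥ : ∀ {x y} → ¬ x < y → y ≤ x
  ≮⇒≥ {x} {y} x≮y with ≤-<-connex y x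
  ... | inj₁ y≤x = y≤x
  ... | inj₂ x<y = ⊥-elim (x≮y x<y)

  <⇒≉ : ∀ {x y} → x < y → ¬ x ≈ y
  <⇒≉ x<y x≈y = <-irrefl x≈y x<y

  >⇒≉ : ∀ {x y} → y < x → ¬ x ≈ y
  >⇒≉ y<x x≈y = <-irrefl (sym x≈y) y<x

  ≤∧≉⇒< : ∀ {x y} → x ≤ y → ¬ x ≈ y → x < y
  ≤∧≉⇒< (inj₁ x<y) _ = x<y
  ≤∧≉⇒< (inj₂ x≈y) x≉y = ⊥-elim (x≉y x≈y)

  -- Inequalities are proved by exhibiting the difference of the two sides
  -- as an expression that is visibly positive or nonnegative.
  <-by : ∀ {x y e} → 0# < e → y - x ≈ e → x < y
  <-by {x} {y} {e} 0<e y-x≈e =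
    <-respˡ-≈ (+-identityˡ x)
      (<-respʳ-≈ (trans (+-congʳ (sym y-x≈e)) (solve 2 (λ x y → y :- x :+ x := y) refl x y))
        (+-monoˡ-< x 0<e))

  ≤-by : ∀ {x y e} → 0# ≤ e → y - x ≈ e → x ≤ y
  ≤-by (inj₁ 0<e) eq = inj₁ (<-by 0<e eq)
  ≤-by {x} {y} (inj₂ 0≈e) eq = inj₂ (trans (sym (+-identityˡ x))
    (trans (+-congʳ (trans 0≈e (sym eq))) (solve 2 (λ x y → y :- x :+ x := y) refl x y)))

  <⇒0<- : ∀ {x y} → x < y → 0# < y - x
  <⇒0<- {x} x<y = <-respˡ-≈ (-‿inverseʳ x) (+-monoˡ-< (- x) x<y)

  ≤⇒0≤- : ∀ {x y} → x ≤ y → 0# ≤ y - x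
  ≤⇒0≤- (inj₁ x<y) = inj₁ (<⇒0<- x<y)
  ≤⇒0≤- {x} (inj₂ x≈y) = inj₂ (trans (sym (-‿inverseʳ x)) (+-congʳ x≈y))

  x-y≈0⇒x≈y : ∀ {x y} → x - y ≈ 0# → x ≈ y
  x-y≈0⇒x≈y {x} {y} eq = begin
    x            ≈⟨ solve 2 (λ x y → x := x :- y :+ y) refl x y ⟩
    x - y + y    ≈⟨ +-congʳ eq ⟩
    0# + y       ≈⟨ +-identityˡ y ⟩
    y            ∎
    where open import Relation.Binary.Reasoning.Setoid setoid

  x≈y⇒x-y≈0 : ∀ {x y} → x ≈ y → x - y ≈ 0#
  x≈y⇒x-y≈0 {x} {y} eq = trans (+-congʳ eq) (-‿inverseʳ y)

  +-pos-nonneg : ∀ {x y} → 0# < x → 0# ≤ y → 0# < x + y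
  +-pos-nonneg {x} {y} 0<x 0≤y =
    ≤-<-trans 0≤y (<-respˡ-≈ (+-identityˡ y) (+-monoˡ-< y 0<x))

  +-nonneg-pos : ∀ {x y} → 0# ≤ x → 0# < y → 0# < x + y
  +-nonneg-pos 0≤x 0<y = <-respʳ-≈ (+-comm _ _) (+-pos-nonneg 0<y 0≤x)

  +-pos : ∀ {x y} → 0# < x → 0# < y → 0# < x + y
  +-pos 0<x 0<y = +-pos-nonneg 0<x (inj₁ 0<y)

  +-nonneg : ∀ {x y} → 0# ≤ x → 0# ≤ y → 0# ≤ x + y
  +-nonneg (inj₁ 0<x) 0≤y = inj₁ (+-pos-nonneg 0<x 0≤y)
  +-nonneg (inj₂ 0≈x) 0≤y = ≤-respʳ-≈ (trans (sym (+-identityˡ _)) (+-congʳ 0≈x)) 0≤y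

  *-nonneg : ∀ {x y} → 0# ≤ x → 0# ≤ y → 0# ≤ x * y
  *-nonneg (inj₁ 0<x) (inj₁ 0<y) = inj₁ (*-pos 0<x 0<y)
  *-nonneg {x} {y} (inj₂ 0≈x) _ = inj₂ (trans (sym (zeroˡ y)) (*-congʳ 0≈x))
  *-nonneg {x} {y} (inj₁ _) (inj₂ 0≈y) = inj₂ (trans (sym (zeroʳ x)) (*-congˡ 0≈y))

  neg-pos : ∀ {x} → x < 0# → 0# < - x
  neg-pos {x} x<0 = <-respʳ-≈ (+-identityˡ (- x)) (<⇒0<- x<0)

  neg-nonneg : ∀ {x} → x ≤ 0# → 0# ≤ - x
  neg-nonneg {x} x≤0 = ≤-respʳ-≈ (+-identityˡ (- x)) (≤⇒0≤- x≤0)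

  0<x² : ∀ {x} → ¬ x ≈ 0# → 0# < x * x
  0<x² {x} x≉0 with compare 0# x
  ... | tri< 0<x _ _ = *-pos 0<x 0<x
  ... | tri≈ _ 0≈x _ = ⊥-elim (x≉0 (sym 0≈x))
  ... | tri> _ _ x<0 = <-respʳ-≈ (solve 1 (λ x → (:- x) :* (:- x) := x :* x) refl x)
                         (*-pos (neg-pos x<0) (neg-pos x<0))

  0≤x² : ∀ x → 0# ≤ x * x
  0≤x² x with x ≟ 0#
  ... | yes x≈0 = inj₂ (trans (sym (zeroˡ x)) (*-congʳ (sym x≈0)))
  ... | no x≉0 = inj₁ (0<x² x≉0)

  0<1 : 0# < 1#
  0<1 = <-respʳ-≈ (*-identityˡ 1#) (0<x² (λ 1≈0 → 0≉1 (sym 1≈0)))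

  0<2 : 0# < 2#
  0<2 = +-pos 0<1 0<1

  0<4 : 0# < 4#
  0<4 = +-pos 0<2 0<2

  *-cancelˡ-pos : ∀ {x y} → 0# ≤ x → 0# < x * y → 0# < y
  *-cancelˡ-pos {x} {y} 0≤x 0<xy with ≤-<-connex y 0#
  ... | inj₂ 0<y = 0<y
  ... | inj₁ y≤0 = ⊥-elim (<-irrefl refl (<-≤-trans 0<xy
          (≤-by (*-nonneg 0≤x (neg-nonneg y≤0))
             (solve 2 (λ x y → :0 :- x :* y := x :* (:- y)) refl x y))))

  *-cancelˡ-nonneg : ∀ {x y} → 0# < x → 0# ≤ x * y → 0# ≤ y
  *-cancelˡ-nonneg {x} {y} 0<x 0≤xy with ≤-<-connex 0# y
  ... | inj₁ 0≤y = 0≤y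
  ... | inj₂ y<0 = ⊥-elim (<⇒≱ (<-by (*-pos 0<x (neg-pos y<0))
             (solve 2 (λ x y → :0 :- x :* y := x :* (:- y)) refl x y)) 0≤xy)

  x*y≈0⇒y≈0 : ∀ {x y} → ¬ x ≈ 0# → x * y ≈ 0# → y ≈ 0#
  x*y≈0⇒y≈0 {x} {y} x≉0 xy≈0 with inverse x x≉0
  ... | z , xz≈1 = begin
    y             ≈⟨ *-identityˡ y ⟨
    1# * y        ≈⟨ *-congʳ xz≈1 ⟨
    (x * z) * y   ≈⟨ solve 3 (λ x y z → x :* z :* y := z :* (x :* y)) refl x y z ⟩
    z * (x * y)   ≈⟨ *-congˡ xy≈0 ⟩
    z * 0#        ≈⟨ zeroʳ z ⟩
    0#            ∎
    where open import Relation.Binary.Reasoning.Setoid setoid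

  *-cancelˡ : ∀ {x y z} → ¬ x ≈ 0# → x * y ≈ x * z → y ≈ z
  *-cancelˡ {x} {y} {z} x≉0 eq = x-y≈0⇒x≈y (x*y≈0⇒y≈0 x≉0
    (trans (solve 3 (λ x y z → x :* (y :- z) := x :* y :- x :* z) refl x y z) (x≈y⇒x-y≈0 eq)))

  x²≈0⇒x≈0 : ∀ {x} → x * x ≈ 0# → x ≈ 0#
  x²≈0⇒x≈0 {x} x²≈0 with x ≟ 0#
  ... | yes x≈0 = x≈0
  ... | no x≉0 = x*y≈0⇒y≈0 x≉0 x²≈0

  divide : ∀ a b → ¬ a ≈ 0# → ∃ λ x → a * x ≈ b
  divide a b a≉0 with inverse a a≉0
  ... | z , az≈1 = z * b , trans (sym (*-assoc a z b)) (trans (*-congʳ az≈1) (*-identityˡ b))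

  sqr-cancel-≤ : ∀ {x y} → 0# ≤ y → x * x ≤ y * y → x ≤ y
  sqr-cancel-≤ {x} {y} 0≤y x²≤y² with ≤-<-connex x y
  ... | inj₁ x≤y = x≤y
  ... | inj₂ y<x = ⊥-elim (<⇒≱ (<-by (*-pos (<⇒0<- y<x) (+-pos-nonneg (≤-<-trans 0≤y y<x) 0≤y))
            (solve 2 (λ x y → x :* x :- y :* y := (x :- y) :* (x :+ y)) refl x y)) x²≤y²)

  sqr-cancel-< : ∀ {x y} → 0# ≤ y → x * x < y * y → x < y
  sqr-cancel-< {x} {y} 0≤y x²<y² = ≤∧≉⇒< (sqr-cancel-≤ 0≤y (inj₁ x²<y²))
    (λ x≈y → <-irrefl (*-cong x≈y x≈y) x²<y²)

  sqr-mono-≤ : ∀ {x y} → 0# ≤ x → x ≤ y → x * x ≤ y * y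
  sqr-mono-≤ {x} {y} 0≤x x≤y =
    ≤-by (*-nonneg (≤⇒0≤- x≤y) (+-nonneg (≤-trans 0≤x x≤y) 0≤x))
      (solve 2 (λ x y → y :* y :- x :* x := (y :- x) :* (y :+ x)) refl x y)

  sqr-injective : ∀ {x y} → 0# ≤ x → 0# ≤ y → x * x ≈ y * y → x ≈ y
  sqr-injective 0≤x 0≤y x²≈y² = ≤-antisym (sqr-cancel-≤ 0≤y (inj₂ x²≈y²))
    (sqr-cancel-≤ 0≤x (inj₂ (sym x²≈y²)))

  nonneg+nonneg≈0 : ∀ {x y} → 0# ≤ x → 0# ≤ y → x + y ≈ 0# → x ≈ 0# × y ≈ 0#
  nonneg+nonneg≈0 {x} {y} 0≤x 0≤y x+y≈0 = x≈0 , trans (sym (+-identityˡ y)) (trans (+-congʳ (sym x≈0)) x+y≈0)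
    where
    x≈0 : x ≈ 0#
    x≈0 = ≤-antisym (≤-by 0≤y (trans (+-congʳ (sym x+y≈0)) (solve 2 (λ x y → x :+ y :- x := y) refl x y))) 0≤x

-- Bounded functions with bounded difference quotients

module LipschitzFunctions (F : OrderedField) where
  open OrderedFieldProperties F

  Within : Carrier → Carrier → Set
  Within B z = 0# ≤ B - z × 0# ≤ B + z

  within-+ : ∀ {B C z w} → Within B z → Within C w → Within (B + C) (z + w)
  within-+ {B} {C} {z} {w} (p , q) (r , s) =
    ≤-respʳ-≈ (solve 4 (λ B C z w → (B :- z) :+ (C :- w) := (B :+ C) :- (z :+ w)) refl B C z w) (+-nonneg p r) ,
    ≤-respʳ-≈ (solve 4 (λ B C z w → (B :+ z) :+ (C :+ w) := (B :+ C) :+ (z :+ w)) refl B C z w) (+-nonneg q s)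

  -- (B - z)(C + w) + (B + z)(C - w) = 2(BC - zw), and similarly for the other sign, so no case
  -- distinction on the signs of z and w arises.
  within-* : ∀ {B C z w} → Within B z → Within C w → Within (B * C) (z * w)
  within-* {B} {C} {z} {w} (p , q) (r , s) =
    *-cancelˡ-nonneg 0<2 (≤-respʳ-≈
      (solve 4 (λ B C z w → (B :- z) :* (C :+ w) :+ (B :+ z) :* (C :- w) := :2 :* (B :* C :- z :* w)) refl B C z w)
      (+-nonneg (*-nonneg p s) (*-nonneg q r))) ,
    *-cancelˡ-nonneg 0<2 (≤-respʳ-≈
      (solve 4 (λ B C z w → (B :- z) :* (C :- w) :+ (B :+ z) :* (C :+ w) := :2 :* (B :* C :+ z :* w)) refl B C z w)
      (+-nonneg (*-nonneg p r) (*-nonneg q s)))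

  within-self : ∀ z → ∃ λ B → Within B z
  within-self z with ≤-total 0# z
  ... | inj₁ 0≤z = z , inj₂ (sym (-‿inverseʳ z)) , +-nonneg 0≤z 0≤z
  ... | inj₂ z≤0 = - z , +-nonneg (neg-nonneg z≤0) (neg-nonneg z≤0) , inj₂ (sym (-‿inverseˡ z))

  module _ (a b : Carrier) where

    Bounded : (Carrier → Carrier) → Set
    Bounded f = ∃ λ B → ∀ x → a ≤ x → x ≤ b → Within B (f x)

    -- The difference quotients of f are bounded; in contrast to the usual
    -- condition |f y - f x| ≤ L |y - x|, this is preserved by products through a
    -- purely algebraic computation.
    Lipschitz : (Carrier → Carrier) → Set
    Lipschitz f = ∃ λ L → ∀ x y → a ≤ x → x ≤ b → a ≤ y → y ≤ b →
      ∃ λ q → f y - f x ≈ (y - x) * q × Within L q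

    BoundedLipschitz : (Carrier → Carrier) → Set
    BoundedLipschitz f = Bounded f × Lipschitz f

    lipschitz-const : ∀ c → BoundedLipschitz (λ _ → c)
    lipschitz-const c = (proj₁ (within-self c) , λ _ _ _ → proj₂ (within-self c)) ,
      (proj₁ (within-self 0#) , λ x y _ _ _ _ → 0# ,
        solve 3 (λ c x y → c :- c := (y :- x) :* :0) refl c x y , proj₂ (within-self 0#))

    lipschitz-id : BoundedLipschitz (λ x → x)
    lipschitz-id = (B + C , bound) ,
      (1# , λ x y _ _ _ _ → 1# , sym (*-identityʳ _) ,
        inj₂ (sym (-‿inverseʳ 1#)) , +-nonneg (inj₁ 0<1) (inj₁ 0<1))
      where
      B = proj₁ (within-self a)
      C = proj₁ (within-self b)
      bound : ∀ x → a ≤ x → x ≤ b → Within (B + C) x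
      bound x a≤x x≤b with proj₂ (within-self a) | proj₂ (within-self b)
      ... | p , q | r , s =
        ≤-respʳ-≈ (solve 5 (λ B C a b x → (b :- x) :+ (C :- b) :+ B := B :+ C :- x) refl B C a b x)
          (+-nonneg (+-nonneg (≤⇒0≤- x≤b) r) (nonneg p q)) ,
        ≤-respʳ-≈ (solve 5 (λ B C a b x → (x :- a) :+ (B :+ a) :+ C := B :+ C :+ x) refl B C a b x)
          (+-nonneg (+-nonneg (≤⇒0≤- a≤x) q) (nonneg r s))
        where
        nonneg : ∀ {B z} → 0# ≤ B - z → 0# ≤ B + z → 0# ≤ B
        nonneg {B} {z} p q = *-cancelˡ-nonneg 0<2 (≤-respʳ-≈
          (solve 2 (λ B z → (B :- z) :+ (B :+ z) := :2 :* B) refl B z) (+-nonneg p q))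

    lipschitz-+ : ∀ {f g} → BoundedLipschitz f → BoundedLipschitz g → BoundedLipschitz (λ x → f x + g x)
    lipschitz-+ {f} {g} ((B , bf) , (L , lf)) ((C , bg) , (M , lg)) =
      (B + C , λ x p q → within-+ (bf x p q) (bg x p q)) , (L + M , quotient)
      where
      quotient : ∀ x y → a ≤ x → x ≤ b → a ≤ y → y ≤ b →
        ∃ λ q → (f y + g y) - (f x + g x) ≈ (y - x) * q × Within (L + M) q
      quotient x y p q r s with lf x y p q r s | lg x y p q r s
      ... | u , eu , wu | v , ev , wv = u + v ,
        trans (solve 4 (λ a b c d → (a :+ b) :- (c :+ d) := (a :- c) :+ (b :- d)) refl (f y) (g y) (f x) (g x))
          (trans (+-cong eu ev) (sym (distribˡ (y - x) u v))) , within-+ wu wv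

    lipschitz-* : ∀ {f g} → BoundedLipschitz f → BoundedLipschitz g → BoundedLipschitz (λ x → f x * g x)
    lipschitz-* {f} {g} ((B , bf) , (L , lf)) ((C , bg) , (M , lg)) =
      (B * C , λ x p q → within-* (bf x p q) (bg x p q)) , (L * C + B * M , quotient)
      where
      quotient : ∀ x y → a ≤ x → x ≤ b → a ≤ y → y ≤ b →
        ∃ λ q → f y * g y - f x * g x ≈ (y - x) * q × Within (L * C + B * M) q
      quotient x y p q r s with lf x y p q r s | lg x y p q r s
      ... | u , eu , wu | v , ev , wv = u * g y + f x * v ,
        trans (solve 4 (λ a b c d → a :* b :- c :* d := (a :- c) :* b :+ c :* (b :- d)) refl (f y) (g y) (f x) (g x))
          (trans (+-cong (*-congʳ eu) (*-congˡ ev))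
            (solve 5 (λ w u v c b → w :* u :* b :+ c :* (w :* v) := w :* (u :* b :+ c :* v)) refl (y - x) u v
                (f x) (g y))) ,
        within-+ (within-* wu (bg y r s)) (within-* (bf x p q) wv)

-- Roots and square roots from completeness

module RealProperties (R : CompleteOrderedField) where
  open CompleteOrderedField R public using (orderedField; complete)
  open OrderedFieldProperties orderedField public
  open LipschitzFunctions orderedField public

  -- The root is the supremum s of the points where f ≤ 0, which gives positivity to its right at
  -- once. With ε = |f s| / (L + 1), a positive f s would make s - ε an upper bound already, and a
  -- negative f s would leave f ≤ 0 at s + ε.
  largest-root : ∀ {a b f} → a ≤ b → BoundedLipschitz a b f → f a ≤ 0# → 0# < f b →
    ∃ λ c → a ≤ c × c < b × f c ≈ 0# × (∀ x → c < x → x ≤ b → 0# < f x)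
  largest-root {a} {b} {f} a≤b (_ , L , lip) fa≤0 0<fb = s , a≤s , s<b , fs≈0 , above
    where
    S : Carrier → Set
    S x = a ≤ x × x ≤ b × f x ≤ 0#
    lub : ∃ (IsLeastUpperBound _≤_ S)
    lub = complete S (a , ≤-refl , a≤b , fa≤0) (b , λ _ x∈S → proj₁ (proj₂ x∈S))
    s = proj₁ lub
    a≤s : a ≤ s
    a≤s = proj₁ (proj₂ lub) a (≤-refl , a≤b , fa≤0)
    s≤b : s ≤ b
    s≤b = proj₂ (proj₂ lub) b (λ _ x∈S → proj₁ (proj₂ x∈S))
    above : ∀ x → s < x → x ≤ b → 0# < f x
    above x s<x x≤b with ≤-<-connex (f x) 0#
    ... | inj₂ 0<fx = 0<fx
    ... | inj₁ fx≤0 = ⊥-elim (<⇒≱ s<x (proj₁ (proj₂ lub) x (≤-trans a≤s (inj₁ s<x) , x≤b , fx≤0)))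
    -- The constant `L` may be zero; adding 1 makes the bound on the slope invertible.
    0<L+1 : 0# < L + 1#
    0<L+1 with lip a a ≤-refl a≤b ≤-refl a≤b
    ... | q , _ , p , r = +-nonneg-pos (*-cancelˡ-nonneg 0<2 (≤-respʳ-≈
          (solve 2 (λ B z → (B :- z) :+ (B :+ z) := :2 :* B) refl L q) (+-nonneg p r))) 0<1
    increment : ∀ x y → a ≤ x → x ≤ y → y ≤ b → f y - f x ≤ (L + 1#) * (y - x)
    increment x y a≤x x≤y y≤b with lip x y a≤x (≤-trans x≤y y≤b) (≤-trans a≤x x≤y) y≤b
    ... | q , eq , p , _ = ≤-respˡ-≈ (sym eq)
          (≤-by (*-nonneg (≤⇒0≤- x≤y) (+-nonneg p (inj₁ 0<1)))
            (solve 3 (λ w L q → (L :+ :1) :* w :- w :* q := w :* (L :- q :+ :1)) refl (y - x) L q))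
    fs≈0 : f s ≈ 0#
    fs≈0 with compare (f s) 0#
    ... | tri≈ _ eq _ = eq
    ... | tri> _ _ 0<fs = ⊥-elim (<⇒≱ (<-by 0<ε (solve 2 (λ s e → s :- (s :- e) := e) refl s ε))
                                   (proj₂ (proj₂ lub) (s - ε) bound))
      where
      ε = proj₁ (divide (L + 1#) (f s) (>⇒≉ 0<L+1))
      eqε : (L + 1#) * ε ≈ f s
      eqε = proj₂ (divide (L + 1#) (f s) (>⇒≉ 0<L+1))
      0<ε : 0# < ε
      0<ε = *-cancelˡ-pos (inj₁ 0<L+1) (<-respʳ-≈ (sym eqε) 0<fs)
      bound : IsUpperBound _≤_ S (s - ε)
      bound y y∈S@(a≤y , y≤b , fy≤0) = ≤-by (*-cancelˡ-nonneg 0<L+1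
          (≤-respʳ-≈ (trans (solve 4 (λ fs fy Lx Le → (Lx :- (fs :- fy)) :+ (:0 :- fy) :+ (fs :- Le) := Lx :- Le)
                        refl (f s) (f y) ((L + 1#) * (s - y)) ((L + 1#) * ε))
                      (solve 4 (λ L s y e → L :* (s :- y) :- L :* e := L :* ((s :- e) :- y)) refl (L + 1#) s y ε))
            (+-nonneg (+-nonneg (≤⇒0≤- (increment y s a≤y (proj₁ (proj₂ lub) y y∈S) s≤b)) (≤⇒0≤- fy≤0))
              (inj₂ (sym (x≈y⇒x-y≈0 (sym eqε))))))) refl
    ... | tri< fs<0 _ _ = ⊥-elim (<⇒≱ s<t (proj₁ (proj₂ lub) t (≤-trans a≤s (inj₁ s<t) , inj₁ t<b , ft≤0)))
      where
      ε = proj₁ (divide (L + 1#) (- f s) (>⇒≉ 0<L+1))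
      eqε : (L + 1#) * ε ≈ - f s
      eqε = proj₂ (divide (L + 1#) (- f s) (>⇒≉ 0<L+1))
      0<ε : 0# < ε
      0<ε = *-cancelˡ-pos (inj₁ 0<L+1) (<-respʳ-≈ (sym eqε) (neg-pos fs<0))
      t = s + ε
      s<t : s < t
      s<t = <-by 0<ε (solve 2 (λ s e → s :+ e :- s := e) refl s ε)
      t<b : t < b
      t<b = <-by (*-cancelˡ-pos (inj₁ 0<L+1)
          (<-respʳ-≈ (trans (solve 4 (λ fs fb Lx Le → (fb :+ (Lx :- (fb :- fs))) :+ (:- fs :- Le) := Lx :- Le)
                        refl (f s) (f b) ((L + 1#) * (b - s)) ((L + 1#) * ε))
                      (solve 4 (λ L s b e → L :* (b :- s) :- L :* e := L :* (b :- (s :+ e))) refl (L + 1#) s b ε))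
            (+-pos-nonneg (+-pos-nonneg 0<fb (≤⇒0≤- (increment s b a≤s s≤b ≤-refl)))
              (inj₂ (sym (x≈y⇒x-y≈0 (sym eqε))))))) refl
      ft≤0 : f t ≤ 0#
      ft≤0 = ≤-by (+-nonneg (≤⇒0≤- (increment s t a≤s (inj₁ s<t) (inj₁ t<b))) (inj₂ (sym (x≈y⇒x-y≈0 (sym eqε)))))
          (solve 5 (λ s e fs ft L → :0 :- ft := (L :* (s :+ e :- s) :- (ft :- fs)) :+ (:- fs :- L :* e))
             refl s ε (f s) (f t) (L + 1#))
    s<b : s < b
    s<b = ≤∧≉⇒< s≤b λ s≈b → >⇒≉ 0<fb (trans (fb≈fs s≈b) fs≈0)
      where
      -- That `f` respects `≈` is no hypothesis; the difference quotient over an interval of length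
      -- zero supplies it.
      fb≈fs : s ≈ b → f b ≈ f s
      fb≈fs s≈b with lip s b a≤s s≤b a≤b ≤-refl
      ... | q , eq , _ = x-y≈0⇒x≈y (trans eq (trans (*-congʳ (x≈y⇒x-y≈0 (sym s≈b))) (zeroˡ q)))

  sqrt : ∀ {x} → 0# ≤ x → ∃ (IsSqrt R x)
  sqrt {x} 0≤x = proj₁ root , proj₁ (proj₂ root) , x-y≈0⇒x≈y (proj₁ (proj₂ (proj₂ (proj₂ root))))
    where
    -- At `x + 1#` the function y² - x is positive for every x ≥ 0, whether x lies below or above 1.
    root = largest-root {0#} {x + 1#} {λ y → y * y - x} (inj₁ (+-nonneg-pos 0≤x 0<1))
      (lipschitz-+ 0# (x + 1#) (lipschitz-* 0# (x + 1#) (lipschitz-id 0# (x + 1#)) (lipschitz-id 0# (x + 1#)))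
        (lipschitz-const 0# (x + 1#) (- x)))
      (≤-by 0≤x (solve 1 (λ x → :0 :- (:0 :* :0 :- x) := x) refl x))
      (<-respʳ-≈ (solve 1 (λ x → x :* x :+ x :+ :1 := (x :+ :1) :* (x :+ :1) :- x) refl x)
        (+-nonneg-pos (+-nonneg (0≤x² x) 0≤x) 0<1))

  sqrt-pos : ∀ {x a} → 0# < x → IsSqrt R x a → 0# < a
  sqrt-pos {x} {a} 0<x (0≤a , a²≈x) = ≤∧≉⇒< 0≤a λ 0≈a → <⇒≉ 0<x
    (trans (sym (zeroˡ a)) (trans (*-congʳ 0≈a) a²≈x))

  sqrt-unique : ∀ {x a b} → IsSqrt R x a → IsSqrt R x b → a ≈ b
  sqrt-unique (0≤a , a²≈x) (0≤b , b²≈x) = sqr-injective 0≤a 0≤b (trans a²≈x (sym b²≈x))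

  sqrt-resp : ∀ {x y a} → x ≈ y → IsSqrt R x a → IsSqrt R y a
  sqrt-resp x≈y (0≤a , a²≈x) = 0≤a , trans a²≈x x≈y

-- Arc length and arccos

module ArccosProperties (R : CompleteOrderedField) where
  open RealProperties R

  inscribed-resp : ∀ {x y l x′ y′ l′} → x ≈ x′ → y ≈ y′ → l ≈ l′ → Inscribed R x y l → Inscribed R x′ y′ l′
  inscribed-resp ex ey el (start p q r) =
    start (trans (sym ex) p) (trans (sym ey) q) (trans (sym el) r)
  inscribed-resp ex ey el (step i (c , 0≤y) x≤ r e) =
    step i (trans (+-cong (*-cong (sym ex) (sym ex)) (*-cong (sym ey) (sym ey))) c , ≤-respʳ-≈ ey 0≤y)
      (≤-respˡ-≈ ex x≤)
      (sqrt-resp (+-cong (*-cong (+-congʳ ex) (+-congʳ ex)) (*-cong (+-congʳ ey) (+-congʳ ey))) r)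
      (trans (sym el) e)

  inscribed-onSemicircle : ∀ {x y l} → Inscribed R x y l → OnUpperUnitSemicircle R x y
  inscribed-onSemicircle (start p q r) =
    trans (+-cong (*-cong p p) (*-cong q q)) (solve 0 (:1 :* :1 :+ :0 :* :0 := :1) refl) , inj₂ (sym q)
  inscribed-onSemicircle (step _ c _ _ _) = c

  abscissa≤1 : ∀ {x y} → x * x + y * y ≈ 1# → x ≤ 1#
  abscissa≤1 {x} {y} c = sqr-cancel-≤ (inj₁ 0<1) (≤-by (0≤x² y)
    (trans (+-congʳ (trans (*-identityʳ 1#) (sym c)))
        (solve 2 (λ x y → x :* x :+ y :* y :- x :* x := y :* y) refl x y)))

  -1≤abscissa : ∀ {x y} → x * x + y * y ≈ 1# → - 1# ≤ x
  -1≤abscissa {x} {y} c = ≤-by (≤⇒0≤- (abscissa≤1 {x = - x} {y}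
      (trans (+-congʳ (solve 1 (λ x → (:- x) :* (:- x) := x :* x) refl x)) c)))
    (solve 1 (λ x → x :- (:- :1) := :1 :- (:- x)) refl x)

  ordinate≤1 : ∀ {x y} → x * x + y * y ≈ 1# → y ≤ 1#
  ordinate≤1 c = abscissa≤1 (trans (+-comm _ _) c)

  ordinate-mono : ∀ {x y x′ y′} → OnUpperUnitSemicircle R x y → OnUpperUnitSemicircle R x′ y′ →
    x * x ≤ x′ * x′ → y′ ≤ y
  ordinate-mono {x} {y} {x′} {y′} (c , 0≤y) (c′ , _) h = sqr-cancel-≤ 0≤y (≤-by (≤⇒0≤- h)
    (trans (solve 4 (λ a b c d → b :- d := c :- a :+ ((a :+ b) :- (c :+ d))) refl (x * x) (y * y) (x′ * x′) (y′ * y′))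
      (trans (+-congˡ (x≈y⇒x-y≈0 (trans c (sym c′)))) (+-identityʳ _))))

  chord≤legs : ∀ {s a b δ} → 0# ≤ a → 0# ≤ b → s ≈ a * a + b * b → IsSqrt R s δ → δ ≤ a + b
  chord≤legs {s} {a} {b} {δ} 0≤a 0≤b s≈ (_ , δ²≈s) = sqr-cancel-≤ (+-nonneg 0≤a 0≤b)
    (≤-by (*-nonneg (inj₁ 0<2) (*-nonneg 0≤a 0≤b))
      (trans (+-congˡ (-‿cong (trans δ²≈s s≈)))
        (solve 2 (λ a b → (a :+ b) :* (a :+ b) :- (a :* a :+ b :* b) := :2 :* (a :* b)) refl a b)))

  -- Each edge is at most as long as its two coordinate displacements together;
  -- the abscissa decreases, and the ordinate increases up to the top of the
  -- semicircle and decreases after it.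
  length≤displacement : ∀ {x y l} → Inscribed R x y l →
    (0# ≤ x × l ≤ 1# - x + y) ⊎ (x < 0# × l ≤ 1# - x + (2# - y))
  length≤displacement {x} {y} {l} (start p q r) = inj₁
    (inj₁ (<-respʳ-≈ (sym p) 0<1) ,
     inj₂ (trans r (trans (solve 0 (:0 := :1 :- :1 :+ :0) refl) (+-cong (+-congˡ (-‿cong (sym p))) (sym q)))))
  length≤displacement {x′} {y′} {l′} (step {x} {y} {l} {δ = δ} i c′ x′≤x r e)
    with length≤displacement i | ≤-<-connex 0# x′
  ... | inj₁ (0≤x , h) | inj₁ 0≤x′ = inj₁ (0≤x′ , ≤-respˡ-≈ (sym e)
      (≤-by (+-nonneg (≤⇒0≤- h) (≤⇒0≤- (chord≤legs (≤⇒0≤- x′≤x) (≤⇒0≤- y≤y′)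
          (solve 4 (λ x y x′ y′ → (x′ :- x) :* (x′ :- x) :+ (y′ :- y) :* (y′ :- y) :=
             (x :- x′) :* (x :- x′) :+ (y′ :- y) :* (y′ :- y)) refl x y x′ y′) r)))
        (solve 6 (λ x y x′ y′ l δ → :1 :- x′ :+ y′ :- (l :+ δ) :=
          (:1 :- x :+ y :- l) :+ ((x :- x′) :+ (y′ :- y) :- δ)) refl x y x′ y′ l δ)))
    where
    y≤y′ = ordinate-mono c′ (inscribed-onSemicircle i) (sqr-mono-≤ 0≤x′ x′≤x)
  ... | inj₂ (x<0 , h) | inj₁ 0≤x′ = ⊥-elim (<⇒≱ x<0 (≤-trans 0≤x′ x′≤x))
  ... | inj₂ (x<0 , h) | inj₂ x′<0 = inj₂ (x′<0 , ≤-respˡ-≈ (sym e)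
      (≤-by (+-nonneg (≤⇒0≤- h) (≤⇒0≤- (chord≤legs (≤⇒0≤- x′≤x) (≤⇒0≤- y′≤y)
          (solve 4 (λ x y x′ y′ → (x′ :- x) :* (x′ :- x) :+ (y′ :- y) :* (y′ :- y) :=
             (x :- x′) :* (x :- x′) :+ (y :- y′) :* (y :- y′)) refl x y x′ y′) r)))
        (solve 6 (λ x y x′ y′ l δ → :1 :- x′ :+ (:2 :- y′) :- (l :+ δ) :=
          (:1 :- x :+ (:2 :- y) :- l) :+ ((x :- x′) :+ (y :- y′) :- δ)) refl x y x′ y′ l δ)))
    where
    y′≤y = ordinate-mono (inscribed-onSemicircle i) c′
      (≤-by (*-nonneg (≤⇒0≤- x′≤x) (+-nonneg (neg-nonneg (inj₁ x<0)) (neg-nonneg (inj₁ x′<0))))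
        (solve 2 (λ x x′ → x′ :* x′ :- x :* x := (x :- x′) :* (:- x :+ :- x′)) refl x x′))
  -- This edge passes over the top of the semicircle, where the bound switches from `y` to
  -- `2# - y′`. The slack in the switch is twice the height missing from the higher endpoint to
  -- ordinate 1.
  ... | inj₁ (0≤x , h) | inj₂ x′<0 with ≤-total y y′
  ...   | inj₁ y≤y′ = inj₂ (x′<0 , ≤-respˡ-≈ (sym e)
      (≤-by (+-nonneg (+-nonneg (≤⇒0≤- h) (≤⇒0≤- (chord≤legs (≤⇒0≤- x′≤x) (≤⇒0≤- y≤y′)
          (solve 4 (λ x y x′ y′ → (x′ :- x) :* (x′ :- x) :+ (y′ :- y) :* (y′ :- y) :=
             (x :- x′) :* (x :- x′) :+ (y′ :- y) :* (y′ :- y)) refl x y x′ y′) r)))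
          (*-nonneg (inj₁ 0<2) (≤⇒0≤- (ordinate≤1 (proj₁ c′)))))
        (solve 6 (λ x y x′ y′ l δ → :1 :- x′ :+ (:2 :- y′) :- (l :+ δ) :=
          (:1 :- x :+ y :- l) :+ ((x :- x′) :+ (y′ :- y) :- δ) :+ :2 :* (:1 :- y′)) refl x y x′ y′ l δ)))
  ...   | inj₂ y′≤y = inj₂ (x′<0 , ≤-respˡ-≈ (sym e)
      (≤-by (+-nonneg (+-nonneg (≤⇒0≤- h) (≤⇒0≤- (chord≤legs (≤⇒0≤- x′≤x) (≤⇒0≤- y′≤y)
          (solve 4 (λ x y x′ y′ → (x′ :- x) :* (x′ :- x) :+ (y′ :- y) :* (y′ :- y) :=
             (x :- x′) :* (x :- x′) :+ (y :- y′) :* (y :- y′)) refl x y x′ y′) r)))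
          (*-nonneg (inj₁ 0<2) (≤⇒0≤- (ordinate≤1 (proj₁ (inscribed-onSemicircle i))))))
        (solve 6 (λ x y x′ y′ l δ → :1 :- x′ :+ (:2 :- y′) :- (l :+ δ) :=
          (:1 :- x :+ y :- l) :+ ((x :- x′) :+ (y :- y′) :- δ) :+ :2 :* (:1 :- y)) refl x y x′ y′ l δ)))

  -- The abscissa travels at most 2, and the ordinate at most 1 up and 1 down. The crude constant
  -- only serves to make the set of lengths bounded, so that its supremum exists.
  length≤4 : ∀ {x y l} → Inscribed R x y l → l ≤ 4#
  length≤4 {x} {y} {l} i with length≤displacement i | inscribed-onSemicircle i
  ... | inj₁ (0≤x , h) | c , _ =
    ≤-by (+-nonneg (+-nonneg (≤⇒0≤- h) 0≤x) (+-nonneg (≤⇒0≤- (ordinate≤1 c)) (inj₁ 0<2)))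
      (solve 3 (λ x y l → :2 :+ :2 :- l := (:1 :- x :+ y :- l) :+ x :+ (:1 :- y :+ :2)) refl x y l)
  ... | inj₂ (_ , h) | c , 0≤y =
    ≤-by (+-nonneg (≤⇒0≤- h) (+-nonneg (≤⇒0≤- (-1≤abscissa c)) 0≤y))
      (solve 3 (λ x y l → :2 :+ :2 :- l := (:1 :- x :+ (:2 :- y) :- l) :+ (x :- (:- :1) :+ y)) refl x y l)

  semicircle-ordinate : ∀ {c} → - 1# ≤ c → c ≤ 1# → ∃ λ y → OnUpperUnitSemicircle R c y
  semicircle-ordinate {c} -1≤c c≤1 =
    proj₁ y , trans (+-congˡ (proj₂ (proj₂ y))) (solve 1 (λ c → c :* c :+ (:1 :- c) :* (c :- (:- :1)) := :1) refl c) ,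
    proj₁ (proj₂ y)
    where y = sqrt (*-nonneg (≤⇒0≤- c≤1) (≤⇒0≤- -1≤c))

  edge : ∀ {x y l c y′} → Inscribed R x y l → OnUpperUnitSemicircle R c y′ → c ≤ x →
    ∃ λ δ → IsSqrt R ((c - x) * (c - x) + (y′ - y) * (y′ - y)) δ × Inscribed R c y′ (l + δ)
  edge {x} {y} {l} {c} {y′} i h c≤x = proj₁ δ , proj₂ δ , step i h c≤x (proj₂ δ) refl
    where δ = sqrt (+-nonneg (0≤x² (c - x)) (0≤x² (y′ - y)))

  arccos-exists : ∀ {c} → - 1# ≤ c → c ≤ 1# → ∃ (IsArccos R c)
  arccos-exists {c} -1≤c c≤1 = complete (λ l → ∃ λ y → Inscribed R c y l)
    (_ , _ , proj₂ (proj₂ (edge (start refl refl refl) (proj₂ (semicircle-ordinate -1≤c c≤1)) c≤1)))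
    (4# , λ { _ (_ , i) → length≤4 i })

  arccos-cong : ∀ {c c′ θ θ′} → c ≈ c′ → IsArccos R c θ → IsArccos R c′ θ′ → θ ≈ θ′
  arccos-cong c≈c′ (ub , least) (ub′ , least′) = ≤-antisym
    (least _ λ { l (y , i) → ub′ l (y , inscribed-resp c≈c′ refl refl i) })
    (least′ _ λ { l (y , i) → ub l (y , inscribed-resp (sym c≈c′) refl refl i) })

  -- Every polygonal line ending at abscissa c′ is prolonged by the same chord.
  arccos-antimono : ∀ {c c′ θ θ′} → - 1# ≤ c → c < c′ → c′ ≤ 1# →
    IsArccos R c θ → IsArccos R c′ θ′ → θ′ < θ
  arccos-antimono {c} {c′} {θ} {θ′} -1≤c c<c′ c′≤1 (ub , _) (_ , least′) =
    ≤-<-trans (least′ (θ - δ) bound) (<-by 0<δ (solve 2 (λ s e → s :- (s :- e) := e) refl θ δ))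
    where
    y = semicircle-ordinate -1≤c (≤-trans (inj₁ c<c′) c′≤1)
    y′ = semicircle-ordinate (≤-trans -1≤c (inj₁ c<c′)) c′≤1
    w = proj₁ y - proj₁ y′
    δ-sqrt = sqrt (+-nonneg (0≤x² (c - c′)) (0≤x² w))
    δ = proj₁ δ-sqrt
    0<δ : 0# < δ
    0<δ = sqrt-pos (+-pos-nonneg (0<x² (λ eq → <⇒≉ c<c′ (x-y≈0⇒x≈y eq))) (0≤x² w)) (proj₂ δ-sqrt)
    bound : IsUpperBound _≤_ (λ l → ∃ λ z → Inscribed R c′ z l) (θ - δ)
    bound l (z , i) = ≤-by (≤⇒0≤- (ub (l + δ) (proj₁ y , step i (proj₂ y) (inj₁ c<c′)
        (sqrt-resp chord (proj₂ δ-sqrt)) refl)))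
      (solve 3 (λ θ δ l → θ :- δ :- l := θ :- (l :+ δ)) refl θ δ l)
      where
      -- On the upper semicircle the abscissa determines the ordinate, so lines ending at abscissa
      -- `c′` all end at one point and the added chord has a fixed length.
      y′≈z : proj₁ y′ ≈ z
      y′≈z = ≤-antisym (ordinate-mono (inscribed-onSemicircle i) (proj₂ y′) ≤-refl)
                       (ordinate-mono (proj₂ y′) (inscribed-onSemicircle i) ≤-refl)
      chord : (c - c′) * (c - c′) + w * w ≈ (c - c′) * (c - c′) + (proj₁ y - z) * (proj₁ y - z)
      chord = +-congˡ (*-cong (+-congˡ (-‿cong y′≈z)) (+-congˡ (-‿cong y′≈z)))

  arccos-injective : ∀ {c c′ θ θ′} → - 1# ≤ c → c ≤ 1# → - 1# ≤ c′ → c′ ≤ 1# →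
    IsArccos R c θ → IsArccos R c′ θ′ → θ ≈ θ′ → c ≈ c′
  arccos-injective {c} {c′} p q p′ q′ a a′ θ≈θ′ with compare c c′
  ... | tri≈ _ eq _ = eq
  ... | tri< c<c′ _ _ = ⊥-elim (<-irrefl (sym θ≈θ′) (arccos-antimono p c<c′ q′ a a′))
  ... | tri> _ _ c′<c = ⊥-elim (<-irrefl θ≈θ′ (arccos-antimono p′ c′<c q a′ a))

  -1<1 : - 1# < 1#
  -1<1 = <-by 0<2 (solve 0 (:1 :- (:- :1) := :2) refl)

  arccos-pos : ∀ {c θ} → - 1# ≤ c → c < 1# → IsArccos R c θ → 0# < θ
  arccos-pos -1≤c c<1 a = ≤-<-trans (proj₁ (proj₂ least) 0# (0# , start refl refl refl))
      (arccos-antimono -1≤c c<1 ≤-refl a (proj₂ least))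
    where least = arccos-exists (inj₁ -1<1) ≤-refl

  arccos<π : ∀ {c θ} → - 1# < c → c ≤ 1# → IsArccos R c θ → ∃ λ π → IsPi R π × θ < π
  arccos<π -1<c c≤1 a = proj₁ π , proj₂ π , arccos-antimono ≤-refl -1<c c≤1 (proj₂ π) a
    where π = arccos-exists ≤-refl (inj₁ -1<1)

-- Linear dependence of d + 1 vectors in dimension d

module LinearDependence (F : OrderedField) where
  open OrderedFieldProperties F
  open import Algebra.Properties.Semiring.Sum semiring public
    using (sum; sum-cong-≋; sum-remove; sum-replicate-zero; *-distribˡ-sum; *-distribʳ-sum; ∑-comm)
  open import Relation.Binary.Reasoning.Setoid setoid

  sum≈0 : ∀ {n} {t : Vector Carrier n} → (∀ i → t i ≈ 0#) → sum t ≈ 0#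
  sum≈0 {n} t≈0 = trans (sum-cong-≋ t≈0) (sum-replicate-zero n)

  sum-pos : ∀ {n} {t : Vector Carrier (suc n)} → (∀ i → 0# < t i) → 0# < sum t
  sum-pos {zero}  0<t = +-pos-nonneg (0<t zero) ≤-refl
  sum-pos {suc n} 0<t = +-pos (0<t zero) (sum-pos (0<t ∘ suc))

  sum-eliminate : ∀ {n} (b m x : Vector Carrier n) y →
    (- sum (λ i → b i * m i)) * y + sum (λ i → b i * x i) ≈ sum (λ i → b i * (x i + - m i * y))
  sum-eliminate {zero}  b m x y = solve 1 (λ y → :- :0 :* y :+ :0 := :0) refl y
  sum-eliminate {suc n} b m x y = trans
    (solve 6 (λ b m x y s t → :- (b :* m :+ s) :* y :+ (b :* x :+ t) := b :* (x :+ :- m :* y) :+ (:- s :* y :+ t))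
      refl (b zero) (m zero) (x zero) y (sum (λ i → b (suc i) * m (suc i))) (sum (λ i → b (suc i) * x (suc i))))
    (+-congˡ (sum-eliminate (b ∘ suc) (m ∘ suc) (x ∘ suc) y))

  -- Gaussian elimination on the first coordinate. If it vanishes throughout, one vector gets
  -- coefficient zero. Otherwise multiples `m i` of a pivot vector are subtracted from the others,
  -- the shortened vectors are dependent by induction, and the pivot receives minus the sum of all
  -- `b i * m i`.
  dependent : ∀ d (u : Fin (suc d) → Vector Carrier d) →
    ∃ λ (a : Vector Carrier (suc d)) → (∃ λ i → ¬ a i ≈ 0#) × (∀ k → sum (λ i → a i * u i k) ≈ 0#)
  dependent zero    u = (λ _ → 1#) , (zero , λ 1≈0 → 0≉1 (sym 1≈0)) , λ ()
  dependent (suc d) u with any? (λ i → ¬? (u i zero ≟ 0#))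
  ... | no allZero = 0# Vector.∷ b , (suc (proj₁ b≉0) , proj₂ b≉0) , combination
    where
    ih = dependent d (λ i k → u (suc i) (suc k))
    b = proj₁ ih
    b≉0 = proj₁ (proj₂ ih)
    head≈0 : ∀ i → u i zero ≈ 0#
    head≈0 i with u i zero ≟ 0#
    ... | yes eq = eq
    ... | no neq = ⊥-elim (allZero (i , neq))
    combination : ∀ k → sum (λ i → (0# Vector.∷ b) i * u i k) ≈ 0#
    combination zero = sum≈0 (λ i → trans (*-congˡ {(0# Vector.∷ b) i} (head≈0 i)) (zeroʳ ((0# Vector.∷ b) i)))
    combination (suc k) = trans (+-cong (zeroˡ _) (proj₂ (proj₂ ih) k)) (+-identityˡ 0#)
  ... | yes (p , pivot≉0) = a , (punchIn p (proj₁ b≉0) , a≉0) , combination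
    where
    m : Vector Carrier (suc d)
    m i = proj₁ (divide (u p zero) (u (punchIn p i) zero) pivot≉0)
    ih = dependent d (λ i k → u (punchIn p i) (suc k) + - m i * u p (suc k))
    b = proj₁ ih
    b≉0 = proj₁ (proj₂ ih)
    a : Vector Carrier (suc (suc d))
    a = insertAt b p (- sum (λ i → b i * m i))
    a≉0 : ¬ a (punchIn p (proj₁ b≉0)) ≈ 0#
    a≉0 eq = proj₂ b≉0 (trans (reflexive (≡.sym (insertAt-punchIn b p _ (proj₁ b≉0)))) eq)
    eliminated : ∀ k → sum (λ i → b i * (u (punchIn p i) k + - m i * u p k)) ≈ 0#
    eliminated zero = sum≈0 λ i → trans (*-congˡ (trans
        (+-congʳ (sym (proj₂ (divide (u p zero) (u (punchIn p i) zero) pivot≉0))))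
      (solve 2 (λ x y → x :* y :+ :- y :* x := :0) refl (u p zero) (m i)))) (zeroʳ (b i))
    eliminated (suc k) = proj₂ (proj₂ ih) k
    combination : ∀ k → sum (λ i → a i * u i k) ≈ 0#
    combination k = begin
      sum (λ i → a i * u i k)
        ≈⟨ sum-remove {i = p} (λ i → a i * u i k) ⟩
      a p * u p k + sum (λ i → a (punchIn p i) * u (punchIn p i) k)
        ≈⟨ +-cong (*-congʳ (reflexive (insertAt-lookup b p (- sum (λ i → b i * m i)))))
             (sum-cong-≋ (λ i → *-congʳ {u (punchIn p i) k}
               (reflexive (insertAt-punchIn b p (- sum (λ i → b i * m i)) i)))) ⟩
      (- sum (λ i → b i * m i)) * u p k + sum (λ i → b i * u (punchIn p i) k)
        ≈⟨ sum-eliminate b m (λ i → u (punchIn p i) k) (u p k) ⟩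
      sum (λ i → b i * (u (punchIn p i) k + - m i * u p k))                  ≈⟨ eliminated k ⟩
      0#                                                                     ∎

-- Squared distances, Gram determinants and Heron's expression

module EuclideanProperties (R : CompleteOrderedField) where
  open RealProperties R
  open LinearDependence orderedField
  open import Relation.Binary.Reasoning.Setoid setoid

  infixl 7 _·_
  _·_ : ∀ {d} → Vector Carrier d → Vector Carrier d → Carrier
  u · v = ⟨_,_⟩ R u v

  dist² : ∀ {d} → Point R d → Point R d → Carrier
  dist² p q = vec R q p · vec R q p

  ·-cong : ∀ {d} {u u′ v v′ : Vector Carrier d} → (∀ i → u i ≈ u′ i) → (∀ i → v i ≈ v′ i) → u · v ≈ u′ · v′
  ·-cong u≈ v≈ = sum-cong-≋ (λ i → *-cong (u≈ i) (v≈ i))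

  ·-comm : ∀ {d} (u v : Vector Carrier d) → u · v ≈ v · u
  ·-comm u v = sum-cong-≋ (λ i → *-comm (u i) (v i))

  ·-linear : ∀ {d} a b (u v w : Vector Carrier d) → (λ i → a * u i + b * v i) · w ≈ a * (u · w) + b * (v · w)
  ·-linear {zero}  a b u v w = solve 2 (λ a b → :0 := a :* :0 :+ b :* :0) refl a b
  ·-linear {suc d} a b u v w = trans (+-congˡ (·-linear a b (u ∘ suc) (v ∘ suc) (w ∘ suc)))
    (solve 7 (λ a b u v w s t → (a :* u :+ b :* v) :* w :+ (a :* s :+ b :* t) := a :* (u :* w :+ s) :+ b :*
        (v :* w :+ t))
      refl a b (u zero) (v zero) (w zero) ((u ∘ suc) · (w ∘ suc)) ((v ∘ suc) · (w ∘ suc)))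

  ·-square : ∀ {d} a b (u v w : Vector Carrier d) → (∀ i → w i ≈ a * u i + b * v i) →
    w · w ≈ a * a * (u · u) + 2# * (a * b * (u · v)) + b * b * (v · v)
  ·-square a b u v w w≈ = begin
    w · w                                            ≈⟨ ·-cong w≈ (λ _ → refl) ⟩
    (λ i → a * u i + b * v i) · w                    ≈⟨ ·-linear a b u v w ⟩
    a * (u · w) + b * (v · w)                        ≈⟨ +-cong (*-congˡ (dot u)) (*-congˡ (dot v)) ⟩
    a * (a * (u · u) + b * (v · u)) + b * (a * (u · v) + b * (v · v))
                                                     ≈⟨ +-congʳ (*-congˡ (+-congˡ (*-congˡ (·-comm v u)))) ⟩
    a * (a * (u · u) + b * (u · v)) + b * (a * (u · v) + b * (v · v))
      ≈⟨ solve 5 (λ a b x y z → a :* (a :* x :+ b :* y) :+ b :* (a :* y :+ b :* z) :=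
           a :* a :* x :+ :2 :* (a :* b :* y) :+ b :* b :* z) refl a b (u · u) (u · v) (v · v) ⟩
    a * a * (u · u) + 2# * (a * b * (u · v)) + b * b * (v · v) ∎
    where
    dot : ∀ x → x · w ≈ a * (u · x) + b * (v · x)
    dot x = trans (·-comm x w) (trans (·-cong w≈ (λ _ → refl)) (·-linear a b u v x))

  ·-nonneg : ∀ {d} (u : Vector Carrier d) → 0# ≤ u · u
  ·-nonneg {zero}  u = ≤-refl
  ·-nonneg {suc d} u = +-nonneg (0≤x² (u zero)) (·-nonneg (u ∘ suc))

  ·-definite : ∀ {d} (u : Vector Carrier d) → u · u ≈ 0# → ∀ i → u i ≈ 0#
  ·-definite {suc d} u eq zero    = x²≈0⇒x≈0 (proj₁ (nonneg+nonneg≈0 (0≤x² (u zero)) (·-nonneg (u ∘ suc)) eq))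
  ·-definite {suc d} u eq (suc i) = ·-definite (u ∘ suc)
    (proj₂ (nonneg+nonneg≈0 (0≤x² (u zero)) (·-nonneg (u ∘ suc)) eq)) i

  polarization : ∀ {d} (p q r : Point R d) → vec R q p · vec R q r ≈ p · r - p · q - q · r + q · q
  polarization {zero}  p q r = solve 0 (:0 := :0 :- :0 :- :0 :+ :0) refl
  polarization {suc d} p q r = trans (+-congˡ (polarization (p ∘ suc) (q ∘ suc) (r ∘ suc)))
    (solve 7 (λ p q r a b c e → (p :- q) :* (r :- q) :+ (a :- b :- c :+ e) :=
        p :* r :+ a :- (p :* q :+ b) :- (q :* r :+ c) :+ (q :* q :+ e))
      refl (p zero) (q zero) (r zero) ((p ∘ suc) · (r ∘ suc)) ((p ∘ suc) · (q ∘ suc)) ((q ∘ suc) · (r ∘ suc))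
          ((q ∘ suc) · (q ∘ suc)))

  dist²-gram : ∀ {d} (p q : Point R d) → dist² p q ≈ p · p - 2# * (p · q) + q · q
  dist²-gram p q = trans (polarization p q p) (trans (+-congʳ (+-congˡ (-‿cong (·-comm q p))))
    (solve 3 (λ a b c → a :- b :- b :+ c := a :- :2 :* b :+ c) refl (p · p) (p · q) (q · q)))

  dist²-sym : ∀ {d} (p q : Point R d) → dist² p q ≈ dist² q p
  dist²-sym p q = sum-cong-≋ (λ i → solve 2 (λ x y → (x :- y) :* (x :- y) := (y :- x) :* (y :- x)) refl (p i) (q i))

  dist²-refl : ∀ {d} (p : Point R d) → dist² p p ≈ 0#
  dist²-refl p = sum≈0 (λ i → solve 1 (λ x → (x :- x) :* (x :- x) := :0) refl (p i))

  law-of-cosines : ∀ {d} (p q r : Point R d) →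
    2# * (vec R q p · vec R q r) ≈ dist² p q + dist² r q - dist² p r
  law-of-cosines p q r = begin
    2# * (vec R q p · vec R q r)                     ≈⟨ *-congˡ (polarization p q r) ⟩
    2# * (p · r - p · q - q · r + q · q)
      ≈⟨ solve 6 (λ pp qq rr pq qr pr → :2 :* (pr :- pq :- qr :+ qq) :=
          pp :- :2 :* pq :+ qq :+ (rr :- :2 :* qr :+ qq) :- (pp :- :2 :* pr :+ rr))
          refl (p · p) (q · q) (r · r) (p · q) (q · r) (p · r) ⟩
    p · p - 2# * (p · q) + q · q + (r · r - 2# * (q · r) + q · q) - (p · p - 2# * (p · r) + r · r)
      ≈⟨ +-cong (+-cong (sym (dist²-gram p q))
           (trans (+-congʳ (+-congˡ (-‿cong (*-congˡ (·-comm q r))))) (sym (dist²-gram r q))))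
           (-‿cong (sym (dist²-gram p r))) ⟩
    dist² p q + dist² r q - dist² p r                ∎

  -- Heron: sixteen times the squared area of a triangle with squared side
  -- lengths x, y, z.
  heron : Carrier → Carrier → Carrier → Carrier
  heron x y z = 4# * (x * y) - (x + y - z) * (x + y - z)

  heron-cong : ∀ {x y z x′ y′ z′} → x ≈ x′ → y ≈ y′ → z ≈ z′ → heron x y z ≈ heron x′ y′ z′
  heron-cong a b c = +-cong (*-congˡ (*-cong a b)) (-‿cong (*-cong h h))
    where h = +-cong (+-cong a b) (-‿cong c)

  :heron : ∀ {n} → Polynomial n → Polynomial n → Polynomial n → Polynomial n
  :heron x y z = (:2 :+ :2) :* (x :* y) :- (x :+ y :- z) :* (x :+ y :- z)

  heron-gram : ∀ {d} (p q r : Point R d) → let u = vec R q p; w = vec R q r in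
    heron (dist² p q) (dist² r q) (dist² p r) ≈ 4# * ((u · u) * (w · w) - (u · w) * (u · w))
  heron-gram p q r = trans (+-congˡ (-‿cong (*-cong (sym (law-of-cosines p q r)) (sym (law-of-cosines p q r)))))
    (solve 3 (λ x y z → (:2 :+ :2) :* (x :* y) :- (:2 :* z) :* (:2 :* z) := (:2 :+ :2) :* (x :* y :- z :* z))
      refl (dist² p q) (dist² r q) (vec R q p · vec R q r))

  -- `z` is `u · u` times the component of `w` orthogonal to `u`. Nonnegativity of its squared
  -- length gives the Cauchy-Schwarz inequality, and its vanishing is the equality case behind
  -- `heron≈0⇒on-line`.
  cauchy-schwarz-defect : ∀ {d} (u w : Vector Carrier d) →
    let z = λ i → (u · u) * w i + (- (u · w)) * u i in
    z · z ≈ (u · u) * ((u · u) * (w · w) - (u · w) * (u · w))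
  cauchy-schwarz-defect u w = trans (·-square (u · u) (- (u · w)) w u _ (λ _ → refl))
    (trans (+-congʳ (+-congˡ (*-congˡ (*-congˡ (·-comm w u)))))
      (solve 3 (λ x y z → x :* x :* z :+ :2 :* (x :* (:- y) :* y) :+ (:- y) :* (:- y) :* x := x :* (x :* z :- y :* y))
        refl (u · u) (u · w) (w · w)))

  heron-nonneg : ∀ {d} (p q r : Point R d) → 0# < dist² p q → 0# ≤ heron (dist² p q) (dist² r q) (dist² p r)
  heron-nonneg p q r 0<pq = ≤-respʳ-≈ (sym (heron-gram p q r)) (*-nonneg (inj₁ 0<4)
    (*-cancelˡ-nonneg 0<pq (≤-respʳ-≈ (cauchy-schwarz-defect u w)
        (·-nonneg (λ i → (u · u) * w i + (- (u · w)) * u i)))))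
    where
    u = vec R q p
    w = vec R q r

  heron≈0⇒on-line : ∀ {d} (p q r : Point R d) → 0# < dist² p q →
    heron (dist² p q) (dist² r q) (dist² p r) ≈ 0# → ∃ λ t → ∀ i → r i ≈ q i + t * (p i - q i)
  heron≈0⇒on-line p q r 0<pq h≈0 = proj₁ t , λ i → *-cancelˡ (>⇒≉ 0<pq) (begin
      x * r i
        ≈⟨ solve 3 (λ x q w → x :* w := x :* q :+ x :* (w :- q)) refl x (q i) (r i) ⟩
      x * q i + x * w i                          ≈⟨ +-congˡ (x-y≈0⇒x≈y (trans (+-congˡ (-‿distribˡ-* _ _)) (z≈0 i))) ⟩
      x * q i + (u · w) * u i                    ≈⟨ +-congˡ (*-congʳ (proj₂ t)) ⟨
      x * q i + x * proj₁ t * u i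
        ≈⟨ solve 4 (λ x q t u → x :* q :+ x :* t :* u := x :* (q :+ t :* u)) refl x (q i) (proj₁ t) (u i) ⟩
      x * (q i + proj₁ t * u i)                  ∎)
    where
    open import Algebra.Properties.Ring ring using (-‿distribˡ-*)
    u = vec R q p
    w = vec R q r
    x = u · u
    t = divide x (u · w) (>⇒≉ 0<pq)
    gram≈0 : x * (w · w) - (u · w) * (u · w) ≈ 0#
    gram≈0 = x*y≈0⇒y≈0 (>⇒≉ 0<4) (trans (sym (heron-gram p q r)) h≈0)
    z≈0 : ∀ i → x * w i + (- (u · w)) * u i ≈ 0#
    z≈0 = ·-definite _ (trans (cauchy-schwarz-defect u w) (trans (*-congˡ gram≈0) (zeroʳ x)))

  -- Stewart's theorem. It expresses the distances of a point `w` on a line in terms of distances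
  -- among the other points, so that the areas of triangles at `w` can be computed without
  -- coordinates.
  stewart : ∀ {d} (p q w k : Point R d) t → (∀ i → w i ≈ q i + t * (p i - q i)) →
    dist² w k ≈ t * t * dist² p q - t * (dist² p q + dist² q k - dist² p k) + dist² q k
  stewart p q w k t w≈ = begin
    dist² w k
      ≈⟨ ·-square t 1# (vec R q p) (vec R k q) (vec R k w) (λ i → trans (+-congʳ (w≈ i))
           (solve 4 (λ t p q k → q :+ t :* (p :- q) :- k := t :* (p :- q) :+ :1 :* (q :- k)) refl t (p i) (q i)
               (k i))) ⟩
    t * t * dist² p q + 2# * (t * 1# * c) + 1# * 1# * dist² q k
      ≈⟨ solve 4 (λ t X c Y → t :* t :* X :+ :2 :* (t :* :1 :* c) :+ :1 :* :1 :* Y :=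
           t :* t :* X :- t :* (X :+ Y :- (:1 :* :1 :* X :+ :2 :* (:1 :* :1 :* c) :+ :1 :* :1 :* Y)) :+ Y)
           refl t (dist² p q) c (dist² q k) ⟩
    t * t * dist² p q - t * (dist² p q + dist² q k -
        (1# * 1# * dist² p q + 2# * (1# * 1# * c) + 1# * 1# * dist² q k)) + dist² q k
      ≈⟨ +-congʳ (+-congˡ (-‿cong (*-congˡ (+-congˡ (-‿cong pk))))) ⟨
    t * t * dist² p q - t * (dist² p q + dist² q k - dist² p k) + dist² q k ∎
    where
    c = vec R q p · vec R k q
    pk : dist² p k ≈ 1# * 1# * dist² p q + 2# * (1# * 1# * c) + 1# * 1# * dist² q k
    pk = ·-square 1# 1# (vec R q p) (vec R k q) (vec R k p)
      (λ i → solve 3 (λ p q k → p :- k := :1 :* (p :- q) :+ :1 :* (q :- k)) refl (p i) (q i) (k i))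

  -- The Gram matrix r (I + J) is positive definite.
  no-long-equiangular-family : ∀ {d} r → 0# < r → (u : Fin (suc d) → Vector Carrier d) →
    (∀ i → u i · u i ≈ 2# * r) → (∀ i j → i ≢ j → u i · u j ≈ r) → ⊥
  no-long-equiangular-family {d} r 0<r u diag offDiag = a≉0 a≈0
    where
    a : Vector Carrier (suc d)
    a = proj₁ (dependent d u)
    i₀ = proj₁ (proj₁ (proj₂ (dependent d u)))
    a≉0 : ¬ a i₀ ≈ 0#
    a≉0 = proj₂ (proj₁ (proj₂ (dependent d u)))
    combination : ∀ k → sum (λ i → a i * u i k) ≈ 0#
    combination = proj₂ (proj₂ (dependent d u))
    Σa = sum a
    pairing : ∀ (w : Vector Carrier d) → sum (λ i → a i * (u i · w)) ≈ 0#
    pairing w = begin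
      sum (λ i → a i * sum (λ k → u i k * w k))     ≈⟨ sum-cong-≋ (λ i → *-distribˡ-sum (a i) (λ k → u i k * w k)) ⟩
      sum (λ i → sum (λ k → a i * (u i k * w k)))   ≈⟨ ∑-comm (λ i k → a i * (u i k * w k)) ⟩
      sum (λ k → sum (λ i → a i * (u i k * w k)))
        ≈⟨ sum≈0 (λ k → trans (sum-cong-≋ (λ i → sym (*-assoc (a i) (u i k) (w k))))
             (trans (sym (*-distribʳ-sum (w k) (λ i → a i * u i k)))
               (trans (*-congʳ (combination k)) (zeroˡ (w k))))) ⟩
      0#                                            ∎
    -- Pairing the linear relation with `u j` gives r (a j + Σa) = 0.
    a≈-Σa : ∀ j → a j ≈ - Σa
    a≈-Σa j = x-y≈0⇒x≈y (x*y≈0⇒y≈0 (>⇒≉ 0<r) (begin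
      r * (a j - - Σa)
        ≈⟨ *-congˡ (+-congˡ (-‿cong (-‿cong (sum-remove {i = j} a)))) ⟩
      r * (a j - - (a j + sum (λ i → a (punchIn j i))))
        ≈⟨ solve 3 (λ r a s → r :* (a :- (:- (a :+ s))) := a :* (:2 :* r) :+ s :* r) refl r (a j)
          (sum (λ i → a (punchIn j i))) ⟩
      a j * (2# * r) + sum (λ i → a (punchIn j i)) * r
        ≈⟨ +-cong (*-congˡ (sym (diag j))) (*-distribʳ-sum r (λ i → a (punchIn j i))) ⟩
      a j * (u j · u j) + sum (λ i → a (punchIn j i) * r)
        ≈⟨ +-congˡ (sum-cong-≋ (λ i → *-congˡ (sym (offDiag (punchIn j i) j (λ eq → punchInᵢ≢i j i eq))))) ⟩
      a j * (u j · u j) + sum (λ i → a (punchIn j i) * (u (punchIn j i) · u j))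
        ≈⟨ sum-remove {i = j} (λ i → a i * (u i · u j)) ⟨
      sum (λ i → a i * (u i · u j))                                         ≈⟨ pairing (u j) ⟩
      0#                                                                    ∎))
    -- All coefficients equal `- Σa`, so their sum would have the sign opposite to its own unless it
    -- vanishes. This avoids dividing by the number of vectors plus one.
    a≈0 : a i₀ ≈ 0#
    a≈0 with compare Σa 0#
    ... | tri≈ _ eq _ = trans (a≈-Σa i₀) (trans (-‿cong eq) (solve 0 (:- :0 := :0) refl))
    ... | tri< Σa<0 _ _ = ⊥-elim (<-asym Σa<0 (sum-pos (λ i → <-respʳ-≈ (sym (a≈-Σa i)) (neg-pos Σa<0))))
    ... | tri> _ _ 0<Σa = ⊥-elim (<-asym 0<Σa (<-by (sum-pos (λ i → <-respʳ-≈ (-Σ i) 0<Σa))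
          (trans (+-identityˡ _) (-sum a))))
      where
      -Σ : ∀ i → Σa ≈ - a i
      -Σ i = trans (solve 1 (λ x → x := :- (:- x)) refl Σa) (-‿cong (sym (a≈-Σa i)))
      -sum : ∀ {n} (t : Vector Carrier n) → - sum t ≈ sum (λ i → - t i)
      -sum {zero} t = solve 0 (:- :0 := :0) refl
      -sum {suc n} t = trans (solve 2 (λ x y → :- (x :+ y) := :- x :+ :- y) refl (t zero) (sum (t ∘ suc)))
          (+-congˡ (-sum (t ∘ suc)))

-- Cosines in terms of squared side lengths

module CosineProperties (R : CompleteOrderedField) where
  open RealProperties R
  open ArccosProperties R
  open EuclideanProperties R
  open import Relation.Binary.Reasoning.Setoid setoid

  -- c is the cosine of the angle between the sides of squared lengths x and y
  -- of a triangle whose third side has squared length z.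
  HasCosine : Carrier → Carrier → Carrier → Carrier → Set
  HasCosine x y z c = ∃ λ a → ∃ λ b → IsSqrt R x a × IsSqrt R y b × 2# * (c * (a * b)) ≈ x + y - z

  hasCosine-resp : ∀ {x y z x′ y′ z′ c c′} → x ≈ x′ → y ≈ y′ → z ≈ z′ → c′ ≈ c →
    HasCosine x y z c → HasCosine x′ y′ z′ c′
  hasCosine-resp ex ey ez ec (a , b , ra , rb , eq) = a , b , sqrt-resp ex ra , sqrt-resp ey rb ,
    trans (*-congˡ (*-congʳ ec)) (trans eq (+-cong (+-cong ex ey) (-‿cong ez)))

  hasCosine-swap : ∀ {x y z c} → HasCosine x y z c → HasCosine y x z c
  hasCosine-swap (a , b , ra , rb , eq) = b , a , rb , ra ,
    trans (*-congˡ (*-congˡ (*-comm b a))) (trans eq (+-congʳ (+-comm _ _)))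

  -- The factor `1# - c * c` is the squared sine of the angle, so a positive area puts the cosine
  -- strictly between -1 and 1.
  cosine-heron : ∀ {x y z c} → HasCosine x y z c → heron x y z ≈ 4# * (x * y) * (1# - c * c)
  cosine-heron {x} {y} {z} {c} (a , b , (_ , a²) , (_ , b²) , eq) = begin
    4# * (x * y) - (x + y - z) * (x + y - z)
      ≈⟨ +-congˡ (-‿cong (*-cong (sym eq) (sym eq))) ⟩
    4# * (x * y) - 2# * (c * (a * b)) * (2# * (c * (a * b)))
      ≈⟨ +-congʳ (*-congˡ (*-cong (sym a²) (sym b²))) ⟩
    4# * (a * a * (b * b)) - 2# * (c * (a * b)) * (2# * (c * (a * b)))
      ≈⟨ solve 3 (λ a b c → (:2 :+ :2) :* (a :* a :* (b :* b)) :- :2 :* (c :* (a :* b)) :* (:2 :* (c :* (a :* b))) :=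
           (:2 :+ :2) :* (a :* a :* (b :* b)) :* (:1 :- c :* c)) refl a b c ⟩
    4# * (a * a * (b * b)) * (1# - c * c)
      ≈⟨ *-congʳ (*-congˡ (*-cong a² b²)) ⟩
    4# * (x * y) * (1# - c * c) ∎

  cosine-exists : ∀ {x y} z → 0# < x → 0# < y → ∃ (HasCosine x y z)
  cosine-exists {x} {y} z 0<x 0<y = proj₁ c , proj₁ a , proj₁ b , proj₂ a , proj₂ b ,
      trans (solve 2 (λ c w → :2 :* (c :* w) := :2 :* w :* c) refl (proj₁ c) (proj₁ a * proj₁ b)) (proj₂ c)
    where
    a = sqrt (inj₁ 0<x)
    b = sqrt (inj₁ 0<y)
    c = divide (2# * (proj₁ a * proj₁ b)) (x + y - z)
          (>⇒≉ (*-pos 0<2 (*-pos (sqrt-pos 0<x (proj₂ a)) (sqrt-pos 0<y (proj₂ b)))))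

  cosine-unique : ∀ {x y z x′ y′ z′ c c′} → 0# < x → 0# < y → x ≈ x′ → y ≈ y′ → z ≈ z′ →
    HasCosine x y z c → HasCosine x′ y′ z′ c′ → c ≈ c′
  cosine-unique {c = c} {c′} 0<x 0<y ex ey ez (a , b , ra , rb , eq) (a′ , b′ , ra′ , rb′ , eq′) =
    *-cancelˡ (>⇒≉ (*-pos 0<2 (*-pos (sqrt-pos 0<x ra) (sqrt-pos 0<y rb)))) (begin
      2# * (a * b) * c       ≈⟨ solve 3 (λ a b c → :2 :* (a :* b) :* c := :2 :* (c :* (a :* b))) refl a b c ⟩
      2# * (c * (a * b))     ≈⟨ trans eq (trans (+-cong (+-cong ex ey) (-‿cong ez)) (sym eq′)) ⟩
      2# * (c′ * (a′ * b′))
        ≈⟨ *-congˡ (*-congˡ (*-cong (sqrt-unique (sqrt-resp (sym ex) ra′) ra)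
          (sqrt-unique (sqrt-resp (sym ey) rb′) rb))) ⟩
      2# * (c′ * (a * b))    ≈⟨ solve 3 (λ a b c → :2 :* (a :* b) :* c := :2 :* (c :* (a :* b))) refl a b c′ ⟨
      2# * (a * b) * c′      ∎)

  c²<1⇒-1<c<1 : ∀ {c} → 0# < 1# - c * c → - 1# < c × c < 1#
  c²<1⇒-1<c<1 {c} h =
    <-by (<⇒0<- (c<1 (<-respʳ-≈ (solve 1 (λ c → :1 :- c :* c := :1 :- (:- c) :* (:- c)) refl c) h)))
      (solve 1 (λ c → c :- (:- :1) := :1 :- (:- c)) refl c) , c<1 h
    where
    c<1 : ∀ {c} → 0# < 1# - c * c → c < 1#
    c<1 {c} h = sqr-cancel-< (inj₁ 0<1) (<-by h (+-congʳ (*-identityʳ 1#)))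

  isAngle⇒hasCosine : ∀ {d} (p q r : Point R d) {θ} → IsAngle R p q r θ →
    ∃ λ c → HasCosine (dist² p q) (dist² r q) (dist² p r) c × IsArccos R c θ
  isAngle⇒hasCosine p q r (a , b , c , ra , rb , eq , arccos) =
    c , (a , b , ra , rb , trans (*-congˡ eq) (law-of-cosines p q r)) , arccos

  hasCosine⇒isAngle : ∀ {d} (p q r : Point R d) {c θ} →
    HasCosine (dist² p q) (dist² r q) (dist² p r) c → IsArccos R c θ → IsAngle R p q r θ
  hasCosine⇒isAngle p q r {c} (a , b , ra , rb , eq) arccos =
    a , b , c , ra , rb , *-cancelˡ (>⇒≉ 0<2) (trans eq (sym (law-of-cosines p q r))) , arccos

  nondegenerate-cosine : ∀ {x y z c} → 0# < x → 0# < y → 0# < heron x y z → HasCosine x y z c → 0# < 1# - c * c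
  nondegenerate-cosine 0<x 0<y 0<h cos =
    *-cancelˡ-pos (inj₁ (*-pos 0<4 (*-pos 0<x 0<y))) (<-respʳ-≈ (cosine-heron cos) 0<h)

  -- x = a², and so on: a = c (b + e) and b = c (a + e) give (a − b)(1 + c) = 0.
  equiangular⇒equilateral : ∀ {x y z c} → 0# < x → 0# < y → 0# < z → - 1# < c →
    HasCosine x y z c → HasCosine x z y c → HasCosine y z x c → x ≈ y × x ≈ z
  equiangular⇒equilateral {x} {y} {z} {c} 0<x 0<y 0<z -1<c (a , b , ra , rb , eq₁) (a′ , e , ra′ , re , eq₂)
      (b′ , e′ , rb′ , re′ , eq₃) =
    trans (sym (proj₂ ra)) (trans (*-cong a≈b a≈b) (proj₂ rb)) ,
    trans (sym (proj₂ ra)) (trans (*-cong a≈e a≈e) (proj₂ re))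
    where
    a′≈a = sqrt-unique ra′ ra
    b′≈b = sqrt-unique rb′ rb
    e′≈e = sqrt-unique re′ re
    eq₂′ : 2# * (c * (a * e)) ≈ x + z - y
    eq₂′ = trans (*-congˡ (*-congˡ (*-congʳ (sym a′≈a)))) eq₂
    eq₃′ : 2# * (c * (b * e)) ≈ y + z - x
    eq₃′ = trans (*-congˡ (*-congˡ (*-cong (sym b′≈b) (sym e′≈e)))) eq₃
    -- Adding the laws of cosines at the two ends of the side `a`: the side is the sum of the
    -- projections of the other two onto it.
    projection : ∀ {x y z a b e} → 0# < x → IsSqrt R x a →
      2# * (c * (a * b)) ≈ x + y - z → 2# * (c * (a * e)) ≈ x + z - y → a ≈ c * (b + e)
    projection {x} {y} {z} {a} {b} {e} 0<x ra p q = *-cancelˡ (>⇒≉ (*-pos 0<2 (sqrt-pos 0<x ra))) (begin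
      2# * a * a                                   ≈⟨ trans (*-assoc 2# a a) (*-congˡ (proj₂ ra)) ⟩
      2# * x
        ≈⟨ solve 3 (λ x y z → :2 :* x := (x :+ y :- z) :+ (x :+ z :- y)) refl x y z ⟩
      (x + y - z) + (x + z - y)                    ≈⟨ +-cong p q ⟨
      2# * (c * (a * b)) + 2# * (c * (a * e))
        ≈⟨ solve 4 (λ a b c e → :2 :* (c :* (a :* b)) :+ :2 :* (c :* (a :* e)) := :2 :* a :* (c :* (b :+ e)))
          refl a b c e ⟩
      2# * a * (c * (b + e))                       ∎)
    swap : ∀ {x y z a b} → 2# * (c * (a * b)) ≈ x + y - z → 2# * (c * (b * a)) ≈ y + x - z
    swap p = trans (*-congˡ (*-congˡ (*-comm _ _))) (trans p (+-congʳ (+-comm _ _)))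
    a≈ = projection {x} {y} {z} 0<x ra eq₁ eq₂′
    b≈ = projection {y} {x} {z} 0<y rb (swap eq₁) eq₃′
    e≈ = projection {z} {x} {y} 0<z re (swap eq₂′) (swap eq₃′)
    0<1+c : 0# < 1# + c
    0<1+c = <-respʳ-≈ (solve 1 (λ c → c :- (:- :1) := :1 :+ c) refl c) (<⇒0<- -1<c)
    cancel : ∀ {a b e} → a ≈ c * (b + e) → b ≈ c * (a + e) → a ≈ b
    cancel {a} {b} {e} p q = x-y≈0⇒x≈y (x*y≈0⇒y≈0 (>⇒≉ 0<1+c) (begin
      (1# + c) * (a - b)
        ≈⟨ solve 3 (λ a b c → (:1 :+ c) :* (a :- b) := a :- b :+ c :* (a :- b)) refl a b c ⟩
      a - b + c * (a - b)                     ≈⟨ +-congʳ (+-cong p (-‿cong q)) ⟩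
      c * (b + e) - c * (a + e) + c * (a - b)
        ≈⟨ solve 4 (λ a b c e → c :* (b :+ e) :- c :* (a :+ e) :+ c :* (a :- b) := :0) refl a b c e ⟩
      0#                                      ∎))
    a≈b = cancel a≈ b≈
    a≈e = cancel {a} {e} {b} (trans a≈ (*-congˡ (+-comm _ _))) e≈

-- Lower bound: point sets with a single angle

module LowerBound (em : ExcludedMiddle 0ℓ) (R : CompleteOrderedField) {d n : ℕ}
  (P : Fin n → Point R d) (isPointSet : IsPointSet R P) where
  open RealProperties R
  open ArccosProperties R
  open EuclideanProperties R
  open CosineProperties R
  open import Relation.Binary.Reasoning.Setoid setoid

  D : Fin n → Fin n → Carrier
  D i j = dist² (P i) (P j)

  D-sym : ∀ i j → D i j ≈ D j i
  D-sym i j = dist²-sym (P i) (P j)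

  D-pos : ∀ {i j} → i ≢ j → 0# < D i j
  D-pos {i} {j} i≢j = ≤∧≉⇒< (·-nonneg (vec R (P j) (P i)))
    (λ 0≈D → i≢j (isPointSet (λ k → x-y≈0⇒x≈y (·-definite (vec R (P j) (P i)) (sym 0≈D) k))))

  area : Fin n → Fin n → Fin n → Carrier
  area i j k = heron (D i j) (D k j) (D i k)

  area-swap : ∀ i j k → area i j k ≈ area k j i
  area-swap i j k = trans (solve 3 (λ x y z → :heron x y z := :heron y x z) refl (D i j) (D k j) (D i k))
    (heron-cong refl refl (D-sym i k))

  area-rotate : ∀ i j k → area i j k ≈ area j i k
  area-rotate i j k = trans (solve 3 (λ x y z → :heron x y z := :heron x z y) refl (D i j) (D k j) (D i k))
    (heron-cong (D-sym i j) (D-sym i k) (D-sym k j))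

  Triangle : Fin n → Fin n → Fin n → Set
  Triangle i j k = i ≢ j × j ≢ k × i ≢ k × 0# < area i j k

  triangle-swap : ∀ {i j k} → Triangle i j k → Triangle k j i
  triangle-swap {i} {j} {k} (p , q , r , h) =
    ≡.≢-sym q , ≡.≢-sym p , ≡.≢-sym r , <-respʳ-≈ (area-swap i j k) h

  triangle-rotate : ∀ {i j k} → Triangle i j k → Triangle j i k
  triangle-rotate {i} {j} {k} (p , q , r , h) = ≡.≢-sym p , r , q , <-respʳ-≈ (area-rotate i j k) h

  triangle-angle : ∀ {i j k} → Triangle i j k →
    ∃ λ θ → AngleValue R P θ × ∃ λ c → HasCosine (D i j) (D k j) (D i k) c × IsArccos R c θ × - 1# < c × c < 1#
  triangle-angle {i} {j} {k} (i≢j , j≢k , i≢k , h) =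
    proj₁ θ ,
    ((i , j , k , i≢j , j≢k , i≢k , hasCosine⇒isAngle (P i) (P j) (P k) (proj₂ cos) (proj₂ θ)) ,
      arccos-pos (inj₁ (proj₁ bounds)) (proj₂ bounds) (proj₂ θ) ,
      arccos<π (proj₁ bounds) (inj₁ (proj₂ bounds)) (proj₂ θ)) ,
    proj₁ cos , proj₂ cos , proj₂ θ , bounds
    where
    cos : ∃ (HasCosine (D i j) (D k j) (D i k))
    cos = cosine-exists (D i k) (D-pos i≢j) (D-pos (≡.≢-sym j≢k))
    bounds : - 1# < proj₁ cos × proj₁ cos < 1#
    bounds = c²<1⇒-1<c<1 (nondegenerate-cosine (D-pos i≢j) (D-pos (≡.≢-sym j≢k)) h (proj₂ cos))
    θ : ∃ (IsArccos R (proj₁ cos))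
    θ = arccos-exists (inj₁ (proj₁ bounds)) (inj₁ (proj₂ bounds))

  area-nonneg : ∀ {i j} k → i ≢ j → 0# ≤ area i j k
  area-nonneg {i} {j} k i≢j = heron-nonneg (P i) (P j) (P k) (D-pos i≢j)

  -- If no triple has positive area, Heron's expression vanishes for `i₁`, `i₀` and every further
  -- point, and the equality case of Cauchy-Schwarz puts all points on the line through these two.
  triangle-exists : ∀ {i₀ i₁ : Fin n} → i₀ ≢ i₁ → ¬ Collinear R P → ∃ λ i → ∃ λ j → ∃ λ k → Triangle i j k
  triangle-exists {i₀} {i₁} i₀≢i₁ ¬collinear with em {∃ λ i → ∃ λ j → ∃ λ k → Triangle i j k}
  ... | yes t = t
  ... | no none = ⊥-elim (¬collinear (P i₀ , vec R (P i₀) (P i₁) , direction≉0 , onLine))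
    where
    direction≉0 : ¬ (∀ k → P i₁ k - P i₀ k ≈ 0#)
    direction≉0 eq = i₀≢i₁ (isPointSet (λ k → sym (x-y≈0⇒x≈y (eq k))))
    onLine : ∀ i → ∃ λ t → ∀ k → P i k ≈ P i₀ k + t * (P i₁ k - P i₀ k)
    onLine i with i ≟ᶠ i₀ | i ≟ᶠ i₁
    ... | yes ≡.refl | _ = 0# , λ k → solve 2 (λ x y → x := x :+ :0 :* (y :- x)) refl (P i k) (P i₁ k)
    ... | no _ | yes ≡.refl = 1# , λ k → solve 2 (λ x y → y := x :+ :1 :* (y :- x)) refl (P i₀ k) (P i k)
    ... | no i≢i₀ | no i≢i₁ = heron≈0⇒on-line (P i₁) (P i₀) (P i) (D-pos (≡.≢-sym i₀≢i₁))
          (≤-antisym (≮⇒≥ (λ h → none (i₁ , i₀ , i , ≡.≢-sym i₀≢i₁ , ≡.≢-sym i≢i₀ , ≡.≢-sym i≢i₁ , h)))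
            (area-nonneg i (≡.≢-sym i₀≢i₁)))

  module OneAngle (one : ∀ θ θ′ → AngleValue R P θ → AngleValue R P θ′ → θ ≈ θ′) where

    equilateral : ∀ {i j k} → Triangle i j k → D i j ≈ D j k × D i j ≈ D i k
    equilateral {i} {j} {k} t@(i≢j , j≢k , i≢k , _) =
      trans (proj₁ sides) (D-sym k j) , proj₂ sides
      where
      atJ = triangle-angle t
      atI = triangle-angle (triangle-rotate t)
      atK = triangle-angle (triangle-rotate (triangle-swap t))
      c = proj₁ (proj₂ (proj₂ atJ))
      -- The angles at the three vertices come packaged with different side lengths. `forget`
      -- quantifies these away, so that `same` can compare any two of them by injectivity of arccos.
      same : (a b : ∃ λ θ → AngleValue R P θ × ∃ λ c → ∃ λ x → ∃ λ y → ∃ λ z →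
        HasCosine x y z c × IsArccos R c θ × - 1# < c × c < 1#) → proj₁ (proj₂ (proj₂ a)) ≈ proj₁ (proj₂ (proj₂ b))
      same (θ , v , c , _ , _ , _ , _ , a , l , u) (θ′ , v′ , c′ , _ , _ , _ , _ , a′ , l′ , u′) =
        arccos-injective (inj₁ l) (inj₁ u) (inj₁ l′) (inj₁ u′) a a′ (one θ θ′ v v′)
      forget : ∀ {x y z} → (∃ λ θ → AngleValue R P θ × ∃ λ c → HasCosine x y z c × IsArccos R c θ ×
          - 1# < c × c < 1#) →
        ∃ λ θ → AngleValue R P θ × ∃ λ c → ∃ λ x → ∃ λ y → ∃ λ z → HasCosine x y z c × IsArccos R c θ ×
            - 1# < c × c < 1#
      forget (θ , v , c , rest) = θ , v , c , _ , _ , _ , rest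
      sides : D i j ≈ D k j × D i j ≈ D i k
      sides = equiangular⇒equilateral (D-pos i≢j) (D-pos (≡.≢-sym j≢k)) (D-pos i≢k)
        (proj₁ (proj₂ (proj₂ (proj₂ (proj₂ (proj₂ atJ))))))
        (proj₁ (proj₂ (proj₂ (proj₂ atJ))))
        (hasCosine-resp (D-sym j i) (D-sym k i) (D-sym j k) (same (forget atJ) (forget atI))
            (proj₁ (proj₂ (proj₂ (proj₂ atI)))))
        (hasCosine-resp (D-sym j k) refl (D-sym j i) (same (forget atJ) (forget atK))
            (proj₁ (proj₂ (proj₂ (proj₂ atK)))))

    -- A point w on the line through i and j would make both i w k and j w k
    -- equilateral, putting w at distance |ij| from both i and j.
    extend : ∀ {i j k} w → Triangle i j k → w ≢ i → w ≢ j → Triangle i j w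
    extend {i} {j} {k} w t@(i≢j , j≢k , i≢k , 0<h) w≢i w≢j = i≢j , ≡.≢-sym w≢j , ≡.≢-sym w≢i ,
      ≤∧≉⇒< (area-nonneg w i≢j) λ 0≈h → degenerate (heron≈0⇒on-line (P i) (P j) (P w) (D-pos i≢j) (sym 0≈h))
      where
      X = D i j
      degenerate : (∃ λ t → ∀ m → P w m ≈ P j m + t * (P i m - P j m)) → ⊥
      degenerate (s , w≈) = <-irrefl (sym 3≈0) (+-pos 0<2 0<1)
        where
        distance : ∀ m → D w m ≈ s * s * X - s * (X + D j m - D i m) + D j m
        distance m = stewart (P i) (P j) (P w) (P m) s w≈
        wj : D w j ≈ s * s * X
        wj = trans (distance j) (trans (+-cong (+-congˡ
            (-‿cong (*-congˡ (+-congʳ (+-congˡ (dist²-refl (P j))))))) (dist²-refl (P j)))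
          (solve 2 (λ s X → s :* s :* X :- s :* (X :+ :0 :- X) :+ :0 := s :* s :* X) refl s X))
        wi : D w i ≈ (1# - s) * (1# - s) * X
        wi = trans (distance i) (trans (+-cong (+-congˡ
            (-‿cong (*-congˡ (+-cong (+-congˡ (D-sym j i)) (-‿cong (dist²-refl (P i))))))) (D-sym j i))
          (solve 2 (λ s X → s :* s :* X :- s :* (X :+ X :- :0) :+ X := (:1 :- s) :* (:1 :- s) :* X) refl s X))
        wk : D w k ≈ s * s * X - s * (X + D k j - D i k) + D k j
        wk = trans (distance k) (+-cong (+-congˡ (-‿cong (*-congˡ (+-congʳ (+-congˡ (D-sym j k)))))) (D-sym j k))
        w≢k : w ≢ k
        w≢k ≡.refl = <⇒≉ 0<h (sym (begin
          heron X (D w j) (D i w)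
            ≈⟨ heron-cong refl wj (trans (D-sym i w) wi) ⟩
          heron X (s * s * X) ((1# - s) * (1# - s) * X)
            ≈⟨ solve 2 (λ s X → :heron X (s :* s :* X) ((:1 :- s) :* (:1 :- s) :* X) := :0) refl s X ⟩
          0# ∎))
        -- The triangles on `w j k` and `w i k` have the apex `k` of `i j k` and bases scaled by |s|
        -- and |1 - s|. Since `area` is quadratic in the true area, it scales by s² and (1 - s)².
        scaled : ∀ {a z} → ¬ z ≈ 0# → a ≈ z * z * area i j k → 0# < a
        scaled z≉0 eq = <-respʳ-≈ (sym eq) (*-pos (0<x² z≉0) 0<h)
        s≉0 : ¬ s ≈ 0#
        s≉0 s≈0 = >⇒≉ (D-pos w≢j) (trans wj (trans (*-congʳ (trans (*-congʳ s≈0) (zeroˡ s))) (zeroˡ X)))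
        1-s≉0 : ¬ 1# - s ≈ 0#
        1-s≉0 1-s≈0 = >⇒≉ (D-pos w≢i) (trans wi (trans (*-congʳ (trans (*-congʳ 1-s≈0) (zeroˡ _))) (zeroˡ X)))
        triangle-wjk : Triangle w j k
        triangle-wjk = w≢j , j≢k , w≢k , scaled s≉0 (trans (heron-cong wj refl wk)
          (solve 4 (λ s X Y Z → :heron (s :* s :* X) Z (s :* s :* X :- s :* (X :+ Z :- Y) :+ Z) := s :* s :*
              :heron X Z Y)
            refl s X (D i k) (D k j)))
        triangle-wik : Triangle w i k
        triangle-wik = w≢i , i≢k , w≢k , scaled 1-s≉0 (trans (heron-cong wi (D-sym k i) wk)
          (solve 4 (λ s X Y Z → :heron ((:1 :- s) :* (:1 :- s) :* X) Y (s :* s :* X :- s :* (X :+ Z :- Y) :+ Z)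
              := (:1 :- s) :* (:1 :- s) :* :heron X Z Y)
            refl s X (D i k) (D k j)))
        -- Being at distance |ij| from both ends means s² = (1 - s)² = 1. Subtracting gives 2s = 1,
        -- hence 4 = 4s² = 1, although 3 is positive.
        s²≈1 : s * s ≈ 1#
        s²≈1 = *-cancelˡ (>⇒≉ (D-pos i≢j)) (trans (*-comm X _) (trans (sym wj)
          (trans (proj₁ (equilateral triangle-wjk)) (trans (sym (proj₁ (equilateral t))) (sym (*-identityʳ X))))))
        [1-s]²≈1 : (1# - s) * (1# - s) ≈ 1#
        [1-s]²≈1 = *-cancelˡ (>⇒≉ (D-pos i≢j)) (trans (*-comm X _) (trans (sym wi)
          (trans (proj₁ (equilateral triangle-wik)) (trans (sym (proj₂ (equilateral t))) (sym (*-identityʳ X))))))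
        2s≈1 : 2# * s ≈ 1#
        2s≈1 = begin
          2# * s
            ≈⟨ solve 1 (λ s → :2 :* s := :1 :+ s :* s :- (:1 :- s) :* (:1 :- s)) refl s ⟩
          1# + s * s - (1# - s) * (1# - s)         ≈⟨ +-cong (+-congˡ s²≈1) (-‿cong [1-s]²≈1) ⟩
          1# + 1# - 1#                             ≈⟨ solve 0 (:1 :+ :1 :- :1 := :1) refl ⟩
          1#                                       ∎
        3≈0 : 2# + 1# ≈ 0#
        3≈0 = begin
          2# + 1#                                  ≈⟨ solve 0 (:2 :+ :1 := (:2 :+ :2) :* :1 :- :1 :* :1) refl ⟩
          4# * 1# - 1# * 1#
            ≈⟨ +-cong (*-congˡ (sym s²≈1)) (-‿cong (*-cong (sym 2s≈1) (sym 2s≈1))) ⟩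
          4# * (s * s) - 2# * s * (2# * s)
            ≈⟨ solve 1 (λ s → (:2 :+ :2) :* (s :* s) :- :2 :* s :* (:2 :* s) := :0) refl s ⟩
          0#                                       ∎

    equidistant-from : ∀ {i j k} → Triangle i j k → ∀ w → w ≢ i → D i w ≈ D i j
    equidistant-from {i} {j} t w w≢i with w ≟ᶠ j
    ... | yes ≡.refl = refl
    ... | no w≢j = sym (proj₂ (equilateral (extend w t w≢i w≢j)))

    -- `extend` replaces the third vertex of a triangle by any other point and keeps it
    -- nondegenerate. Permuting vertices and extending again carries the side `i j` to `i v` and
    -- then to `v w`, always within equilateral triangles.
    equidistant : ∀ {i j k} → Triangle i j k → ∀ v w → v ≢ w → D v w ≈ D i j
    equidistant {i} {j} {k} t v w v≢w with v ≟ᶠ i | w ≟ᶠ i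
    ... | yes ≡.refl | _ = equidistant-from t w (≡.≢-sym v≢w)
    ... | no v≢i | yes ≡.refl = trans (D-sym v i) (equidistant-from t v v≢w)
    ... | no v≢i | no w≢i with v ≟ᶠ j
    ...   | yes ≡.refl = sym (proj₁ (equilateral (extend w t w≢i (≡.≢-sym v≢w))))
    ...   | no v≢j = trans (sym (proj₁ (equilateral ivw))) (sym (proj₂ (equilateral ijv)))
      where
      ijv = extend v t v≢i v≢j
      ivj = triangle-rotate (triangle-swap (triangle-rotate ijv))
      ivw = extend w ivj w≢i (≡.≢-sym v≢w)

  -- With one point as origin, the differences to d + 1 others have Gram matrix r (I + J), where 2r
  -- is the common squared distance.
  one-angle⇒small : ¬ Collinear R P → 2 ℕ.≤ n → (∀ θ θ′ → AngleValue R P θ → AngleValue R P θ′ → θ ≈ θ′) →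
    ¬ suc (suc d) ℕ.≤ n
  one-angle⇒small ¬collinear (ℕ.s≤s (ℕ.s≤s ℕ.z≤n)) one (ℕ.s≤s d<n) with triangle-exists {zero} {suc zero}
      (λ ()) ¬collinear
  ... | i , j , k , t@(i≢j , _) = no-long-equiangular-family r 0<r u diag offDiag
    where
    open OneAngle one
    half = divide 2# (D i j) (>⇒≉ 0<2)
    r = proj₁ half
    0<r : 0# < r
    0<r = *-cancelˡ-pos (inj₁ 0<2) (<-respʳ-≈ (sym (proj₂ half)) (D-pos i≢j))
    index : Fin (suc d) → Fin n
    index m = suc (inject≤ m d<n)
    u : Fin (suc d) → Vector Carrier d
    u m = vec R (P zero) (P (index m))
    diag : ∀ m → u m · u m ≈ 2# * r
    diag m = trans (equidistant t (index m) zero (λ ())) (sym (proj₂ half))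
    offDiag : ∀ m m′ → m ≢ m′ → u m · u m′ ≈ r
    offDiag m m′ m≢m′ = *-cancelˡ (>⇒≉ 0<2) (begin
      2# * (u m · u m′)
        ≈⟨ law-of-cosines (P (index m)) (P zero) (P (index m′)) ⟩
      D (index m) zero + D (index m′) zero - D (index m) (index m′)
        ≈⟨ +-cong (+-cong (equidistant t (index m) zero (λ ())) (equidistant t (index m′) zero (λ ())))
             (-‿cong (equidistant t (index m) (index m′) λ eq → m≢m′
                 (inject≤-injective d<n d<n m m′ (sucᶠ-injective eq)))) ⟩
      D i j + D i j - D i j
        ≈⟨ solve 1 (λ x → x :+ x :- x := x) refl (D i j) ⟩
      D i j
        ≈⟨ proj₂ half ⟨
      2# * r ∎)

-- Minima and counting of angle values

least : ExcludedMiddle 0ℓ → (Q : Pred ℕ 0ℓ) → ∃ Q → ∃ λ a → Q a × (∀ m → Q m → a ℕ.≤ m)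
least em Q (b , qb) = search b 0 (λ _ _ → ℕ.z≤n) (≡.subst Q (≡.sym (ℕ.+-identityʳ b)) qb)
  where
  search : ∀ fuel a → (∀ m → Q m → a ℕ.≤ m) → Q (fuel ℕ.+ a) → ∃ λ a → Q a × (∀ m → Q m → a ℕ.≤ m)
  search zero       a below q = a , q , below
  search (suc fuel) a below q with em {Q a}
  ... | yes qa = a , qa , below
  ... | no ¬qa = search fuel (suc a) (λ m qm → ℕ.≤∧≢⇒< (below m qm) λ { ≡.refl → ¬qa qm })
                   (≡.subst Q (≡.sym (ℕ.+-suc fuel a)) q)

module Counting (em : ExcludedMiddle 0ℓ) (R : CompleteOrderedField) where
  open RealProperties R
  open ArccosProperties R
  open EuclideanProperties R
  open CosineProperties R

  -- A head of the list that matches no element of `S` is dropped; otherwise a matching `y` is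
  -- enumerated and removed from `S`, so repeated entries find nothing left to match. The value
  -- enumerated is `y` and not the entry `x`, because `S` need not be closed under `≈`.
  cardinality≤length : (xs : List Carrier) (S : Pred Carrier 0ℓ) → (∀ x → S x → Any (x ≈_) xs) →
    ∃ λ m → m ℕ.≤ length xs × HasCardinality R S m
  cardinality≤length [] S cover = 0 , ℕ.z≤n , (λ ()) , (λ {i} → ⊥-elim (absurd i)) , (λ ()) , λ x x∈S → ⊥-elim
      (none (cover x x∈S))
    where
    absurd : Fin 0 → ⊥
    absurd ()
    none : ∀ {x} → Any (x ≈_) [] → ⊥
    none ()
  cardinality≤length (x ∷ xs) S cover with em {∃ λ y → S y × y ≈ x}
  ... | no x∉S = proj₁ ih , ℕ.m≤n⇒m≤1+n (proj₁ (proj₂ ih)) , proj₂ (proj₂ ih)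
    where
    tailCover : ∀ z → S z → Any (z ≈_) xs
    tailCover z z∈S with cover z z∈S
    ... | here z≈x = ⊥-elim (x∉S (z , z∈S , z≈x))
    ... | there p  = p
    ih = cardinality≤length xs S tailCover
  ... | yes (y , y∈S , y≈x) with cardinality≤length xs (λ z → S z × ¬ z ≈ y) tailCover
    where
    tailCover : ∀ z → S z × ¬ z ≈ y → Any (z ≈_) xs
    tailCover z (z∈S , z≉y) with cover z z∈S
    ... | here z≈x = ⊥-elim (z≉y (trans z≈x (sym y≈x)))
    ... | there p  = p
  ...   | m , m≤ , g , g-inj , g∈ , g-onto = suc m , ℕ.s≤s m≤ , f , (λ {i} {j} → f-inj i j) , f∈ , f-onto
    where
    f : Fin (suc m) → Carrier
    f zero    = y
    f (suc i) = g i
    f-inj : ∀ i j → f i ≈ f j → i ≡ j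
    f-inj zero    zero    _  = ≡.refl
    f-inj zero    (suc j) eq = ⊥-elim (proj₂ (g∈ j) (sym eq))
    f-inj (suc i) zero    eq = ⊥-elim (proj₂ (g∈ i) eq)
    f-inj (suc i) (suc j) eq = ≡.cong suc (g-inj eq)
    f∈ : ∀ i → S (f i)
    f∈ zero    = y∈S
    f∈ (suc i) = proj₁ (g∈ i)
    f-onto : ∀ z → S z → ∃ λ i → z ≈ f i
    f-onto z z∈S with z ≟ y
    ... | yes z≈y = zero , z≈y
    ... | no  z≉y with g-onto z (z∈S , z≉y)
    ...   | i , z≈gi = suc i , z≈gi

  dist²-pos⇒isPointSet : ∀ {d n} {P : Fin n → Point R d} →
    (∀ i j → i ≢ j → 0# < dist² (P i) (P j)) → IsPointSet R P
  dist²-pos⇒isPointSet {P = P} pos {i} {j} eq with i ≟ᶠ j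
  ... | yes i≡j = i≡j
  ... | no  i≢j = ⊥-elim (>⇒≉ (pos i j i≢j)
        (sum≈0 (λ k → trans (*-congʳ (x≈y⇒x-y≈0 (eq k))) (zeroˡ _))))
    where open LinearDependence orderedField using (sum≈0)

  module _ {d n : ℕ} (P : Fin n → Point R d)
    (pos : ∀ i j → i ≢ j → 0# < dist² (P i) (P j)) where

    -- The list only has to cover: repeated cosines, and cosines attained by no triple, merely make
    -- the bound coarser. By monotonicity of suprema one cosine determines one angle, so passing to
    -- angles does not lengthen the list.
    angleCount≤ : ¬ Collinear R P → (cs : List Carrier) →
      (∀ i j k → i ≢ j → j ≢ k → i ≢ k →
        Any (HasCosine (dist² (P i) (P j)) (dist² (P k) (P j)) (dist² (P i) (P k))) cs) →
      ∃ λ m → m ℕ.≤ length cs × AngleCount R d n m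
    angleCount≤ ¬collinear cs cosines = m , ≡.subst (m ℕ.≤_) (length-map angle cs) (proj₁ (proj₂ cardinality)) ,
      P , dist²-pos⇒isPointSet pos , ¬collinear , proj₂ (proj₂ cardinality)
      where
      -- The default `0#` stands for listed values that are the cosine of nothing; `angleOf-correct`
      -- shows that no actual angle is sent there.
      angleOf : (c : Carrier) → Dec (∃ λ θ → ∃ λ c′ → c′ ≈ c × IsArccos R c′ θ) → Carrier
      angleOf c (yes (θ , _)) = θ
      angleOf c (no _)        = 0#
      angle : Carrier → Carrier
      angle c = angleOf c (em {∃ λ θ → ∃ λ c′ → c′ ≈ c × IsArccos R c′ θ})
      angleOf-correct : ∀ {c c′ θ} dec → c′ ≈ c → IsArccos R c′ θ → θ ≈ angleOf c dec
      angleOf-correct (yes (_ , _ , eq , a)) eq′ a′ = arccos-cong (trans eq′ (sym eq)) a′ a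
      angleOf-correct (no none) eq′ a′ = ⊥-elim (none (_ , _ , eq′ , a′))
      cover : ∀ θ → AngleValue R P θ → Any (θ ≈_) (map angle cs)
      cover θ ((i , j , k , i≢j , j≢k , i≢k , isAngle) , _) =
        Any.map⁺ (Any.map match (cosines i j k i≢j j≢k i≢k))
        where
        cos = isAngle⇒hasCosine (P i) (P j) (P k) isAngle
        match : ∀ {c} → HasCosine (dist² (P i) (P j)) (dist² (P k) (P j)) (dist² (P i) (P k)) c → θ ≈ angle c
        match {c} cos′ = angleOf-correct {c} {proj₁ cos} (em {∃ λ θ → ∃ λ c′ → c′ ≈ c × IsArccos R c′ θ})
          (cosine-unique (pos i j i≢j) (pos k j (≡.≢-sym j≢k)) refl refl refl (proj₁ (proj₂ cos)) cos′)
              (proj₂ (proj₂ cos))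
      cardinality : ∃ λ m → m ℕ.≤ length (map angle cs) × HasCardinality R (AngleValue R P) m
      cardinality = cardinality≤length (map angle cs) (AngleValue R P) cover
      m : ℕ
      m = proj₁ cardinality

  1≤angleCount : ∀ {d n m} → 2 ℕ.≤ n → AngleCount R d n m → 1 ℕ.≤ m
  1≤angleCount {m = suc m} _ _ = ℕ.s≤s ℕ.z≤n
  1≤angleCount {m = zero} (ℕ.s≤s (ℕ.s≤s ℕ.z≤n)) (P , isPointSet , ¬collinear , _ , _ , _ , onto) =
    ⊥-elim (noFin (proj₁ (onto (proj₁ angle) (proj₁ (proj₂ angle)))))
    where
    open LowerBound em R P isPointSet
    noFin : Fin 0 → ⊥
    noFin ()
    triangle = triangle-exists {zero} {suc zero} (λ ()) ¬collinear
    angle = triangle-angle (proj₂ (proj₂ (proj₂ triangle)))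

  2≤angleCount : ∀ {d n m} → suc (suc d) ℕ.≤ n → AngleCount R d n m → 2 ℕ.≤ m
  2≤angleCount {m = suc (suc m)} _ _ = ℕ.s≤s (ℕ.s≤s ℕ.z≤n)
  2≤angleCount {m = zero} d+2≤n count with 1≤angleCount (ℕ.≤-trans (ℕ.s≤s (ℕ.s≤s ℕ.z≤n)) d+2≤n) count
  ... | ()
  2≤angleCount {m = suc zero} d+2≤n (P , isPointSet , ¬collinear , f , _ , _ , onto) =
    ⊥-elim (one-angle⇒small ¬collinear (ℕ.≤-trans (ℕ.s≤s (ℕ.s≤s ℕ.z≤n)) d+2≤n) one d+2≤n)
    where
    open LowerBound em R P isPointSet
    one : ∀ θ θ′ → AngleValue R P θ → AngleValue R P θ′ → θ ≈ θ′
    one θ θ′ v v′ with onto θ v | onto θ′ v′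
    ... | zero , eq | zero , eq′ = trans eq (sym eq′)

-- The regular simplex

module Simplex (R : CompleteOrderedField) where
  open RealProperties R
  open EuclideanProperties R
  open CosineProperties R
  open LinearDependence orderedField using (sum≈0)
  open import Relation.Binary.Reasoning.Setoid setoid

  -- The first vector is (√α , 0); the others have first coordinate β / √α, and
  -- their projections orthogonal to it again form such a family.
  equiangular-family : ∀ d α β → 0# ≤ β → β < α → ∃ λ (u : Fin d → Vector Carrier d) →
    (∀ i → u i · u i ≈ α) × (∀ i j → i ≢ j → u i · u j ≈ β)
  equiangular-family zero    α β 0≤β β<α = (λ ()) , (λ ()) , λ ()
  equiangular-family (suc d) α β 0≤β β<α = u , diag , offDiag
    where
    0<α = ≤-<-trans 0≤β β<α
    root = sqrt (inj₁ 0<α)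
    ρ = proj₁ root
    quotient = divide ρ β (>⇒≉ (sqrt-pos 0<α (proj₂ root)))
    κ = proj₁ quotient
    ακ² : α * (κ * κ) ≈ β * β
    ακ² = begin
      α * (κ * κ)         ≈⟨ *-congʳ (proj₂ (proj₂ root)) ⟨
      ρ * ρ * (κ * κ)     ≈⟨ solve 2 (λ ρ κ → ρ :* ρ :* (κ :* κ) := ρ :* κ :* (ρ :* κ)) refl ρ κ ⟩
      ρ * κ * (ρ * κ)     ≈⟨ *-cong (proj₂ quotient) (proj₂ quotient) ⟩
      β * β               ∎
    -- κ² is β²/α, which is at most β since β < α. Hence the projected family again satisfies the
    -- hypotheses, with both parameters lowered by κ².
    0≤β-κ² : 0# ≤ β - κ * κ
    0≤β-κ² = *-cancelˡ-nonneg 0<α (≤-respʳ-≈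
      (trans (solve 2 (λ α β → β :* (α :- β) := α :* β :- β :* β) refl α β)
        (trans (+-congˡ (-‿cong (sym ακ²))) (solve 3 (λ α β κ → α :* β :- α :* κ := α :* (β :- κ)) refl α β (κ * κ))))
      (*-nonneg 0≤β (inj₁ (<⇒0<- β<α))))
    ih = equiangular-family d (α - κ * κ) (β - κ * κ) 0≤β-κ² (+-monoˡ-< (- (κ * κ)) β<α)
    u : Fin (suc d) → Vector Carrier (suc d)
    u zero    = ρ Vector.∷ (λ _ → 0#)
    u (suc i) = κ Vector.∷ proj₁ ih i
    restore : ∀ {x y} → y ≈ x - κ * κ → κ * κ + y ≈ x
    restore {x} eq = trans (+-congˡ eq) (solve 2 (λ x k → k :+ (x :- k) := x) refl x (κ * κ))
    diag : ∀ i → u i · u i ≈ α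
    diag zero    = trans (+-congˡ (sum≈0 {d} (λ _ → zeroˡ 0#))) (trans (+-identityʳ (ρ * ρ)) (proj₂ (proj₂ root)))
    diag (suc i) = restore (proj₁ (proj₂ ih) i)
    first : ∀ j → u zero · u (suc j) ≈ β
    first j = trans (+-congˡ (sum≈0 (λ k → zeroˡ (proj₁ ih j k)))) (trans (+-identityʳ (ρ * κ)) (proj₂ quotient))
    offDiag : ∀ i j → i ≢ j → u i · u j ≈ β
    offDiag zero    zero    i≢j = ⊥-elim (i≢j ≡.refl)
    offDiag zero    (suc j) i≢j = first j
    offDiag (suc i) zero    i≢j = trans (·-comm (u (suc i)) (u zero)) (first i)
    offDiag (suc i) (suc j) i≢j = restore (proj₂ (proj₂ ih) i j (λ eq → i≢j (≡.cong suc eq)))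

  simplex : ∀ d → ∃ λ (P : Fin (suc d) → Point R d) → ∀ i j → i ≢ j → dist² (P i) (P j) ≈ 2#
  simplex d = P , distance
    where
    -- Squared length 2 and inner product 1 give mutual squared distances 2 - 2 + 2 = 2, equal to
    -- the squared distance from the origin, which is the remaining vertex.
    family = equiangular-family d 2# 1# (inj₁ 0<1) (<-by 0<1 (solve 0 (:1 :+ :1 :- :1 := :1) refl))
    P : Fin (suc d) → Point R d
    P zero    = λ _ → 0#
    P (suc i) = proj₁ family i
    toOrigin : ∀ i → dist² (P (suc i)) (P zero) ≈ 2#
    toOrigin i = trans (·-cong (λ k → solve 1 (λ x → x :- :0 := x) refl (P (suc i) k))
        (λ k → solve 1 (λ x → x :- :0 := x) refl (P (suc i) k)))
      (proj₁ (proj₂ family) i)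
    distance : ∀ i j → i ≢ j → dist² (P i) (P j) ≈ 2#
    distance zero    zero    i≢j = ⊥-elim (i≢j ≡.refl)
    distance zero    (suc j) i≢j = trans (dist²-sym (P zero) (P (suc j))) (toOrigin j)
    distance (suc i) zero    i≢j = toOrigin i
    distance (suc i) (suc j) i≢j = begin
      dist² (P (suc i)) (P (suc j))
        ≈⟨ dist²-gram (P (suc i)) (P (suc j)) ⟩
      P (suc i) · P (suc i) - 2# * (P (suc i) · P (suc j)) + P (suc j) · P (suc j)
        ≈⟨ +-cong (+-cong (proj₁ (proj₂ family) i)
          (-‿cong (*-congˡ (proj₂ (proj₂ family) i j (λ eq → i≢j (≡.cong suc eq))))))
             (proj₁ (proj₂ family) j) ⟩
      2# - 2# * 1# + 2#
        ≈⟨ solve 0 (:2 :- :2 :* :1 :+ :2 := :2) refl ⟩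
      2# ∎

  collinear⇒heron≈0 : ∀ {d n} (P : Fin n → Point R d) → Collinear R P → ∀ i j k →
    heron (dist² (P i) (P j)) (dist² (P k) (P j)) (dist² (P i) (P k)) ≈ 0#
  collinear⇒heron≈0 P (a , v , _ , onLine) i j k = trans (heron-cong (distance i j) (distance k j) (distance i k))
    (solve 4 (λ x y z V → :heron ((x :- y) :* (x :- y) :* V) ((z :- y) :* (z :- y) :* V)
        ((x :- z) :* (x :- z) :* V) := :0)
      refl (t i) (t j) (t k) (v · v))
    where
    t = λ i → proj₁ (onLine i)
    distance : ∀ i j → dist² (P i) (P j) ≈ (t i - t j) * (t i - t j) * (v · v)
    distance i j = trans
      (·-square (t i - t j) 0# v v (vec R (P j) (P i))
          (λ k → trans (+-cong (proj₂ (onLine i) k) (-‿cong (proj₂ (onLine j) k)))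
        (solve 4 (λ a s t v → a :+ s :* v :- (a :+ t :* v) := (s :- t) :* v :+ :0 :* v) refl (a k) (t i) (t j)
            (v k))))
      (solve 2 (λ s V → s :* s :* V :+ :2 :* (s :* :0 :* V) :+ :0 :* :0 :* V := s :* s :* V) refl (t i - t j) (v · v))

  simplex-angleCount : ExcludedMiddle 0ℓ → ∀ {d n} → 3 ℕ.≤ n → n ℕ.≤ suc d → ∃ λ m → m ℕ.≤ 1 × AngleCount R d n m
  simplex-angleCount em {d} {n} (ℕ.s≤s (ℕ.s≤s (ℕ.s≤s ℕ.z≤n))) n≤d+1 = angleCount≤ P pos ¬collinear (proj₁ half ∷ [])
      (λ i j k i≢j j≢k i≢k → here (proj₁ root , proj₁ root , sqrt-resp (sym (distance i≢j)) (proj₂ root) ,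
        sqrt-resp (sym (distance (≡.≢-sym j≢k))) (proj₂ root) , (begin
          2# * (proj₁ half * (proj₁ root * proj₁ root))  ≈⟨ *-assoc _ _ _ ⟨
          2# * proj₁ half * (proj₁ root * proj₁ root)    ≈⟨ *-cong (proj₂ half) (proj₂ (proj₂ root)) ⟩
          1# * 2#                                        ≈⟨ solve 0 (:1 :* :2 := :2 :+ :2 :- :2) refl ⟩
          2# + 2# - 2#
            ≈⟨ +-cong (+-cong (distance i≢j) (distance (≡.≢-sym j≢k))) (-‿cong (distance i≢k)) ⟨
          dist² (P i) (P j) + dist² (P k) (P j) - dist² (P i) (P k) ∎)))
    where
    open Counting em R
    P : Fin n → Point R d
    P i = proj₁ (simplex d) (inject≤ i n≤d+1)
    distance : ∀ {i j} → i ≢ j → dist² (P i) (P j) ≈ 2#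
    distance {i} {j} i≢j = proj₂ (simplex d) (inject≤ i n≤d+1) (inject≤ j n≤d+1)
      (λ eq → i≢j (inject≤-injective n≤d+1 n≤d+1 i j eq))
    pos : ∀ i j → i ≢ j → 0# < dist² (P i) (P j)
    pos i j i≢j = <-respʳ-≈ (sym (distance i≢j)) 0<2
    half = divide 2# 1# (>⇒≉ 0<2)
    root = sqrt (inj₁ 0<2)
    ¬collinear : ¬ Collinear R P
    -- `2# * 4# + 4#` is 12, Heron's expression for three squared sides equal to 2, written so that
    -- its positivity is visible.
    ¬collinear col = >⇒≉ (+-pos (*-pos 0<2 0<4) 0<4) (begin
      2# * 4# + 4#              ≈⟨ solve 0 (:2 :* (:2 :+ :2) :+ (:2 :+ :2) := :heron :2 :2 :2) refl ⟩
      heron 2# 2# 2#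
        ≈⟨ heron-cong (distance {zero} {suc zero} (λ ())) (distance {suc (suc zero)} {suc zero} (λ ()))
          (distance {zero} {suc (suc zero)} (λ ())) ⟨
      heron (dist² (P zero) (P (suc zero))) (dist² (P (suc (suc zero))) (P (suc zero)))
          (dist² (P zero) (P (suc (suc zero))))
                                ≈⟨ collinear⇒heron≈0 P col zero (suc zero) (suc (suc zero)) ⟩
      0#                        ∎)

-- Chebyshev polynomials of the second kind and their largest roots

module Chebyshev (R : CompleteOrderedField) where
  open RealProperties R
  open import Relation.Binary.Reasoning.Setoid setoid

  -- sin ((k + 1) α) = U k (cos α) · sin α
  U : ℕ → Carrier → Carrier
  U zero          x = 1#
  U (suc zero)    x = 2# * x
  U (suc (suc k)) x = 2# * x * U (suc k) x + - 1# * U k x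

  U-lipschitz : ∀ a b k → BoundedLipschitz a b (U k)
  U-lipschitz a b zero          = lipschitz-const a b 1#
  U-lipschitz a b (suc zero)    = lipschitz-* a b (lipschitz-const a b 2#) (lipschitz-id a b)
  U-lipschitz a b (suc (suc k)) = lipschitz-+ a b
    (lipschitz-* a b (U-lipschitz a b (suc zero)) (U-lipschitz a b (suc k)))
    (lipschitz-* a b (lipschitz-const a b (- 1#)) (U-lipschitz a b k))

  -- The value at 1 is k + 1; carrying the increment 1 along with positivity makes the two-step
  -- recursion go through.
  U-at-1 : ∀ k → 0# < U k 1# × U (suc k) 1# - U k 1# ≈ 1#
  U-at-1 zero    = 0<1 , solve 0 (:2 :* :1 :- :1 := :1) refl
  U-at-1 (suc k) =
    <-respʳ-≈ (trans (+-congˡ (sym (proj₂ (U-at-1 k))))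
        (solve 2 (λ x y → y :+ (x :- y) := x) refl (U (suc k) 1#) (U k 1#)))
      (+-pos (proj₁ (U-at-1 k)) 0<1) ,
    trans (solve 2 (λ x y → :2 :* :1 :* x :+ (:- :1) :* y :- x := x :- y) refl (U (suc k) 1#) (U k 1#))
        (proj₂ (U-at-1 k))

  -- The root is the cosine of π / (m + 2). `positive` yields the positive sines of its proper
  -- multiples, while `positive->` is the invariant that lets the next root, lying further right,
  -- inherit positivity in all lower degrees.
  record PrincipalRoot (m : ℕ) : Set where
    field
      root       : Carrier
      0≤root     : 0# ≤ root
      root<1     : root < 1#
      vanishes   : U (suc m) root ≈ 0#
      positive   : ∀ k → k ℕ.≤ m → 0# < U k root
      positive-> : ∀ x → root < x → x ≤ 1# → ∀ k → k ℕ.≤ suc m → 0# < U k x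

  U-cong : ∀ k {x y} → x ≈ y → U k x ≈ U k y
  U-cong zero          eq = refl
  U-cong (suc zero)    eq = *-congˡ eq
  U-cong (suc (suc k)) eq = +-cong (*-cong (*-congˡ eq) (U-cong (suc k) eq)) (*-congˡ (U-cong k eq))

  U-after-root : ∀ m x → U (suc m) x ≈ 0# → 0# < U m x → U (suc (suc m)) x < 0#
  U-after-root m x vanishes positive = <-by positive (begin
    0# - (2# * x * U (suc m) x + - 1# * U m x)
      ≈⟨ +-congˡ (-‿cong (+-congʳ (trans (*-congˡ vanishes) (zeroʳ (2# * x))))) ⟩
    0# - (0# + - 1# * U m x)
      ≈⟨ solve 1 (λ x → :0 :- (:0 :+ (:- :1) :* x) := x) refl (U m x) ⟩
    U m x ∎)

  -- At the largest root of U k one has U (k + 1) = − U (k − 1) < 0, so the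
  -- largest root of U (k + 1) lies further to the right.
  nextRoot : ∀ m → (r : PrincipalRoot m) → let open PrincipalRoot r in
    (∃ λ c → root ≤ c × c < 1# × U (suc (suc m)) c ≈ 0# × (∀ x → c < x → x ≤ 1# → 0# < U (suc (suc m)) x)) →
    PrincipalRoot (suc m)
  nextRoot m r (c , root≤c , c<1 , Uc≈0 , above) = record
    { root       = c
    ; 0≤root     = ≤-trans 0≤root root≤c
    ; root<1     = c<1
    ; vanishes   = Uc≈0
    ; positive   = positive-> c root<c (inj₁ c<1)
    ; positive-> = above′
    }
    where
    open PrincipalRoot r
    root<c : root < c
    root<c = ≤∧≉⇒< root≤c λ eq →
      <⇒≉ (U-after-root m root vanishes (positive m ℕ.≤-refl)) (trans (U-cong (suc (suc m)) eq) Uc≈0)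
    above′ : ∀ x → c < x → x ≤ 1# → ∀ k → k ℕ.≤ suc (suc m) → 0# < U k x
    above′ x c<x x≤1 k k≤ with ℕ.m≤n⇒m<n∨m≡n k≤
    ... | inj₁ (ℕ.s≤s k≤m+1) = positive-> x (<-trans root<c c<x) x≤1 k k≤m+1
    ... | inj₂ ≡.refl = above x c<x x≤1

  principalRoot : ∀ m → PrincipalRoot m
  principalRoot zero = record
    { root       = 0#
    ; 0≤root     = ≤-refl
    ; root<1     = 0<1
    ; vanishes   = zeroʳ 2#
    ; positive   = λ { zero _ → 0<1 }
    ; positive-> = λ { x 0<x x≤1 zero _ → 0<1
                     ; x 0<x x≤1 (suc zero) _ → *-pos 0<2 0<x
                     ; x 0<x x≤1 (suc (suc k)) (ℕ.s≤s ()) }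
    }
  principalRoot (suc m) = nextRoot m r (largest-root (inj₁ root<1) (U-lipschitz root 1# (suc (suc m)))
      (inj₁ (U-after-root m root vanishes (positive m ℕ.≤-refl))) (proj₁ (U-at-1 (suc (suc m)))))
    where
    r = principalRoot m
    open PrincipalRoot r

-- Rotation through multiples of π / m

OnUnitCircle : (R : CompleteOrderedField) (x y : CompleteOrderedField.Carrier R) → Set
OnUnitCircle R x y = x * x + y * y ≈ 1#
  where open CompleteOrderedField R

-- C k and S k are the cosine and the sine of k π / m.
record HalfTurn (R : CompleteOrderedField) (m : ℕ) : Set where
  open RealProperties R
  field
    C S   : ℕ → Carrier
    C-+   : ∀ a b → C (a ℕ.+ b) ≈ C a * C b - S a * S b
    S-+   : ∀ a b → S (a ℕ.+ b) ≈ S a * C b + C a * S b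
    unit  : ∀ k → C k * C k + S k * S k ≈ 1#
    S-pos : ∀ k → 0 ℕ.< k → k ℕ.< m → 0# < S k
    S-m   : S m ≈ 0#

module Rotation (R : CompleteOrderedField) (c s : CompleteOrderedField.Carrier R)
  (c²+s²≈1 : OnUnitCircle R c s) where
  open RealProperties R
  open Chebyshev R
  open import Relation.Binary.Reasoning.Setoid setoid

  -- The powers of the complex number c + i s, as pairs of real and imaginary part.
  rotation : ℕ → Carrier × Carrier
  rotation zero    = 1# , 0#
  rotation (suc k) = proj₁ (rotation k) * c - proj₂ (rotation k) * s , proj₂ (rotation k) * c + proj₁ (rotation k) * s
  C S : ℕ → Carrier
  C k = proj₁ (rotation k)
  S k = proj₂ (rotation k)
  addition : ∀ a b → C (a ℕ.+ b) ≈ C a * C b - S a * S b × S (a ℕ.+ b) ≈ S a * C b + C a * S b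
  addition zero b = solve 2 (λ x y → x := :1 :* x :- :0 :* y) refl (C b) (S b) ,
                    solve 2 (λ x y → y := :0 :* x :+ :1 :* y) refl (C b) (S b)
  addition (suc a) b =
    trans (+-cong (*-congʳ (proj₁ (addition a b))) (-‿cong (*-congʳ (proj₂ (addition a b)))))
      (solve 6 (λ x y z w c s → (x :* z :- y :* w) :* c :- (y :* z :+ x :* w) :* s :=
          (x :* c :- y :* s) :* z :- (y :* c :+ x :* s) :* w) refl (C a) (S a) (C b) (S b) c s) ,
    trans (+-cong (*-congʳ (proj₂ (addition a b))) (*-congʳ (proj₁ (addition a b))))
      (solve 6 (λ x y z w c s → (y :* z :+ x :* w) :* c :+ (x :* z :- y :* w) :* s :=
          (y :* c :+ x :* s) :* z :+ (x :* c :- y :* s) :* w) refl (C a) (S a) (C b) (S b) c s)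
  unit : ∀ k → C k * C k + S k * S k ≈ 1#
  unit zero = solve 0 (:1 :* :1 :+ :0 :* :0 := :1) refl
  unit (suc k) = begin
    C (suc k) * C (suc k) + S (suc k) * S (suc k)
      ≈⟨ solve 4 (λ x y c s → (x :* c :- y :* s) :* (x :* c :- y :* s) :+ (y :* c :+ x :* s) :* (y :* c :+ x :* s) :=
           (x :* x :+ y :* y) :* (c :* c :+ s :* s)) refl (C k) (S k) c s ⟩
    (C k * C k + S k * S k) * (c * c + s * s)   ≈⟨ *-cong (unit k) c²+s²≈1 ⟩
    1# * 1#                                     ≈⟨ *-identityˡ 1# ⟩
    1#                                          ∎
  S-U : ∀ k → S (suc k) ≈ s * U k c
  S-U zero          = solve 2 (λ c s → :0 :* c :+ :1 :* s := s :* :1) refl c s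
  S-U (suc zero)    = solve 2 (λ c s → (:0 :* c :+ :1 :* s) :* c :+ (:1 :* c :- :0 :* s) :* s := s :*
      (:2 :* c)) refl c s
  S-U (suc (suc k)) = begin
    S (3 ℕ.+ k)
      ≈⟨ solve 4 (λ x y c s → ((y :* c :+ x :* s) :* c :+ (x :* c :- y :* s) :* s) :=
           :2 :* c :* (y :* c :+ x :* s) :+ (:- :1) :* (y :* (c :* c :+ s :* s))) refl (C (suc k)) (S (suc k)) c s ⟩
    2# * c * S (2 ℕ.+ k) + - 1# * (S (suc k) * (c * c + s * s))
      ≈⟨ +-cong (*-congˡ (S-U (suc k))) (*-congˡ (trans (*-congˡ c²+s²≈1) (trans (*-identityʳ _) (S-U k)))) ⟩
    2# * c * (s * U (suc k) c) + - 1# * (s * U k c)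
      ≈⟨ solve 4 (λ c s x y → :2 :* c :* (s :* x) :+ (:- :1) :* (s :* y) := s :* (:2 :* c :* x :+ (:- :1) :* y))
           refl c s (U (suc k) c) (U k c) ⟩
    s * U (suc (suc k)) c ∎

halfTurn : ∀ R m → 2 ℕ.≤ m → HalfTurn R m
halfTurn R (suc (suc m)) (ℕ.s≤s (ℕ.s≤s ℕ.z≤n)) = record
  { C = C ; S = S
  ; C-+ = λ a b → proj₁ (addition a b) ; S-+ = λ a b → proj₂ (addition a b)
  ; unit = unit
  ; S-pos = λ { (suc k) _ (ℕ.s≤s (ℕ.s≤s k≤m)) → <-respʳ-≈ (sym (S-U k)) (*-pos 0<s (positive k k≤m)) }
  ; S-m = trans (S-U (suc m)) (trans (*-congˡ vanishes) (zeroʳ s))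
  }
  where
  open RealProperties R
  open Chebyshev R
  open PrincipalRoot (principalRoot m) renaming (root to c)
  0<1-c² : 0# < 1# - c * c
  0<1-c² = <-respʳ-≈ (trans (*-comm _ _) (solve 1 (λ c → (:1 :+ c) :* (:1 :- c) := :1 :- c :* c) refl c))
    (*-pos (<⇒0<- root<1) (+-pos-nonneg 0<1 0≤root))
  sine = sqrt (inj₁ 0<1-c²)
  s = proj₁ sine
  0<s : 0# < s
  0<s = sqrt-pos 0<1-c² (proj₂ sine)
  open Rotation R c s (trans (+-congˡ (proj₂ (proj₂ sine))) (solve 1 (λ c → c :+ (:1 :- c) := :1) refl (c * c)))

-- The regular m-gon and its inscribed angles

module Polygon (R : CompleteOrderedField) {m : ℕ} (halfTurn : HalfTurn R m) where
  open RealProperties R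
  open CosineProperties R
  open HalfTurn halfTurn public
  open import Relation.Binary.Reasoning.Setoid setoid

  C-cong : ∀ {a b} → a ≡ b → C a ≈ C b
  C-cong eq = reflexive (≡.cong C eq)

  S-cong : ∀ {a b} → a ≡ b → S a ≈ S b
  S-cong eq = reflexive (≡.cong S eq)

  -- Vertex a lies at the angle 2aα, so that half-chords and inscribed angles become whole multiples
  -- of α = π / m.
  x y : ℕ → Carrier
  x a = C (a ℕ.+ a)
  y a = S (a ℕ.+ a)

  vertexGram : ℕ → ℕ → Carrier
  vertexGram a b = x a * x b + y a * y b

  side² : ℕ → ℕ → Carrier
  side² a b = 2# - 2# * vertexGram a b

  infix 4 _≋ᵥ_
  -- Indices are compared as points of the circle, so that a and a + m name the same vertex and no
  -- arithmetic modulo m is required.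
  record _≋ᵥ_ (a b : ℕ) : Set where
    constructor _,_
    field
      x≈ : x a ≈ x b
      y≈ : y a ≈ y b

  ≋ᵥ-reflexive : ∀ {a b} → a ≡ b → a ≋ᵥ b
  ≋ᵥ-reflexive ≡.refl = refl , refl

  ≋ᵥ-sym : ∀ {a b} → a ≋ᵥ b → b ≋ᵥ a
  ≋ᵥ-sym (p , q) = sym p , sym q

  ≋ᵥ-trans : ∀ {a b c} → a ≋ᵥ b → b ≋ᵥ c → a ≋ᵥ c
  ≋ᵥ-trans (p , q) (r , s) = trans p r , trans q s

  side²-cong : ∀ {a b a′ b′} → a ≋ᵥ a′ → b ≋ᵥ b′ → side² a b ≈ side² a′ b′
  side²-cong (p , q) (r , s) = +-congˡ (-‿cong (*-congˡ (+-cong (*-cong p r) (*-cong q s))))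

  side²-sym : ∀ a b → side² a b ≈ side² b a
  side²-sym a b = +-congˡ (-‿cong (*-congˡ (+-cong (*-comm _ _) (*-comm _ _))))

  side²-refl : ∀ a → side² a a ≈ 0#
  side²-refl a = trans (+-congˡ (-‿cong (*-congˡ (unit (a ℕ.+ a))))) (solve 0 (:2 :- :2 :* :1 := :0) refl)

  C-double : ∀ k → C (k ℕ.+ k) ≈ 1# - 2# * (S k * S k)
  C-double k = begin
    C (k ℕ.+ k)                                    ≈⟨ C-+ k k ⟩
    C k * C k - S k * S k
      ≈⟨ solve 2 (λ c s → c :- s := c :+ s :- :2 :* s) refl (C k * C k) (S k * S k) ⟩
    C k * C k + S k * S k - 2# * (S k * S k)       ≈⟨ +-congʳ (unit k) ⟩
    1# - 2# * (S k * S k)                          ∎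

  side²-chord : ∀ b k → side² (b ℕ.+ k) b ≈ 4# * (S k * S k)
  side²-chord b k = begin
    2# - 2# * (x (b ℕ.+ k) * x b + y (b ℕ.+ k) * y b)
      ≈⟨ +-congˡ (-‿cong (*-congˡ (+-cong (*-congʳ (trans (C-cong (interchange b k b k)) (C-+ (b ℕ.+ b) (k ℕ.+ k))))
           (*-congʳ (trans (S-cong (interchange b k b k)) (S-+ (b ℕ.+ b) (k ℕ.+ k))))))) ⟩
    2# - 2# * ((x b * C (k ℕ.+ k) - y b * S (k ℕ.+ k)) * x b + (y b * C (k ℕ.+ k) + x b * S (k ℕ.+ k)) * y b)
      ≈⟨ solve 4 (λ x y c s → :2 :- :2 :* ((x :* c :- y :* s) :* x :+ (y :* c :+ x :* s) :* y) :=
           :2 :- :2 :* (c :* (x :* x :+ y :* y))) refl (x b) (y b) (C (k ℕ.+ k)) (S (k ℕ.+ k)) ⟩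
    2# - 2# * (C (k ℕ.+ k) * (x b * x b + y b * y b))
      ≈⟨ +-congˡ (-‿cong (*-congˡ (*-cong (C-double k) (unit (b ℕ.+ b))))) ⟩
    2# - 2# * ((1# - 2# * (S k * S k)) * 1#)
      ≈⟨ solve 1 (λ s → :2 :- :2 :* ((:1 :- :2 :* s) :* :1) := (:2 :+ :2) :* s) refl (S k * S k) ⟩
    4# * (S k * S k) ∎

  full-turn : ∀ a → (a ℕ.+ m) ≋ᵥ a
  full-turn a =
    trans (C-cong (interchange a m a m)) (trans (C-+ (a ℕ.+ a) (m ℕ.+ m))
      (trans (+-cong (*-congˡ C2m) (-‿cong (*-congˡ S2m)))
          (solve 2 (λ x y → x :* :1 :- y :* :0 := x) refl (x a) (y a)))) ,
    trans (S-cong (interchange a m a m)) (trans (S-+ (a ℕ.+ a) (m ℕ.+ m))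
      (trans (+-cong (*-congˡ C2m) (*-congˡ S2m)) (solve 2 (λ x y → y :* :1 :+ x :* :0 := y) refl (x a) (y a))))
    where
    C2m : C (m ℕ.+ m) ≈ 1#
    C2m = trans (C-double m) (trans (+-congˡ (-‿cong (*-congˡ (*-cong S-m S-m))))
        (solve 0 (:1 :- :2 :* (:0 :* :0) := :1) refl))
    S2m : S (m ℕ.+ m) ≈ 0#
    S2m = trans (S-+ m m) (trans (+-cong (*-congʳ S-m) (*-congˡ S-m))
        (solve 1 (λ c → :0 :* c :+ c :* :0 := :0) refl (C m)))

  -- The number of steps from vertex b forward to vertex a. When a precedes b, one full turn is
  -- added to a first.
  record Gap (a b : ℕ) : Set where
    constructor mkGap
    field
      width : ℕ
      0<    : 0 ℕ.< width
      <m    : width ℕ.< m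
      turn  : b ℕ.+ width ≋ᵥ a

  gap : ∀ {a b} → a ℕ.< m → b ℕ.< m → a ≢ b → Gap a b
  gap {a} {b} a<m b<m a≢b with ℕ.<-cmp a b
  ... | tri≈ _ a≡b _ = ⊥-elim (a≢b a≡b)
  ... | tri> _ _ b<a = mkGap (a ℕ.∸ b) (ℕ.m<n⇒0<n∸m b<a) (ℕ.≤-<-trans (ℕ.m∸n≤m a b) a<m)
      (≋ᵥ-reflexive (ℕ.m+[n∸m]≡n (ℕ.<⇒≤ b<a)))
  ... | tri< a<b _ _ = mkGap ((a ℕ.+ m) ℕ.∸ b) (ℕ.m<n⇒0<n∸m b<a+m)
      (ℕ.+-cancelˡ-< b _ _ (≡.subst (ℕ._< b ℕ.+ m) (≡.sym (ℕ.m+[n∸m]≡n (ℕ.<⇒≤ b<a+m))) (ℕ.+-monoˡ-< m a<b)))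
      (≋ᵥ-trans (≋ᵥ-reflexive (ℕ.m+[n∸m]≡n (ℕ.<⇒≤ b<a+m))) (full-turn a))
    where
    b<a+m : b ℕ.< a ℕ.+ m
    b<a+m = ℕ.<-≤-trans b<m (ℕ.m≤n+m m a)

  side²-gap : ∀ {a b} (g : Gap a b) → side² a b ≈ 4# * (S (Gap.width g) * S (Gap.width g))
  side²-gap {a} {b} (mkGap k _ _ t) = trans (side²-cong (≋ᵥ-sym t) (≋ᵥ-reflexive {b} ≡.refl)) (side²-chord b k)

  chord-pos : ∀ {k} → 0 ℕ.< k → k ℕ.< m → 0# < 4# * (S k * S k)
  chord-pos {k} 0<k k<m = *-pos 0<4 (*-pos (S-pos k 0<k k<m) (S-pos k 0<k k<m))

  side²-pos : ∀ {a b} → a ℕ.< m → b ℕ.< m → a ≢ b → 0# < side² a b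
  side²-pos a<m b<m a≢b = <-respʳ-≈ (sym (side²-gap g)) (chord-pos (Gap.0< g) (Gap.<m g))
    where g = gap a<m b<m a≢b

  chord-sqrt : ∀ {k} → 0 ℕ.< k → k ℕ.< m → IsSqrt R (4# * (S k * S k)) (2# * S k)
  chord-sqrt {k} 0<k k<m = inj₁ (*-pos 0<2 (S-pos k 0<k k<m)) ,
    solve 1 (λ s → :2 :* s :* (:2 :* s) := (:2 :+ :2) :* (s :* s)) refl (S k)

  -- S_{u+k} = S_u C_k + C_u S_k turns this into C_u² + S_u² = 1.
  inscribed-cosine : ∀ u k → 0 ℕ.< u → u ℕ.+ k ℕ.< m →
    HasCosine (4# * (S u * S u)) (4# * (S (u ℕ.+ k) * S (u ℕ.+ k))) (4# * (S k * S k)) (C k)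
  inscribed-cosine u k 0<u u+k<m = 2# * S u , 2# * S (u ℕ.+ k) ,
    chord-sqrt 0<u (ℕ.≤-<-trans (ℕ.m≤m+n u k) u+k<m) , chord-sqrt (ℕ.<-≤-trans 0<u (ℕ.m≤m+n u k)) u+k<m , (begin
      2# * (C k * (2# * S u * (2# * S (u ℕ.+ k))))
        ≈⟨ *-congˡ (*-congˡ (*-congˡ (*-congˡ (S-+ u k)))) ⟩
      2# * (C k * (2# * S u * (2# * (S u * C k + C u * S k))))
        ≈⟨ x-y≈0⇒x≈y (trans
             (solve 4 (λ su cu sk ck →
               :2 :* (ck :* (:2 :* su :* (:2 :* (su :* ck :+ cu :* sk)))) :-
                 ((:2 :+ :2) :* (su :* su) :+ (:2 :+ :2) :* ((su :* ck :+ cu :* sk) :* (su :* ck :+ cu :* sk))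
                     :- (:2 :+ :2) :* (sk :* sk)) :=
               (:2 :+ :2) :* (su :* su) :* (ck :* ck :+ sk :* sk :- :1) :- (:2 :+ :2) :* (sk :* sk) :*
                   (cu :* cu :+ su :* su :- :1))
               refl (S u) (C u) (S k) (C k))
             (trans (+-cong (*-congˡ (x≈y⇒x-y≈0 (unit k))) (-‿cong (*-congˡ (x≈y⇒x-y≈0 (unit u)))))
               (solve 2 (λ a b → a :* :0 :- b :* :0 := :0) refl (4# * (S u * S u)) (4# * (S k * S k))))) ⟩
      4# * (S u * S u) + 4# * ((S u * C k + C u * S k) * (S u * C k + C u * S k)) - 4# * (S k * S k)
        ≈⟨ +-congʳ (+-congˡ (*-congˡ (*-cong (S-+ u k) (S-+ u k)))) ⟨
      4# * (S u * S u) + 4# * (S (u ℕ.+ k) * S (u ℕ.+ k)) - 4# * (S k * S k) ∎)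

  inscribedCosines : List Carrier
  inscribedCosines = applyUpTo (λ i → C (suc i)) (m ℕ.∸ 2)

  -- The inscribed angle theorem: seen from `b`, the chord from `a` to `c` subtends kα, where k is
  -- the difference of the gaps from `b` to its ends. Both gaps lie between 1 and m - 1, so 1 ≤ k ≤
  -- m - 2.
  inscribed∈ : ∀ {a b c} → a ℕ.< m → b ℕ.< m → c ℕ.< m → a ≢ b → c ≢ b → a ≢ c →
    Any (HasCosine (side² a b) (side² c b) (side² a c)) inscribedCosines
  inscribed∈ {a} {b} {c} a<m b<m c<m a≢b c≢b a≢c = compareGaps (gap a<m b<m a≢b) (gap c<m b<m c≢b)
    where
    ordered : ∀ {a c} (gu : Gap a b) (gv : Gap c b) → Gap.width gu ℕ.< Gap.width gv →
      Any (HasCosine (side² a b) (side² c b) (side² a c)) inscribedCosines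
    ordered {a} {c} gu@(mkGap u 0<u u<m tu) gv@(mkGap v 0<v v<m tv) u<v =
      fromWidth (v ℕ.∸ u) (ℕ.m<n⇒0<n∸m u<v) (ℕ.m+[n∸m]≡n (ℕ.<⇒≤ u<v))
      where
      fromWidth : ∀ k → 0 ℕ.< k → u ℕ.+ k ≡ v → Any (HasCosine (side² a b) (side² c b) (side² a c)) inscribedCosines
      fromWidth (suc i) _ ≡.refl = Any.applyUpTo⁺ (λ i → C (suc i))
        (hasCosine-resp (sym (side²-gap gu)) (sym (side²-gap gv)) (sym z) refl
            (inscribed-cosine u (suc i) 0<u v<m)) i<m-2
        where
        z : side² a c ≈ 4# * (S (suc i) * S (suc i))
        z = trans (side²-sym a c) (trans
          (side²-cong (≋ᵥ-trans (≋ᵥ-sym tv) (≋ᵥ-reflexive (≡.sym (ℕ.+-assoc b u (suc i))))) (≋ᵥ-sym tu))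
          (side²-chord (b ℕ.+ u) (suc i)))
        i<m-2 : i ℕ.< m ℕ.∸ 2
        i<m-2 = ℕ.m+n≤o⇒m≤o∸n (suc i) (≡.subst (ℕ._≤ m) (ℕ.+-comm 2 (suc i))
          (ℕ.≤-trans (ℕ.s≤s (ℕ.+-monoˡ-≤ (suc i) 0<u)) v<m))
    compareGaps : Gap a b → Gap c b → Any (HasCosine (side² a b) (side² c b) (side² a c)) inscribedCosines
    compareGaps gu@(mkGap u _ _ tu) gv@(mkGap v _ _ tv) with ℕ.<-cmp u v
    ... | tri< u<v _ _ = ordered gu gv u<v
    ... | tri> _ _ v<u = Any.map (λ h → hasCosine-swap (hasCosine-resp refl refl (side²-sym c a) refl h))
        (ordered gv gu v<u)
    ... | tri≈ _ ≡.refl _ = ⊥-elim (>⇒≉ (side²-pos a<m c<m a≢c)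
          (trans (side²-cong (≋ᵥ-sym tu) (≋ᵥ-sym tv)) (side²-refl (b ℕ.+ v))))

  -- `HalfTurn` records that `S m` vanishes but not the value of `C m`. Vanishing of S (k + l) makes
  -- the squares of the two sines agree, and positivity then removes the sign.
  S-supplement : ∀ k l → k ℕ.+ l ≡ m → 0 ℕ.< k → 0 ℕ.< l → S k ≈ S l
  S-supplement k l k+l≡m 0<k 0<l = sqr-injective (inj₁ (S-pos k 0<k k<m)) (inj₁ (S-pos l 0<l l<m)) (begin
    S k * S k                                       ≈⟨ *-identityʳ _ ⟨
    S k * S k * 1#                                  ≈⟨ *-congˡ (unit l) ⟨
    S k * S k * (C l * C l + S l * S l)             ≈⟨ solve 4 (λ a b c d → a :* a :* (d :* d :+ c :* c) :=
                                                         (a :* d :+ b :* c) :* (a :* d :- b :* c) :+ c :* c :*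
                                                             (b :* b :+ a :* a)) refl (S k) (C k) (S l) (C l) ⟩
    (S k * C l + C k * S l) * (S k * C l - C k * S l) + S l * S l * (C k * C k + S k * S k)
                                                    ≈⟨ +-cong (*-congʳ (trans (sym (S-+ k l))
                                                      (trans (S-cong k+l≡m) S-m))) (*-congˡ (unit k)) ⟩
    0# * (S k * C l - C k * S l) + S l * S l * 1#
      ≈⟨ solve 2 (λ a b → :0 :* a :+ b :* :1 := b) refl (S k * C l - C k * S l) (S l * S l) ⟩
    S l * S l                                       ∎)
    where
    k<m : k ℕ.< m
    k<m = ≡.subst (k ℕ.<_) k+l≡m (ℕ.m<m+n k 0<l)
    l<m : l ℕ.< m
    l<m = ≡.subst (l ℕ.<_) k+l≡m (ℕ.m<n+m l 0<k)

  -- Triangles meeting two circles depend on k only through sin kα, so k and m - k give the same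
  -- cosine; reflecting the larger of them halves the lists.
  fold : ∀ k → 0 ℕ.< k → k ℕ.< m → ∃ λ l → 0 ℕ.< l × l ℕ.+ l ℕ.≤ m × S k ≈ S l
  fold k 0<k k<m with ℕ.≤-total (k ℕ.+ k) m
  ... | inj₁ 2k≤m = k , 0<k , 2k≤m , refl
  ... | inj₂ m≤2k = m ℕ.∸ k , ℕ.m<n⇒0<n∸m k<m ,
        ≡.subst (m ℕ.∸ k ℕ.+ (m ℕ.∸ k) ℕ.≤_) (ℕ.m∸n+n≡m (ℕ.<⇒≤ k<m))
          (ℕ.+-monoʳ-≤ (m ℕ.∸ k) (ℕ.m≤n+o⇒m∸n≤o m k m≤2k)) ,
        S-supplement k (m ℕ.∸ k) (ℕ.m+[n∸m]≡n (ℕ.<⇒≤ k<m)) 0<k (ℕ.m<n⇒0<n∸m k<m)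

halve : ∀ {k n} → k ℕ.+ k ℕ.≤ n → k ℕ.≤ ⌊ n /2⌋
halve {k} {n} 2k≤n = ≡.subst (ℕ._≤ ⌊ n /2⌋) (≡.sym (ℕ.n≡⌊n+n/2⌋ k)) (ℕ.⌊n/2⌋-mono 2k≤n)

-- Lenz' configuration

module Lenz (R : CompleteOrderedField) where
  open RealProperties R
  open EuclideanProperties R
  open CosineProperties R
  open LinearDependence orderedField using (sum≈0)
  open import Relation.Binary.Reasoning.Setoid setoid

  -- The point (x , y) of the i-th of ⌊ d /2⌋ pairwise orthogonal coordinate planes.
  inPlane : ∀ d → Fin ⌊ d /2⌋ → Carrier → Carrier → Point R d
  inPlane (suc (suc d)) zero    x y = x Vector.∷ y Vector.∷ λ _ → 0#
  inPlane (suc (suc d)) (suc i) x y = 0# Vector.∷ 0# Vector.∷ inPlane d i x y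

  inPlane-same : ∀ d i x y x′ y′ → inPlane d i x y · inPlane d i x′ y′ ≈ x * x′ + y * y′
  inPlane-same (suc (suc d)) zero    x y x′ y′ = +-congˡ
      (trans (+-congˡ (sum≈0 {d} (λ _ → zeroˡ 0#))) (+-identityʳ _))
  inPlane-same (suc (suc d)) (suc i) x y x′ y′ = trans (+-congˡ (+-congˡ (inPlane-same d i x y x′ y′)))
    (solve 1 (λ s → :0 :* :0 :+ (:0 :* :0 :+ s) := s) refl (x * x′ + y * y′))

  inPlane-orthogonal : ∀ d i j x y x′ y′ → i ≢ j → inPlane d i x y · inPlane d j x′ y′ ≈ 0#
  inPlane-orthogonal (suc (suc d)) zero    zero    x y x′ y′ i≢j = ⊥-elim (i≢j ≡.refl)
  inPlane-orthogonal (suc (suc d)) zero    (suc j) x y x′ y′ i≢j =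
    trans (+-cong (zeroʳ x) (+-cong (zeroʳ y) (sum≈0 (λ k → zeroˡ (inPlane d j x′ y′ k)))))
        (solve 0 (:0 :+ (:0 :+ :0) := :0) refl)
  inPlane-orthogonal (suc (suc d)) (suc i) zero    x y x′ y′ i≢j =
    trans (+-cong (zeroˡ x′) (+-cong (zeroˡ y′) (sum≈0 (λ k → zeroʳ (inPlane d i x y k)))))
        (solve 0 (:0 :+ (:0 :+ :0) := :0) refl)
  inPlane-orthogonal (suc (suc d)) (suc i) (suc j) x y x′ y′ i≢j =
    trans (+-congˡ (+-congˡ (inPlane-orthogonal d i j x y x′ y′ (λ eq → i≢j (≡.cong suc eq)))))
      (solve 0 (:0 :* :0 :+ (:0 :* :0 :+ :0) := :0) refl)

  -- A line meets the unit sphere in at most two points.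
  sphere-¬collinear : ∀ {d n} (P : Fin n → Point R d) → 3 ℕ.≤ n → (∀ i → P i · P i ≈ 1#) →
    (∀ i j → i ≢ j → 0# < dist² (P i) (P j)) → ¬ Collinear R P
  sphere-¬collinear P (ℕ.s≤s (ℕ.s≤s (ℕ.s≤s ℕ.z≤n))) onSphere pos (a , v , v≉0 , onLine) =
    v≉0 (·-definite v (x*y≈0⇒y≈0 (t≉ (suc zero) (suc (suc zero)) (λ ()))
      (trans (solve 5 (λ r s t b V → (s :- t) :* V := (:2 :* b :+ (r :+ s) :* V) :- (:2 :* b :+ (r :+ t) :* V))
                refl (t zero) (t (suc zero)) (t (suc (suc zero))) (a · v) (v · v))
        (trans (+-cong (chord zero (suc zero) (λ ())) (-‿cong (chord zero (suc (suc zero)) (λ ()))))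
          (solve 0 (:0 :- :0 := :0) refl)))))
    where
    t = λ i → proj₁ (onLine i)
    norm : ∀ i → P i · P i ≈ a · a + 2# * (t i * (a · v)) + t i * t i * (v · v)
    norm i = trans (·-square 1# (t i) a v (P i) (λ k → trans (proj₂ (onLine i) k)
        (+-congʳ (sym (*-identityˡ (a k))))))
      (solve 4 (λ t A B V → :1 :* :1 :* A :+ :2 :* (:1 :* t :* B) :+ t :* t :* V := A :+ :2 :* (t :* B) :+ t :*
          t :* V)
        refl (t i) (a · a) (a · v) (v · v))
    t≉ : ∀ i j → i ≢ j → ¬ t i - t j ≈ 0#
    t≉ i j i≢j eq = >⇒≉ (pos i j i≢j) (sum≈0 (λ k → trans (*-congʳ (x≈y⇒x-y≈0 (same k))) (zeroˡ _)))
      where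
      same : ∀ k → P i k ≈ P j k
      same k = trans (proj₂ (onLine i) k) (trans (+-congˡ (*-congʳ (x-y≈0⇒x≈y eq))) (sym (proj₂ (onLine j) k)))
    -- Subtracting the two norm equations and cancelling `t i - t j` leaves an equation linear in
    -- the parameters. Comparing it for two different j forces v · v to vanish.
    chord : ∀ i j → i ≢ j → 2# * (a · v) + (t i + t j) * (v · v) ≈ 0#
    chord i j i≢j = x*y≈0⇒y≈0 (t≉ i j i≢j) (begin
      (t i - t j) * (2# * (a · v) + (t i + t j) * (v · v))
        ≈⟨ solve 5 (λ s t A B V → (s :- t) :* (:2 :* B :+ (s :+ t) :* V) :=
             (A :+ :2 :* (s :* B) :+ s :* s :* V) :- (A :+ :2 :* (t :* B) :+ t :* t :* V)) refl (t i) (t j)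
                 (a · a) (a · v) (v · v) ⟩
      a · a + 2# * (t i * (a · v)) + t i * t i * (v · v) - (a · a + 2# * (t j * (a · v)) + t j * t j * (v · v))
        ≈⟨ +-cong (sym (norm i)) (-‿cong (sym (norm j))) ⟩
      P i · P i - P j · P j
        ≈⟨ x≈y⇒x-y≈0 (trans (onSphere i) (sym (onSphere j))) ⟩
      0# ∎)

  module _ {m : ℕ} (halfTurn : HalfTurn R m) (3≤m : 3 ℕ.≤ m)
    (√2 1/√2 : Carrier) (√2-sqrt : IsSqrt R 2# √2) (√2*1/√2≈1 : √2 * 1/√2 ≈ 1#) where
    open Polygon R halfTurn

    -- A triangle with two vertices on one circle and the third on another is isosceles with legs
    -- √2. The first list is for the angle at the lone vertex, the second for the angles at the two
    -- others.
    apexCosines baseCosines : List Carrier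
    apexCosines = applyUpTo (λ i → C (suc i) * C (suc i)) ⌊ ℕ.pred m /2⌋
    baseCosines = applyUpTo (λ i → S (suc i) * 1/√2) ⌊ m /2⌋

    apex-cosine : ∀ {k l} → S k ≈ S l → HasCosine 2# 2# (4# * (S k * S k)) (C l * C l)
    apex-cosine {k} {l} Sk≈Sl = √2 , √2 , √2-sqrt , √2-sqrt , (begin
      2# * (C l * C l * (√2 * √2))           ≈⟨ *-congˡ (*-cong cos² (proj₂ √2-sqrt)) ⟩
      2# * ((1# - S k * S k) * 2#)
        ≈⟨ solve 1 (λ s → :2 :* ((:1 :- s) :* :2) := :2 :+ :2 :- (:2 :+ :2) :* s) refl (S k * S k) ⟩
      2# + 2# - 4# * (S k * S k)             ∎)
      where
      cos² : C l * C l ≈ 1# - S k * S k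
      cos² = begin
        C l * C l                              ≈⟨ solve 2 (λ c s → c := c :+ s :- s) refl (C l * C l) (S l * S l) ⟩
        C l * C l + S l * S l - S l * S l      ≈⟨ +-cong (unit l) (-‿cong (*-cong (sym Sk≈Sl) (sym Sk≈Sl))) ⟩
        1# - S k * S k                         ∎

    base-cosine : ∀ {k l} → 0 ℕ.< k → k ℕ.< m → S k ≈ S l → HasCosine (4# * (S k * S k)) 2# 2# (S l * 1/√2)
    base-cosine {k} {l} 0<k k<m Sk≈Sl = 2# * S k , √2 , chord-sqrt 0<k k<m , √2-sqrt , (begin
      2# * (S l * 1/√2 * (2# * S k * √2))    ≈⟨ *-congˡ (*-congʳ (*-congʳ (sym Sk≈Sl))) ⟩
      2# * (S k * 1/√2 * (2# * S k * √2))
        ≈⟨ solve 3 (λ s h r → :2 :* (s :* h :* (:2 :* s :* r)) := (:2 :+ :2) :* (s :* s) :* (r :* h)) refl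
          (S k) 1/√2 √2 ⟩
      4# * (S k * S k) * (√2 * 1/√2)         ≈⟨ *-congˡ √2*1/√2≈1 ⟩
      4# * (S k * S k) * 1#                  ≈⟨ solve 1 (λ s → s :* :1 := s :+ :2 :- :2) refl (4# * (S k * S k)) ⟩
      4# * (S k * S k) + 2# - 2#             ∎)

    equilateral-cosine : HasCosine 2# 2# 2# (1/√2 * 1/√2)
    equilateral-cosine = √2 , √2 , √2-sqrt , √2-sqrt , (begin
      2# * (1/√2 * 1/√2 * (√2 * √2))
        ≈⟨ solve 2 (λ h r → :2 :* (h :* h :* (r :* r)) := :2 :* (r :* h :* (r :* h))) refl 1/√2 √2 ⟩
      2# * (√2 * 1/√2 * (√2 * 1/√2))         ≈⟨ *-congˡ (*-cong √2*1/√2≈1 √2*1/√2≈1) ⟩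
      2# * (1# * 1#)                         ≈⟨ solve 0 (:2 :* (:1 :* :1) := :2 :+ :2 :- :2) refl ⟩
      2# + 2# - 2#                           ∎)

    -- For 2 l = m the cosine is C l ² = 0 = C l, a right angle that also occurs
    -- inside one polygon.
    apex∈ : ∀ {k} → 0 ℕ.< k → k ℕ.< m →
      Any (HasCosine 2# 2# (4# * (S k * S k))) inscribedCosines ⊎ Any (HasCosine 2# 2# (4# * (S k * S k))) apexCosines
    apex∈ {k} 0<k k<m = place (fold k 0<k k<m)
      where
      place : (∃ λ l → 0 ℕ.< l × l ℕ.+ l ℕ.≤ m × S k ≈ S l) → _
      place (suc l , _ , 2l≤m , Sk≈Sl) with ℕ.m≤n⇒m<n∨m≡n 2l≤m
      ... | inj₁ 2l<m = inj₂ (Any.applyUpTo⁺ (λ i → C (suc i) * C (suc i)) (apex-cosine {k} {suc l} Sk≈Sl)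
              (halve {suc l} {ℕ.pred m} (ℕ.<⇒≤pred 2l<m)))
      ... | inj₂ 2l≡m = inj₁ (Any.applyUpTo⁺ (λ i → C (suc i))
              (hasCosine-resp refl refl refl C≈C² (apex-cosine {k} {suc l} Sk≈Sl)) l<m-2)
        where
        -- Here m = 2 (l + 1), and m ≥ 3 excludes l = 0. Hence m/2 ≤ m - 2, so the right angle
        -- really is among the inscribed cosines.
        0<l : 0 ℕ.< l
        0<l = ℕ.n≢0⇒n>0 λ { ≡.refl → ℕ.<⇒≱ 3≤m (ℕ.≤-reflexive (≡.sym 2l≡m)) }
        l<m-2 : l ℕ.< m ℕ.∸ 2
        l<m-2 = ℕ.m+n≤o⇒m≤o∸n (suc l) (≡.subst (suc l ℕ.+ 2 ℕ.≤_) 2l≡m (ℕ.+-monoʳ-≤ (suc l) (ℕ.s≤s 0<l)))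
        C≈0 : C (suc l) ≈ 0#
        C≈0 = x*y≈0⇒y≈0 (>⇒≉ (*-pos 0<2 (S-pos (suc l) (ℕ.s≤s ℕ.z≤n)
            (≡.subst (suc l ℕ.<_) 2l≡m (ℕ.m<m+n (suc l) (ℕ.s≤s ℕ.z≤n))))))
          (trans (solve 2 (λ s c → :2 :* s :* c := s :* c :+ c :* s) refl (S (suc l)) (C (suc l)))
            (trans (sym (S-+ (suc l) (suc l))) (trans (S-cong 2l≡m) S-m)))
        C≈C² : C (suc l) ≈ C (suc l) * C (suc l)
        C≈C² = trans C≈0 (trans (sym (zeroˡ (C (suc l)))) (*-congʳ (sym C≈0)))

    base∈ : ∀ {k} → 0 ℕ.< k → k ℕ.< m → Any (HasCosine (4# * (S k * S k)) 2# 2#) baseCosines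
    base∈ {k} 0<k k<m = place (fold k 0<k k<m)
      where
      place : (∃ λ l → 0 ℕ.< l × l ℕ.+ l ℕ.≤ m × S k ≈ S l) → _
      place (suc l , _ , 2l≤m , Sk≈Sl) =
        Any.applyUpTo⁺ (λ i → S (suc i) * 1/√2) (base-cosine 0<k k<m Sk≈Sl) (halve 2l≤m)

    module _ (d : ℕ) where

      Vertex : Set
      Vertex = Fin ⌊ d /2⌋ × Fin m

      vertex : Vertex → Point R d
      vertex (i , a) = inPlane d i (x (toℕ a)) (y (toℕ a))

      vertex-norm : ∀ p → vertex p · vertex p ≈ 1#
      vertex-norm (i , a) = trans (inPlane-same d i _ _ _ _) (unit (toℕ a ℕ.+ toℕ a))

      dist²-vertex : ∀ p q {g} → vertex p · vertex q ≈ g → dist² (vertex p) (vertex q) ≈ 2# - 2# * g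
      dist²-vertex p q {g} eq = trans (dist²-gram (vertex p) (vertex q))
        (trans (+-cong (+-cong (vertex-norm p) (-‿cong (*-congˡ eq))) (vertex-norm q))
          (solve 1 (λ g → :1 :- g :+ :1 := :2 :- g) refl (2# * g)))

      dist²-samePlane : ∀ i a b → dist² (vertex (i , a)) (vertex (i , b)) ≈ side² (toℕ a) (toℕ b)
      dist²-samePlane i a b = dist²-vertex (i , a) (i , b) (inPlane-same d i _ _ _ _)

      dist²-orthogonal : ∀ i j a b → i ≢ j → dist² (vertex (i , a)) (vertex (j , b)) ≈ 2#
      dist²-orthogonal i j a b i≢j = trans (dist²-vertex (i , a) (j , b) (inPlane-orthogonal d i j _ _ _ _ i≢j))
        (solve 0 (:2 :- :2 :* :0 := :2) refl)

      toℕ-≢ : ∀ i {a b} → _≢_ {A = Vertex} (i , a) (i , b) → toℕ a ≢ toℕ b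
      toℕ-≢ i p≢q eq = p≢q (≡.cong (i ,_) (toℕ-injective eq))

      vertex-gap : ∀ i a b → _≢_ {A = Vertex} (i , a) (i , b) → Gap (toℕ a) (toℕ b)
      vertex-gap i a b p≢q = gap (toℕ<n a) (toℕ<n b) (toℕ-≢ i p≢q)

      dist²-gap : ∀ i a b (g : Gap (toℕ a) (toℕ b)) →
        dist² (vertex (i , a)) (vertex (i , b)) ≈ 4# * (S (Gap.width g) * S (Gap.width g))
      dist²-gap i a b g = trans (dist²-samePlane i a b) (side²-gap g)

      vertex-pos : ∀ p q → p ≢ q → 0# < dist² (vertex p) (vertex q)
      vertex-pos (i , a) (j , b) p≢q with i ≟ᶠ j
      ... | no i≢j = <-respʳ-≈ (sym (dist²-orthogonal i j a b i≢j)) 0<2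
      ... | yes ≡.refl = <-respʳ-≈ (sym (dist²-samePlane i a b)) (side²-pos (toℕ<n a) (toℕ<n b) (toℕ-≢ i p≢q))

      TwoPlanes ThreePlanes : Set
      TwoPlanes   = ∃ λ (i : Fin ⌊ d /2⌋) → ∃ λ j → i ≢ j
      ThreePlanes = ∃ λ (i : Fin ⌊ d /2⌋) → ∃ λ j → ∃ λ k → i ≢ j × k ≢ j × i ≢ k

      VertexCosine : (p q r : Vertex) → Carrier → Set
      VertexCosine p q r = HasCosine (dist² (vertex p) (vertex q)) (dist² (vertex r) (vertex q))
          (dist² (vertex p) (vertex r))

      -- A cosine from outside `inscribedCosines` is accompanied by the distinct planes that it
      -- needs. In low dimension these planes do not exist, which is how the shorter lists suffice
      -- there.
      classify : ∀ p q r → p ≢ q → r ≢ q → p ≢ r →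
        Any (VertexCosine p q r) inscribedCosines ⊎
        TwoPlanes × Any (VertexCosine p q r) (apexCosines ++ baseCosines) ⊎
        ThreePlanes × VertexCosine p q r (1/√2 * 1/√2)
      classify (i , a) (j , b) (k , c) p≢q r≢q p≢r with i ≟ᶠ j | k ≟ᶠ j | i ≟ᶠ k
      ... | yes ≡.refl | yes ≡.refl | _ = inj₁ (Any.map
            (hasCosine-resp (sym (dist²-samePlane i a b)) (sym (dist²-samePlane i c b))
                (sym (dist²-samePlane i a c)) refl)
            (inscribed∈ (toℕ<n a) (toℕ<n b) (toℕ<n c) (toℕ-≢ i p≢q) (toℕ-≢ i r≢q) (toℕ-≢ i p≢r)))
      ... | yes ≡.refl | no k≢i | _ = inj₂ (inj₁ ((k , i , k≢i) , Any.++⁺ʳ apexCosines (Any.map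
            (hasCosine-resp (sym (dist²-gap i a b g)) (sym (dist²-orthogonal k i c b k≢i))
                (sym (dist²-orthogonal i k a c (≡.≢-sym k≢i))) refl)
            (base∈ (Gap.0< g) (Gap.<m g)))))
        where g = vertex-gap i a b p≢q
      ... | no i≢k | yes ≡.refl | _ = inj₂ (inj₁ ((i , k , i≢k) , Any.++⁺ʳ apexCosines (Any.map
            (λ h → hasCosine-resp (sym (dist²-orthogonal i k a b i≢k)) (sym (dist²-gap k c b g))
                (sym (dist²-orthogonal i k a c i≢k)) refl (hasCosine-swap h))
            (base∈ (Gap.0< g) (Gap.<m g)))))
        where g = vertex-gap k c b r≢q
      ... | no i≢j | no _ | yes ≡.refl = side (apex∈ (Gap.0< g) (Gap.<m g))
        where
        g = vertex-gap i a c p≢r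
        resp : ∀ {c′} → HasCosine 2# 2# (4# * (S (Gap.width g) * S (Gap.width g))) c′ → VertexCosine (i , a)
            (j , b) (i , c) c′
        resp = hasCosine-resp (sym (dist²-orthogonal i j a b i≢j)) (sym (dist²-orthogonal i j c b i≢j))
            (sym (dist²-gap i a c g)) refl
        side : _ ⊎ _ → _
        side (inj₁ h) = inj₁ (Any.map resp h)
        side (inj₂ h) = inj₂ (inj₁ ((i , j , i≢j) , Any.++⁺ˡ (Any.map resp h)))
      ... | no i≢j | no k≢j | no i≢k = inj₂ (inj₂ ((i , j , k , i≢j , k≢j , i≢k) ,
            hasCosine-resp (sym (dist²-orthogonal i j a b i≢j)) (sym (dist²-orthogonal k j c b k≢j))
                (sym (dist²-orthogonal i k a c i≢k)) refl equilateral-cosine))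

      module _ (em : ExcludedMiddle 0ℓ) {n : ℕ} (3≤n : 3 ℕ.≤ n)
        (index : Fin n → Vertex) (index-injective : Injective _≡_ _≡_ index) where
        open Counting em R

        configuration : Fin n → Point R d
        configuration i = vertex (index i)

        configuration-pos : ∀ i j → i ≢ j → 0# < dist² (configuration i) (configuration j)
        configuration-pos i j i≢j = vertex-pos (index i) (index j) (λ eq → i≢j (index-injective eq))

        configuration-count : (cs : List Carrier) →
          (∀ p q r → p ≢ q → r ≢ q → p ≢ r → Any (VertexCosine p q r) cs) →
          ∃ λ m → m ℕ.≤ length cs × AngleCount R d n m
        configuration-count cs cosines = angleCount≤ configuration configuration-pos
          (sphere-¬collinear configuration 3≤n (λ i → vertex-norm (index i)) configuration-pos) cs
          (λ i j k i≢j j≢k i≢k → cosines (index i) (index j) (index k) (λ eq → i≢j (index-injective eq))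
            (λ eq → j≢k (≡.sym (index-injective eq))) (λ eq → i≢k (index-injective eq)))

        length-mixed : length (apexCosines ++ baseCosines) ≡ ℕ.pred m
        length-mixed = ≡.trans (length-++ apexCosines) (≡.trans
          (≡.cong₂ ℕ._+_ (length-applyUpTo _ ⌊ ℕ.pred m /2⌋) (length-applyUpTo _ ⌊ m /2⌋)) (split m 3≤m))
          where
          split : ∀ m → 3 ℕ.≤ m → ⌊ ℕ.pred m /2⌋ ℕ.+ ⌊ m /2⌋ ≡ ℕ.pred m
          -- `⌊ suc m /2⌋` is `⌈ m /2⌉` by definition.
          split (suc m) _ = ℕ.⌊n/2⌋+⌈n/2⌉≡n m

        one-plane : ¬ TwoPlanes → ∃ λ a → a ℕ.≤ m ℕ.∸ 2 × AngleCount R d n a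
        one-plane ¬two with configuration-count inscribedCosines cover
          where
          cover : ∀ p q r → p ≢ q → r ≢ q → p ≢ r → Any (VertexCosine p q r) inscribedCosines
          cover p q r p≢q r≢q p≢r with classify p q r p≢q r≢q p≢r
          ... | inj₁ h = h
          ... | inj₂ (inj₁ (two , _)) = ⊥-elim (¬two two)
          ... | inj₂ (inj₂ ((i , j , _ , i≢j , _) , _)) = ⊥-elim (¬two (i , j , i≢j))
        ... | a , a≤ , count = a , ≡.subst (a ℕ.≤_) (length-applyUpTo (λ i → C (suc i)) (m ℕ.∸ 2)) a≤ , count

        two-planes : ¬ ThreePlanes → ∃ λ a → a ℕ.≤ (m ℕ.∸ 2) ℕ.+ ℕ.pred m × AngleCount R d n a
        two-planes ¬three with configuration-count (inscribedCosines ++ apexCosines ++ baseCosines) cover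
          where
          cover : ∀ p q r → p ≢ q → r ≢ q → p ≢ r → Any (VertexCosine p q r)
              (inscribedCosines ++ apexCosines ++ baseCosines)
          cover p q r p≢q r≢q p≢r with classify p q r p≢q r≢q p≢r
          ... | inj₁ h = Any.++⁺ˡ h
          ... | inj₂ (inj₁ (_ , h)) = Any.++⁺ʳ inscribedCosines h
          ... | inj₂ (inj₂ (three , _)) = ⊥-elim (¬three three)
        ... | a , a≤ , count = a , ≡.subst (a ℕ.≤_) (≡.trans (length-++ inscribedCosines)
                (≡.cong₂ ℕ._+_ (length-applyUpTo (λ i → C (suc i)) (m ℕ.∸ 2)) length-mixed)) a≤ , count

        many-planes : ∃ λ a → a ℕ.≤ suc ((m ℕ.∸ 2) ℕ.+ ℕ.pred m) × AngleCount R d n a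
        many-planes with configuration-count (1/√2 * 1/√2 ∷ inscribedCosines ++ apexCosines ++ baseCosines) cover
          where
          cover : ∀ p q r → p ≢ q → r ≢ q → p ≢ r → Any (VertexCosine p q r)
              (1/√2 * 1/√2 ∷ inscribedCosines ++ apexCosines ++ baseCosines)
          cover p q r p≢q r≢q p≢r with classify p q r p≢q r≢q p≢r
          ... | inj₁ h = there (Any.++⁺ˡ h)
          ... | inj₂ (inj₁ (_ , h)) = there (Any.++⁺ʳ inscribedCosines h)
          ... | inj₂ (inj₂ (_ , h)) = here h
        ... | a , a≤ , count = a , ≡.subst (a ℕ.≤_) (≡.cong suc (≡.trans (length-++ inscribedCosines)
                (≡.cong₂ ℕ._+_ (length-applyUpTo (λ i → C (suc i)) (m ℕ.∸ 2)) length-mixed))) a≤ , count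

-- Arithmetic of the bounds and assembly

open import Data.Nat.Base using (z≤n; s≤s; pred; _+_; _*_; _∸_; _≤_; _<_; _/_; _%_)

2⌊n/2⌋≤n : ∀ n → ⌊ n /2⌋ + ⌊ n /2⌋ ≤ n
2⌊n/2⌋≤n n = ≡.subst (⌊ n /2⌋ + ⌊ n /2⌋ ≤_) (ℕ.⌊n/2⌋+⌈n/2⌉≡n n) (ℕ.+-monoʳ-≤ ⌊ n /2⌋ (ℕ.⌊n/2⌋≤⌈n/2⌉ n))

n≤2⌈n/2⌉ : ∀ n → n ≤ 2 * ⌈ n /2⌉
n≤2⌈n/2⌉ n = ≡.subst₂ _≤_ (ℕ.⌊n/2⌋+⌈n/2⌉≡n n) (≡.cong (⌈ n /2⌉ +_) (≡.sym (ℕ.+-identityʳ ⌈ n /2⌉)))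
  (ℕ.+-monoˡ-≤ ⌈ n /2⌉ (ℕ.⌊n/2⌋≤⌈n/2⌉ n))

n≤k*⌈n÷k⌉ : ∀ n k → 0 < k → n ≤ k * ⌈ n ÷ k ⌉
n≤k*⌈n÷k⌉ n (suc k) _ = ℕ.+-cancelʳ-≤ k n _ (begin
  n + k                                          ≡⟨ ℕ.m≡m%n+[m/n]*n (n + k) (suc k) ⟩
  (n + k) % suc k + (n + k) / suc k * suc k      ≤⟨ ℕ.+-monoˡ-≤ _ (ℕ.m<1+n⇒m≤n (ℕ.m%n<n (n + k) (suc k))) ⟩
  k + (n + k) / suc k * suc k                    ≡⟨ ℕ.+-comm k _ ⟩
  (n + k) / suc k * suc k + k                    ≡⟨ ≡.cong (_+ k) (ℕ.*-comm ((n + k) / suc k) (suc k)) ⟩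
  suc k * ((n + k) / suc k) + k                  ∎)
  where open ℕ.≤-Reasoning

-- With k = ⌊d/2⌋ and n > d this gives each circle room for a polygon of at least three vertices.
3≤⌈n÷k⌉ : ∀ n k → 0 < k → k + k < n → 3 ≤ ⌈ n ÷ k ⌉
3≤⌈n÷k⌉ n (suc k) _ 2k<n = ≡.subst (_≤ (n + k) / suc k) (ℕ.m*n/n≡m 3 (suc k)) (ℕ./-monoˡ-≤ (suc k) (begin
  3 * suc k                  ≡⟨ ≡.cong (λ x → suc k + (suc k + x)) (ℕ.+-identityʳ (suc k)) ⟩
  suc k + (suc k + suc k)    ≡⟨ ℕ.+-assoc (suc k) (suc k) (suc k) ⟨
  suc k + suc k + suc k      ≡⟨ ℕ.+-suc (suc k + suc k) k ⟩
  suc (suc k + suc k) + k    ≤⟨ ℕ.+-monoˡ-≤ k 2k<n ⟩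
  n + k                      ∎))
  where open ℕ.≤-Reasoning

[m-2]+[m-1]≡2m-3 : ∀ m → 3 ≤ m → m ∸ 2 + pred m ≡ 2 * m ∸ 3
[m-2]+[m-1]≡2m-3 (suc (suc (suc m))) (s≤s (s≤s (s≤s z≤n))) = ≡.trans (≡.cong suc (ℕ.+-suc m (suc m)))
  (≡.sym (≡.trans (≡.cong (m +_) (ℕ.+-identityʳ (3 + m)))
      (≡.trans (ℕ.+-suc m (2 + m)) (≡.cong suc (ℕ.+-suc m (suc m))))))

[m-2]+[m-1]+1≡2m-2 : ∀ m → 3 ≤ m → suc (m ∸ 2 + pred m) ≡ 2 * m ∸ 2
[m-2]+[m-1]+1≡2m-2 m 3≤m =
  ≡.trans (≡.cong suc ([m-2]+[m-1]≡2m-3 m 3≤m)) (≡.sym (ℕ.+-∸-assoc 1 {2 * m} {3} (ℕ.≤-trans 3≤m (ℕ.m≤m+n m _))))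

module _ (em : ExcludedMiddle 0ℓ) (R : CompleteOrderedField) (d n m : ℕ)
  (3≤m : 3 ≤ m) (3≤n : 3 ≤ n) (n≤⌊d/2⌋*m : n ≤ ⌊ d /2⌋ * m) where
  open RealProperties R using (sqrt; divide; 0<2; >⇒≉; sqrt-pos; 1#; 2#)

  -- Only n of the ⌊d/2⌋ m vertices are used, filling one circle after another; the cosine lists for
  -- all vertices cover any such selection.
  index : Fin n → Fin ⌊ d /2⌋ × Fin m
  index i = remQuot m (inject≤ i n≤⌊d/2⌋*m)

  index-injective : Injective _≡_ _≡_ index
  index-injective {i} {j} eq = inject≤-injective n≤⌊d/2⌋*m n≤⌊d/2⌋*m i j
    (≡.trans (≡.sym (combine-remQuot {⌊ d /2⌋} m (inject≤ i n≤⌊d/2⌋*m)))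
      (≡.trans (≡.cong (uncurry combine) eq) (combine-remQuot {⌊ d /2⌋} m (inject≤ j n≤⌊d/2⌋*m))))

  √2 : ∃ (IsSqrt R 2#)
  √2 = sqrt (inj₁ 0<2)

  1/√2 : ∃ λ h → _
  1/√2 = divide (proj₁ √2) 1# (>⇒≉ (sqrt-pos 0<2 (proj₂ √2)))

  private module L = Lenz R

  one-plane : ¬ (∃ λ (i : Fin ⌊ d /2⌋) → ∃ λ j → i ≢ j) → ∃ λ a → a ≤ m ∸ 2 × AngleCount R d n a
  one-plane = L.one-plane (halfTurn R m (ℕ.≤-trans (s≤s (s≤s z≤n)) 3≤m)) 3≤m
    (proj₁ √2) (proj₁ 1/√2) (proj₂ √2) (proj₂ 1/√2) d em 3≤n index index-injective

  two-planes : ¬ (∃ λ (i : Fin ⌊ d /2⌋) → ∃ λ j → ∃ λ k → i ≢ j × k ≢ j × i ≢ k) →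
    ∃ λ a → a ≤ m ∸ 2 + pred m × AngleCount R d n a
  two-planes = L.two-planes (halfTurn R m (ℕ.≤-trans (s≤s (s≤s z≤n)) 3≤m)) 3≤m
    (proj₁ √2) (proj₁ 1/√2) (proj₂ √2) (proj₂ 1/√2) d em 3≤n index index-injective

  many-planes : ∃ λ a → a ≤ suc (m ∸ 2 + pred m) × AngleCount R d n a
  many-planes = L.many-planes (halfTurn R m (ℕ.≤-trans (s≤s (s≤s z≤n)) 3≤m)) 3≤m
    (proj₁ √2) (proj₁ 1/√2) (proj₂ √2) (proj₂ 1/√2) d em 3≤n index index-injective

theorem7p3 : ExcludedMiddle 0ℓ → (R : CompleteOrderedField) → (d : ℕ) → 2 ≤ d →
    ((n : ℕ) → d + 1 < n →
    ∃ λ (a : ℕ) → IsA R d n a × 2 ≤ a ×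
    (d ≡ 2 ⊎ d ≡ 3 → a ≤ n ∸ 2) ×
    (d ≡ 4 ⊎ d ≡ 5 → a ≤ 2 * ⌈ n /2⌉ ∸ 3) ×
    (6 ≤ d → a ≤ 2 * ⌈ n ÷ ⌊ d /2⌋ ⌉ ∸ 2)) ×
    ((n : ℕ) → 3 ≤ n → n ≤ d + 1 → IsA R d n 1)
theorem7p3 em R d 2≤d = large , small
  where
  open Counting em R

  0<⌊d/2⌋ : 0 < ⌊ d /2⌋
  0<⌊d/2⌋ = ℕ.⌊n/2⌋-mono 2≤d

  large : (n : ℕ) → d + 1 < n →
    ∃ λ (a : ℕ) → IsA R d n a × 2 ≤ a ×
    (d ≡ 2 ⊎ d ≡ 3 → a ≤ n ∸ 2) ×
    (d ≡ 4 ⊎ d ≡ 5 → a ≤ 2 * ⌈ n /2⌉ ∸ 3) ×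
    (6 ≤ d → a ≤ 2 * ⌈ n ÷ ⌊ d /2⌋ ⌉ ∸ 2)
  large n d+1<n = a , (count , minimal) , 2≤angleCount d+2≤n count ,
      (λ d≡ → bound (planar d≡)) , (λ d≡ → bound (fourDimensional d≡)) , λ _ → bound higherDimensional
    where
    d+2≤n : suc (suc d) ≤ n
    d+2≤n = ≡.subst (λ x → suc x ≤ n) (ℕ.+-comm d 1) d+1<n
    3≤n : 3 ≤ n
    3≤n = ℕ.≤-trans (s≤s 2≤d) (ℕ.<⇒≤ d+2≤n)
    d<n : d < n
    d<n = ℕ.<⇒≤ d+2≤n

    planar : d ≡ 2 ⊎ d ≡ 3 → ∃ λ b → b ≤ n ∸ 2 × AngleCount R d n b
    -- There is a single plane, and the configuration is the regular n-gon.
    planar (inj₁ ≡.refl) = one-plane em R d n n 3≤n 3≤n (ℕ.m≤m+n n 0) λ { (zero , zero , i≢j) → i≢j ≡.refl }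
    planar (inj₂ ≡.refl) = one-plane em R d n n 3≤n 3≤n (ℕ.m≤m+n n 0) λ { (zero , zero , i≢j) → i≢j ≡.refl }

    ¬three : ¬ (∃ λ (i : Fin 2) → ∃ λ j → ∃ λ k → i ≢ j × k ≢ j × i ≢ k)
    ¬three (zero     , zero     , _        , i≢j , _) = i≢j ≡.refl
    ¬three (suc zero , suc zero , _        , i≢j , _) = i≢j ≡.refl
    ¬three (zero     , suc zero , suc zero , _ , k≢j , _) = k≢j ≡.refl
    ¬three (suc zero , zero     , zero     , _ , k≢j , _) = k≢j ≡.refl
    ¬three (zero     , suc zero , zero     , _ , _ , i≢k) = i≢k ≡.refl
    ¬three (suc zero , zero     , suc zero , _ , _ , i≢k) = i≢k ≡.refl

    shrink : ∀ {b b′} → b ≡ b′ → (∃ λ c → c ≤ b × AngleCount R d n c) → ∃ λ c → c ≤ b′ × AngleCount R d n c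
    shrink ≡.refl c = c

    fourDimensional : d ≡ 4 ⊎ d ≡ 5 → ∃ λ b → b ≤ 2 * ⌈ n /2⌉ ∸ 3 × AngleCount R d n b
    fourDimensional d≡ = shrink ([m-2]+[m-1]≡2m-3 ⌈ n /2⌉ 3≤m) (planes d≡)
      where
      4≤d : d ≡ 4 ⊎ d ≡ 5 → 4 ≤ d
      4≤d (inj₁ ≡.refl) = ℕ.≤-refl
      4≤d (inj₂ ≡.refl) = ℕ.n≤1+n 4
      3≤m : 3 ≤ ⌈ n /2⌉
      3≤m = ℕ.⌈n/2⌉-mono (ℕ.≤-trans (s≤s (s≤s (4≤d d≡))) d+2≤n)
      planes : d ≡ 4 ⊎ d ≡ 5 → ∃ λ b → b ≤ ⌈ n /2⌉ ∸ 2 + pred ⌈ n /2⌉ × AngleCount R d n b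
      planes (inj₁ ≡.refl) = two-planes em R d n ⌈ n /2⌉ 3≤m 3≤n (n≤2⌈n/2⌉ n) ¬three
      planes (inj₂ ≡.refl) = two-planes em R d n ⌈ n /2⌉ 3≤m 3≤n (n≤2⌈n/2⌉ n) ¬three

    higherDimensional : ∃ λ b → b ≤ 2 * ⌈ n ÷ ⌊ d /2⌋ ⌉ ∸ 2 × AngleCount R d n b
    higherDimensional = shrink ([m-2]+[m-1]+1≡2m-2 m 3≤m)
        (many-planes em R d n m 3≤m 3≤n (n≤k*⌈n÷k⌉ n ⌊ d /2⌋ 0<⌊d/2⌋))
      where
      m = ⌈ n ÷ ⌊ d /2⌋ ⌉
      3≤m : 3 ≤ m
      3≤m = 3≤⌈n÷k⌉ n ⌊ d /2⌋ 0<⌊d/2⌋ (ℕ.≤-<-trans (2⌊n/2⌋≤n d) d<n)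

    -- `higherDimensional` holds for every d ≥ 2, not only from 6 on, so it supplies the
    -- configuration that shows the minimum to exist in all dimensions.
    minimum : ∃ λ a → AngleCount R d n a × (∀ b → AngleCount R d n b → a ≤ b)
    minimum = least em (AngleCount R d n) (proj₁ higherDimensional , proj₂ (proj₂ higherDimensional))
    a = proj₁ minimum
    count : AngleCount R d n a
    count = proj₁ (proj₂ minimum)
    minimal : ∀ b → AngleCount R d n b → a ≤ b
    minimal = proj₂ (proj₂ minimum)
    bound : ∀ {b} → (∃ λ c → c ≤ b × AngleCount R d n c) → a ≤ b
    bound (c , c≤b , c-count) = ℕ.≤-trans (minimal c c-count) c≤b

  small : (n : ℕ) → 3 ≤ n → n ≤ d + 1 → IsA R d n 1
  small n 3≤n n≤d+1 = one (Simplex.simplex-angleCount R em 3≤n (≡.subst (n ≤_) (ℕ.+-comm d 1) n≤d+1)) , λ _ → positive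
    where
    positive : ∀ {m} → AngleCount R d n m → 1 ≤ m
    positive = 1≤angleCount (ℕ.≤-trans (s≤s (s≤s z≤n)) 3≤n)
    one : (∃ λ m → m ≤ 1 × AngleCount R d n m) → AngleCount R d n 1
    one (m , m≤1 , count) = ≡.subst (AngleCount R d n) (ℕ.≤-antisym m≤1 (positive count)) count
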